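{- Consider the adversarial-order secretary problem with an $\alpha$-power signal (defined in the context), where $\alpha=\alpha(n)>0$ may depend on $n$, and let $n\to\infty$. If $\alpha=o(n)$, then $\mathrm{OPT}^{\mathrm{det}}_n(\alpha)=o(1)$. If $\alpha/n\to c\in(0,\infty)$, then $\mathrm{OPT}^{\mathrm{det}}_n(\alpha)\to1-e^{ -c}$.
   Context: Notation: $[n]=\{1,\dots,n\}$. Adversarial-order secretary problem with an $\alpha$-power signal ($\alpha>0$ real): an adversary fixes an instance, i.e. a value vector $v\in\mathbb{N}_0^n$ with a unique maximum entry, located at a time $i^\star\in[n]$. Items arrive one by one at times $1,\dots,n$ in this order. A signal time $S\in[i^\star]$ is drawn with $$\Pr[S=s]=\frac{s^\alpha-(s-1)^\alpha}{(i^\star)^\alpha},\qquad s\in[i^\star].$$ At each time $t$ the policy observes $v_t$ and whether the content-free signal occurs at time $t$ ($S=t$); it then irrevocably decides whether to stop at time $t$. The policy knows $n$ and $\alpha$, but not the instance. It succeeds if it stops exactly at time $i^\star$. A deterministic policy uses no internal randomness: its decision at time $t$ is a function of the observations up to time $t$. The worst-case success probability of a policy is the infimum over all instances of length $n$ of its success probability (over the signal); $\mathrm{OPT}^{\mathrm{det}}_n(\alpha)$ is the supremum of the worst-case success probability over all deterministic policies. -}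

module Defs where

open import Data.Bool using (Bool; true; false; if_then_else_)
import Data.Bool.Properties as Bool
open import Data.Fin as Fin using (Fin; toℕ; inject≤)
import Data.Fin.Properties as Fin
open import Data.Integer as ℤ using (+_)
import Data.Integer.Properties as ℤ
open import Data.Nat as ℕ using (ℕ; zero; suc; NonZero)
import Data.Nat.Properties as ℕ
open import Data.Product using (∃; _×_; _,_; proj₁; proj₂)
open import Data.Rational as ℚ using (ℚ; 0ℚ; 1ℚ)
import Data.Rational.Properties as ℚ
open import Data.Rational.Solver using (module +-*-Solver)
open import Data.Rational.Unnormalised as ℚᵘ using (mkℚᵘ)
import Data.Rational.Unnormalised.Properties as ℚᵘ
open import Data.Sum using (inj₁; inj₂)
open import Data.Vec using (Vec; lookup; tabulate)
open import Data.Vec.Functional using (foldr)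
open import Relation.Binary.PropositionalEquality
open import Relation.Nullary using (Dec; does)
open import Relation.Nullary.Decidable using (_×-dec_; _→-dec_)

------------------------------------------------------------------------
-- Rational estimates behind the real operations

module RationalAnalysis where

  open import Data.Rational using (_+_; _-_; _*_; -_; ∣_∣; _≤_; _<_; _⊔_; 1/_)
  open +-*-Solver

  Cauchy : (ℕ → ℚ) → Set
  Cauchy a = ∀ ε → 0ℚ < ε →
    ∃ λ N → ∀ m n → N ℕ.≤ m → N ℕ.≤ n → ∣ a m - a n ∣ ≤ ε

  *-monoˡ : ∀ r {p q} → 0ℚ ≤ r → p ≤ q → r * p ≤ r * q
  *-monoˡ r 0≤r = ℚ.*-monoˡ-≤-nonNeg r {{ℚ.nonNegative 0≤r}}

  *-monoʳ : ∀ r {p q} → 0ℚ ≤ r → p ≤ q → p * r ≤ q * r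
  *-monoʳ r 0≤r = ℚ.*-monoʳ-≤-nonNeg r {{ℚ.nonNegative 0≤r}}

  *-nonNeg : ∀ {p q} → 0ℚ ≤ p → 0ℚ ≤ q → 0ℚ ≤ p * q
  *-nonNeg {p} {q} 0≤p 0≤q = ℚ.nonNegative⁻¹ (p * q)
    {{ℚ.nonNeg*nonNeg⇒nonNeg p {{ℚ.nonNegative 0≤p}} q {{ℚ.nonNegative 0≤q}}}}

  *-pos : ∀ {p q} → 0ℚ < p → 0ℚ < q → 0ℚ < p * q
  *-pos {p} {q} 0<p 0<q = ℚ.positive⁻¹ (p * q)
    {{ℚ.pos*pos⇒pos p {{ℚ.positive 0<p}} q {{ℚ.positive 0<q}}}}

  +-nonNeg : ∀ {p q} → 0ℚ ≤ p → 0ℚ ≤ q → 0ℚ ≤ p + q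
  +-nonNeg 0≤p 0≤q = ℚ.+-mono-≤ 0≤p 0≤q

  p≤p+q : ∀ p {q} → 0ℚ ≤ q → p ≤ p + q
  p≤p+q p 0≤q = ℚ.≤-trans (ℚ.≤-reflexive (sym (ℚ.+-identityʳ p))) (ℚ.+-monoʳ-≤ p 0≤q)

  1+-pos : ∀ {q} → 0ℚ ≤ q → 0ℚ < 1ℚ + q
  1+-pos 0≤q = ℚ.<-≤-trans (ℚ.positive⁻¹ 1ℚ) (p≤p+q 1ℚ 0≤q)

  ∣∣-sym : ∀ p q → ∣ p - q ∣ ≡ ∣ q - p ∣
  ∣∣-sym p q = trans
    (cong ∣_∣ (solve 2 (λ p q → p :- q := :- (q :- p)) refl p q))
    (ℚ.∣-p∣≡∣p∣ (q - p))

  ∣∣-triangle : ∀ p q r → ∣ p - r ∣ ≤ ∣ p - q ∣ + ∣ q - r ∣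
  ∣∣-triangle p q r = ℚ.≤-trans
    (ℚ.≤-reflexive (cong ∣_∣
      (solve 3 (λ p q r → p :- r := (p :- q) :+ (q :- r)) refl p q r)))
    (ℚ.∣p+q∣≤∣p∣+∣q∣ (p - q) (q - r))

  ∣p∣≤∣q∣+∣p-q∣ : ∀ p q → ∣ p ∣ ≤ ∣ q ∣ + ∣ p - q ∣
  ∣p∣≤∣q∣+∣p-q∣ p q = ℚ.≤-trans
    (ℚ.≤-reflexive (cong ∣_∣ (solve 2 (λ p q → p := q :+ (p :- q)) refl p q)))
    (ℚ.∣p+q∣≤∣p∣+∣q∣ q (p - q))

  ∣∣p∣-∣q∣∣≤∣p-q∣ : ∀ p q → ∣ ∣ p ∣ - ∣ q ∣ ∣ ≤ ∣ p - q ∣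
  ∣∣p∣-∣q∣∣≤∣p-q∣ p q with ℚ.∣p∣≡p∨∣p∣≡-p (∣ p ∣ - ∣ q ∣)
  ... | inj₁ eq = begin
      ∣ ∣ p ∣ - ∣ q ∣ ∣               ≡⟨ eq ⟩
      ∣ p ∣ - ∣ q ∣                   ≤⟨ ℚ.+-monoˡ-≤ (- ∣ q ∣) (∣p∣≤∣q∣+∣p-q∣ p q) ⟩
      ∣ q ∣ + ∣ p - q ∣ - ∣ q ∣       ≡⟨ solve 2 (λ x y → x :+ y :- x := y) refl ∣ q ∣ ∣ p - q ∣ ⟩
      ∣ p - q ∣                       ∎
    where open ℚ.≤-Reasoning
  ... | inj₂ eq = begin
      ∣ ∣ p ∣ - ∣ q ∣ ∣               ≡⟨ eq ⟩
      - (∣ p ∣ - ∣ q ∣)               ≡⟨ solve 2 (λ x y → :- (x :- y) := y :- x) refl ∣ p ∣ ∣ q ∣ ⟩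
      ∣ q ∣ - ∣ p ∣                   ≤⟨ ℚ.+-monoˡ-≤ (- ∣ p ∣) (∣p∣≤∣q∣+∣p-q∣ q p) ⟩
      ∣ p ∣ + ∣ q - p ∣ - ∣ p ∣       ≡⟨ solve 2 (λ x y → x :+ y :- x := y) refl ∣ p ∣ ∣ q - p ∣ ⟩
      ∣ q - p ∣                       ≡⟨ ∣∣-sym q p ⟩
      ∣ p - q ∣                       ∎
    where open ℚ.≤-Reasoning

  split : ∀ K → 0ℚ < K → ∀ ε → 0ℚ < ε → ∃ λ η → 0ℚ < η × K * η ≡ ε
  split K 0<K ε 0<ε =
      1/ K * ε , *-pos (ℚ.positive⁻¹ (1/ K) {{ℚ.1/pos⇒pos K}}) 0<ε ,
      trans (sym (ℚ.*-assoc K (1/ K) ε))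
        (trans (cong (_* ε) (ℚ.*-inverseʳ K)) (ℚ.*-identityˡ ε))
    where instance
      posK = ℚ.positive 0<K
      nzK = ℚ.pos⇒nonZero K

  -- Comparing every later term with the N-th one suffices, up to a constant K.
  -- Abstract, so that no modulus of convergence is ever unfolded.
  abstract
    mkCauchy : ∀ a K → 0ℚ < K →
      (∀ ε → 0ℚ < ε → ∃ λ N → ∀ n → N ℕ.≤ n → ∣ a n - a N ∣ ≤ K * ε) → Cauchy a
    mkCauchy a K 0<K h ε 0<ε = N , λ m n N≤m N≤n → begin
        ∣ a m - a n ∣                   ≤⟨ ∣∣-triangle (a m) (a N) (a n) ⟩
        ∣ a m - a N ∣ + ∣ a N - a n ∣   ≡⟨ cong (λ z → ∣ a m - a N ∣ + z) (∣∣-sym (a N) (a n)) ⟩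
        ∣ a m - a N ∣ + ∣ a n - a N ∣   ≤⟨ ℚ.+-mono-≤ (close m N≤m) (close n N≤n) ⟩
        K * η + K * η                   ≡⟨ ℚ.*-distribʳ-+ η K K ⟨
        (K + K) * η                     ≡⟨ proj₂ (proj₂ halved) ⟩
        ε                               ∎
      where
      open ℚ.≤-Reasoning
      halved : ∃ λ η → 0ℚ < η × (K + K) * η ≡ ε
      halved = split (K + K) (ℚ.+-mono-< 0<K 0<K) ε 0<ε
      η : ℚ
      η = proj₁ halved
      N : ℕ
      N = proj₁ (h η (proj₁ (proj₂ halved)))
      close : ∀ n → N ℕ.≤ n → ∣ a n - a N ∣ ≤ K * η
      close = proj₂ (h η (proj₁ (proj₂ halved)))

  eventually-bounded : ∀ {a} → Cauchy a →
    ∃ λ B → 0ℚ ≤ B × ∃ λ N → ∀ n → N ℕ.≤ n → ∣ a n ∣ ≤ B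
  eventually-bounded {a} ca =
      ∣ a N ∣ + 1ℚ
    , +-nonNeg (ℚ.0≤∣p∣ (a N)) (ℚ.nonNegative⁻¹ 1ℚ)
    , N , λ n N≤n → ℚ.≤-trans (∣p∣≤∣q∣+∣p-q∣ (a n) (a N))
                      (ℚ.+-monoʳ-≤ ∣ a N ∣ (close n N N≤n ℕ.≤-refl))
    where
    N = proj₁ (ca 1ℚ (ℚ.positive⁻¹ 1ℚ))
    close = proj₂ (ca 1ℚ (ℚ.positive⁻¹ 1ℚ))

  -- Termwise image under a map that is Lipschitz on the values taken.
  lipschitz-cauchy : ∀ {a} (f : ℚ → ℚ) C → 0ℚ ≤ C →
    (∀ p q → ∣ f p - f q ∣ ≤ C * ∣ p - q ∣) → Cauchy a → Cauchy (λ n → f (a n))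
  lipschitz-cauchy {a} f C 0≤C lip ca = mkCauchy (λ n → f (a n)) (1ℚ + C) (1+-pos 0≤C) λ ε 0<ε →
      proj₁ (ca ε 0<ε) , λ n N≤n →
        close ε (ℚ.<⇒≤ 0<ε) n (proj₁ (ca ε 0<ε)) (proj₂ (ca ε 0<ε) n _ N≤n ℕ.≤-refl)
    where
    C≤1+C : C ≤ 1ℚ + C
    C≤1+C = ℚ.≤-trans (ℚ.≤-reflexive (sym (ℚ.+-identityˡ C))) (ℚ.+-monoˡ-≤ C (ℚ.nonNegative⁻¹ 1ℚ))
    close : ∀ ε → 0ℚ ≤ ε → ∀ m n → ∣ a m - a n ∣ ≤ ε → ∣ f (a m) - f (a n) ∣ ≤ (1ℚ + C) * ε
    close ε 0≤ε m n d = ℚ.≤-trans (lip (a m) (a n)) (ℚ.≤-trans (*-monoˡ C 0≤C d) (*-monoʳ ε 0≤ε C≤1+C))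

  two : ℚ
  two = 1ℚ + 1ℚ

  const-cauchy : ∀ q → Cauchy (λ _ → q)
  const-cauchy q ε 0<ε = 0 , λ _ _ _ _ →
    subst (_≤ ε) (sym (cong ∣_∣ (ℚ.+-inverseʳ q))) (ℚ.<⇒≤ 0<ε)

  neg-cauchy : ∀ {a} → Cauchy a → Cauchy (λ n → - a n)
  neg-cauchy {a} = lipschitz-cauchy {a} -_ 1ℚ (ℚ.nonNegative⁻¹ 1ℚ) λ p q → ℚ.≤-reflexive
    (trans (cong ∣_∣ (solve 2 (λ p q → :- p :- :- q := :- (p :- q)) refl p q))
      (trans (ℚ.∣-p∣≡∣p∣ (p - q)) (sym (ℚ.*-identityˡ ∣ p - q ∣))))

  abs-cauchy : ∀ {a} → Cauchy a → Cauchy (λ n → ∣ a n ∣)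
  abs-cauchy {a} = lipschitz-cauchy {a} ∣_∣ 1ℚ (ℚ.nonNegative⁻¹ 1ℚ) λ p q →
    ℚ.≤-trans (∣∣p∣-∣q∣∣≤∣p-q∣ p q) (ℚ.≤-reflexive (sym (ℚ.*-identityˡ ∣ p - q ∣)))

  add-cauchy : ∀ {a b} → Cauchy a → Cauchy b → Cauchy (λ n → a n + b n)
  add-cauchy {a} {b} ca cb = mkCauchy (λ n → a n + b n) two (ℚ.positive⁻¹ two) λ ε 0<ε →
      close ε (proj₁ (ca ε 0<ε)) (proj₁ (cb ε 0<ε)) (proj₂ (ca ε 0<ε)) (proj₂ (cb ε 0<ε))
    where
    close : ∀ ε N₁ N₂ →
      (∀ m n → N₁ ℕ.≤ m → N₁ ℕ.≤ n → ∣ a m - a n ∣ ≤ ε) →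
      (∀ m n → N₂ ℕ.≤ m → N₂ ℕ.≤ n → ∣ b m - b n ∣ ≤ ε) →
      ∃ λ N → ∀ n → N ℕ.≤ n → ∣ (a n + b n) - (a N + b N) ∣ ≤ two * ε
    close ε N₁ N₂ h₁ h₂ = N , λ n N≤n → begin
        ∣ (a n + b n) - (a N + b N) ∣
          ≡⟨ cong ∣_∣ (solve 4 (λ p q r s → (p :+ q) :- (r :+ s) := (p :- r) :+ (q :- s))
               refl (a n) (b n) (a N) (b N)) ⟩
        ∣ (a n - a N) + (b n - b N) ∣   ≤⟨ ℚ.∣p+q∣≤∣p∣+∣q∣ (a n - a N) (b n - b N) ⟩
        ∣ a n - a N ∣ + ∣ b n - b N ∣
          ≤⟨ ℚ.+-mono-≤ (h₁ n N (ℕ.≤-trans (ℕ.m≤m⊔n N₁ N₂) N≤n) (ℕ.m≤m⊔n N₁ N₂))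
                        (h₂ n N (ℕ.≤-trans (ℕ.m≤n⊔m N₁ N₂) N≤n) (ℕ.m≤n⊔m N₁ N₂)) ⟩
        ε + ε
          ≡⟨ solve 1 (λ e → e :+ e := (con 1ℚ :+ con 1ℚ) :* e) refl ε ⟩
        two * ε                         ∎
      where
      open ℚ.≤-Reasoning
      N = N₁ ℕ.⊔ N₂

  *-mono : ∀ {p q r s} → 0ℚ ≤ r → p ≤ q → r ≤ s → 0ℚ ≤ q → p * r ≤ q * s
  *-mono {p} {q} {r} 0≤r p≤q r≤s 0≤q = ℚ.≤-trans (*-monoʳ r 0≤r p≤q) (*-monoˡ q 0≤q r≤s)

  ∣*-*∣≤ : ∀ p q r s → ∣ p * q - r * s ∣ ≤ ∣ p ∣ * ∣ q - s ∣ + ∣ p - r ∣ * ∣ s ∣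
  ∣*-*∣≤ p q r s = begin
      ∣ p * q - r * s ∣
        ≡⟨ cong ∣_∣ (solve 4 (λ p q r s → p :* q :- r :* s := p :* (q :- s) :+ (p :- r) :* s)
             refl p q r s) ⟩
      ∣ p * (q - s) + (p - r) * s ∣
        ≤⟨ ℚ.∣p+q∣≤∣p∣+∣q∣ (p * (q - s)) ((p - r) * s) ⟩
      ∣ p * (q - s) ∣ + ∣ (p - r) * s ∣
        ≡⟨ cong₂ _+_ (ℚ.∣p*q∣≡∣p∣*∣q∣ p (q - s)) (ℚ.∣p*q∣≡∣p∣*∣q∣ (p - r) s) ⟩
      ∣ p ∣ * ∣ q - s ∣ + ∣ p - r ∣ * ∣ s ∣
        ∎
    where open ℚ.≤-Reasoning

  mul-cauchy : ∀ {a b} → Cauchy a → Cauchy b → Cauchy (λ n → a n * b n)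
  mul-cauchy {a} {b} ca cb =
      mkCauchy (λ n → a n * b n) (A + B + 1ℚ) 0<K λ ε 0<ε →
        close ε 0<ε (proj₁ (ca ε 0<ε)) (proj₁ (cb ε 0<ε)) (proj₂ (ca ε 0<ε)) (proj₂ (cb ε 0<ε))
    where
    open ℚ.≤-Reasoning
    A    = proj₁ (eventually-bounded {a} ca)
    0≤A  = proj₁ (proj₂ (eventually-bounded {a} ca))
    M₁   = proj₁ (proj₂ (proj₂ (eventually-bounded {a} ca)))
    bdA  = proj₂ (proj₂ (proj₂ (eventually-bounded {a} ca)))
    B    = proj₁ (eventually-bounded {b} cb)
    0≤B  = proj₁ (proj₂ (eventually-bounded {b} cb))
    M₂   = proj₁ (proj₂ (proj₂ (eventually-bounded {b} cb)))
    bdB  = proj₂ (proj₂ (proj₂ (eventually-bounded {b} cb)))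
    0<K : 0ℚ < A + B + 1ℚ
    0<K = subst (0ℚ <_) (ℚ.+-comm 1ℚ (A + B)) (1+-pos (+-nonNeg 0≤A 0≤B))

    collect : ∀ x y e → x * e + e * y + e ≡ (x + y + 1ℚ) * e
    collect = solve 3 (λ x y e → x :* e :+ e :* y :+ e := (x :+ y :+ con 1ℚ) :* e) refl

    close : ∀ ε → 0ℚ < ε → ∀ N₁ N₂ →
      (∀ m n → N₁ ℕ.≤ m → N₁ ℕ.≤ n → ∣ a m - a n ∣ ≤ ε) →
      (∀ m n → N₂ ℕ.≤ m → N₂ ℕ.≤ n → ∣ b m - b n ∣ ≤ ε) →
      ∃ λ N → ∀ n → N ℕ.≤ n → ∣ a n * b n - a N * b N ∣ ≤ (A + B + 1ℚ) * ε
    close ε 0<ε N₁ N₂ h₁ h₂ =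
        N , λ n N≤n → pointwise n N
          (bdA n (ℕ.≤-trans M₁≤N N≤n)) (bdB N M₂≤N)
          (h₁ n N (ℕ.≤-trans N₁≤N N≤n) N₁≤N) (h₂ n N (ℕ.≤-trans N₂≤N N≤n) N₂≤N)
      where
      N = (N₁ ℕ.⊔ N₂) ℕ.⊔ (M₁ ℕ.⊔ M₂)
      N₁≤N = ℕ.≤-trans (ℕ.m≤m⊔n N₁ N₂) (ℕ.m≤m⊔n (N₁ ℕ.⊔ N₂) (M₁ ℕ.⊔ M₂))
      N₂≤N = ℕ.≤-trans (ℕ.m≤n⊔m N₁ N₂) (ℕ.m≤m⊔n (N₁ ℕ.⊔ N₂) (M₁ ℕ.⊔ M₂))
      M₁≤N = ℕ.≤-trans (ℕ.m≤m⊔n M₁ M₂) (ℕ.m≤n⊔m (N₁ ℕ.⊔ N₂) (M₁ ℕ.⊔ M₂))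
      M₂≤N = ℕ.≤-trans (ℕ.m≤n⊔m M₁ M₂) (ℕ.m≤n⊔m (N₁ ℕ.⊔ N₂) (M₁ ℕ.⊔ M₂))
      pointwise : ∀ m n → ∣ a m ∣ ≤ A → ∣ b n ∣ ≤ B → ∣ a m - a n ∣ ≤ ε → ∣ b m - b n ∣ ≤ ε →
        ∣ a m * b m - a n * b n ∣ ≤ (A + B + 1ℚ) * ε
      pointwise m n am≤A bn≤B da db = begin
        ∣ a m * b m - a n * b n ∣
          ≤⟨ ∣*-*∣≤ (a m) (b m) (a n) (b n) ⟩
        ∣ a m ∣ * ∣ b m - b n ∣ + ∣ a m - a n ∣ * ∣ b n ∣
          ≤⟨ ℚ.+-mono-≤ (*-mono (ℚ.0≤∣p∣ (b m - b n)) am≤A db 0≤A)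
                        (*-mono (ℚ.0≤∣p∣ (b n)) da bn≤B (ℚ.<⇒≤ 0<ε)) ⟩
        A * ε + ε * B
          ≤⟨ p≤p+q (A * ε + ε * B) (ℚ.<⇒≤ 0<ε) ⟩
        A * ε + ε * B + ε
          ≡⟨ collect A B ε ⟩
        (A + B + 1ℚ) * ε
          ∎

  -- The reciprocal, continued constantly to the left of δ.
  recip : ∀ δ → 0ℚ < δ → ℚ → ℚ
  recip δ 0<δ p = (1/ (p ⊔ δ)) {{ℚ.pos⇒nonZero (p ⊔ δ) {{ℚ.positive (ℚ.<-≤-trans 0<δ (ℚ.p≤q⊔p p δ))}}}}

  ⊔-lipschitz-across : ∀ δ p q → δ ≤ p → q ≤ δ → ∣ (p ⊔ δ) - (q ⊔ δ) ∣ ≤ ∣ p - q ∣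
  ⊔-lipschitz-across δ p q δ≤p q≤δ = begin
      ∣ (p ⊔ δ) - (q ⊔ δ) ∣   ≡⟨ cong₂ (λ u v → ∣ u - v ∣) (ℚ.p≥q⇒p⊔q≡p δ≤p) (ℚ.p≤q⇒p⊔q≡q q≤δ) ⟩
      ∣ p - δ ∣               ≡⟨ ℚ.0≤p⇒∣p∣≡p (diff δ≤p) ⟩
      p - δ                   ≤⟨ ℚ.+-monoʳ-≤ p (ℚ.neg-antimono-≤ q≤δ) ⟩
      p - q                   ≡⟨ ℚ.0≤p⇒∣p∣≡p (diff (ℚ.≤-trans q≤δ δ≤p)) ⟨
      ∣ p - q ∣               ∎
    where
    open ℚ.≤-Reasoning
    diff : ∀ {r s} → r ≤ s → 0ℚ ≤ s - r
    diff {r} r≤s = ℚ.≤-trans (ℚ.≤-reflexive (sym (ℚ.+-inverseʳ r))) (ℚ.+-monoˡ-≤ (- r) r≤s)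

  ⊔-lipschitz : ∀ δ p q → ∣ (p ⊔ δ) - (q ⊔ δ) ∣ ≤ ∣ p - q ∣
  ⊔-lipschitz δ p q with ℚ.≤-total p δ | ℚ.≤-total q δ
  ... | inj₁ p≤δ | inj₁ q≤δ rewrite ℚ.p≤q⇒p⊔q≡q p≤δ | ℚ.p≤q⇒p⊔q≡q q≤δ =
    subst (_≤ ∣ p - q ∣) (sym (cong ∣_∣ (ℚ.+-inverseʳ δ))) (ℚ.0≤∣p∣ (p - q))
  ... | inj₂ δ≤p | inj₂ δ≤q rewrite ℚ.p≥q⇒p⊔q≡p δ≤p | ℚ.p≥q⇒p⊔q≡p δ≤q = ℚ.≤-refl
  ... | inj₂ δ≤p | inj₁ q≤δ = ⊔-lipschitz-across δ p q δ≤p q≤δ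
  ... | inj₁ p≤δ | inj₂ δ≤q =
    subst₂ _≤_ (∣∣-sym (q ⊔ δ) (p ⊔ δ)) (∣∣-sym q p) (⊔-lipschitz-across δ q p δ≤q p≤δ)

  recip-cauchy : ∀ {a} δ (0<δ : 0ℚ < δ) → Cauchy a → Cauchy (λ n → recip δ 0<δ (a n))
  recip-cauchy {a} δ 0<δ = lipschitz-cauchy {a} (recip δ 0<δ) (d * d) (*-nonNeg 0≤d 0≤d) lip
    where
    instance
      posδ = ℚ.positive 0<δ
      nzδ = ℚ.pos⇒nonZero δ
    d = 1/ δ
    0≤d : 0ℚ ≤ d
    0≤d = ℚ.<⇒≤ (ℚ.positive⁻¹ d {{ℚ.1/pos⇒pos δ}})
    module _ (p : ℚ) where
      instance
        posM = ℚ.positive (ℚ.<-≤-trans 0<δ (ℚ.p≤q⊔p p δ))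
        nzM = ℚ.pos⇒nonZero (p ⊔ δ)
      r≥0 : 0ℚ ≤ recip δ 0<δ p
      r≥0 = ℚ.<⇒≤ (ℚ.positive⁻¹ _ {{ℚ.1/pos⇒pos (p ⊔ δ)}})
      r*M : recip δ 0<δ p * (p ⊔ δ) ≡ 1ℚ
      r*M = ℚ.*-inverseˡ (p ⊔ δ)
      r≤d : recip δ 0<δ p ≤ d
      r≤d = begin
        r                 ≡⟨ ℚ.*-identityʳ r ⟨
        r * 1ℚ            ≡⟨ cong (r *_) (ℚ.*-inverseʳ δ) ⟨
        r * (δ * d)       ≡⟨ ℚ.*-assoc r δ d ⟨
        r * δ * d         ≤⟨ *-monoʳ d 0≤d (*-monoˡ r r≥0 (ℚ.p≤q⊔p p δ)) ⟩
        r * (p ⊔ δ) * d   ≡⟨ cong (_* d) r*M ⟩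
        1ℚ * d            ≡⟨ ℚ.*-identityˡ d ⟩
        d                 ∎
        where
        open ℚ.≤-Reasoning
        r = recip δ 0<δ p
    lip : ∀ p q → ∣ recip δ 0<δ p - recip δ 0<δ q ∣ ≤ d * d * ∣ p - q ∣
    lip p q = begin
      ∣ r - s ∣
        ≡⟨ cong ∣_∣ (cong₂ _-_ (sym (trans (cong (r *_) (r*M q)) (ℚ.*-identityʳ r)))
                              (sym (trans (cong (s *_) (r*M p)) (ℚ.*-identityʳ s)))) ⟩
      ∣ r * (s * v) - s * (r * u) ∣
        ≡⟨ cong ∣_∣ (solve 4 (λ r s u v → r :* (s :* v) :- s :* (r :* u) := r :* s :* (v :- u))
             refl r s u v) ⟩
      ∣ r * s * (v - u) ∣
        ≡⟨ ℚ.∣p*q∣≡∣p∣*∣q∣ (r * s) (v - u) ⟩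
      ∣ r * s ∣ * ∣ v - u ∣
        ≡⟨ cong₂ _*_ (ℚ.0≤p⇒∣p∣≡p (*-nonNeg (r≥0 p) (r≥0 q))) (∣∣-sym v u) ⟩
      r * s * ∣ u - v ∣
        ≤⟨ *-monoˡ (r * s) (*-nonNeg (r≥0 p) (r≥0 q)) (⊔-lipschitz δ p q) ⟩
      r * s * ∣ p - q ∣
        ≤⟨ *-monoʳ ∣ p - q ∣ (ℚ.0≤∣p∣ (p - q))
             (ℚ.≤-trans (*-monoʳ s (r≥0 q) (r≤d p)) (*-monoˡ d 0≤d (r≤d q))) ⟩
      d * d * ∣ p - q ∣
        ∎
      where
      open ℚ.≤-Reasoning
      r = recip δ 0<δ p
      s = recip δ 0<δ q
      u = p ⊔ δ
      v = q ⊔ δ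

  ----------------------------------------------------------------------
  -- Series

  ι : ℕ → ℚ
  ι n = + n ℚ./ 1

  ι-suc : ∀ n → ι (suc n) ≡ ι n + 1ℚ
  ι-suc n = ℚ.toℚᵘ-injective (begin
      ℚ.toℚᵘ (ι (suc n))                     ≈⟨ ℚ.toℚᵘ-fromℚᵘ (mkℚᵘ (+ suc n) 0) ⟩
      mkℚᵘ (+ suc n) 0                       ≈⟨ ℚᵘ.*≡* eq ⟩
      mkℚᵘ (+ n) 0 ℚᵘ.+ mkℚᵘ (+ 1) 0         ≈⟨ ℚᵘ.+-congˡ (ℚ.toℚᵘ 1ℚ) (ℚ.toℚᵘ-fromℚᵘ (mkℚᵘ (+ n) 0)) ⟨
      ℚ.toℚᵘ (ι n) ℚᵘ.+ ℚ.toℚᵘ 1ℚ            ≈⟨ ℚ.toℚᵘ-homo-+ (ι n) 1ℚ ⟨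
      ℚ.toℚᵘ (ι n + 1ℚ)                      ∎)
    where
    open ℚᵘ.≃-Reasoning
    eq : + suc n ℤ.* + 1 ≡ (+ n ℤ.* + 1 ℤ.+ + 1 ℤ.* + 1) ℤ.* + 1
    eq = cong (ℤ._* + 1) (trans (cong +_ (ℕ.+-comm 1 n)) (cong (ℤ._+ + 1) (sym (ℤ.*-identityʳ (+ n)))))

  ι-nonNeg : ∀ n → 0ℚ ≤ ι n
  ι-nonNeg n = ℚ.nonNegative⁻¹ (ι n) {{ℚ.normalize-nonNeg n 1}}

  ι-+ : ∀ m n → ι (m ℕ.+ n) ≡ ι m + ι n
  ι-+ zero    n = sym (ℚ.+-identityˡ (ι n))
  ι-+ (suc m) n = trans (ι-suc (m ℕ.+ n)) (trans (cong (_+ 1ℚ) (ι-+ m n))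
    (trans (solve 3 (λ x y z → x :+ y :+ z := x :+ z :+ y) refl (ι m) (ι n) 1ℚ)
           (cong (_+ ι n) (sym (ι-suc m)))))

  ι-mono : ∀ {m n} → m ℕ.≤ n → ι m ≤ ι n
  ι-mono {m} {n} m≤n = ℚ.≤-trans (p≤p+q (ι m) (ι-nonNeg (n ℕ.∸ m)))
    (ℚ.≤-reflexive (trans (sym (ι-+ m (n ℕ.∸ m))) (cong ι (ℕ.m+[n∸m]≡n m≤n))))

  unit : ℕ → ℚ
  unit k = + 1 ℚ./ suc k

  unit-pos : ∀ k → 0ℚ < unit k
  unit-pos k = ℚ.positive⁻¹ (unit k) {{ℚ.normalize-pos 1 (suc k)}}

  unit-inverse : ∀ k → unit k * ι (suc k) ≡ 1ℚ
  unit-inverse k = ℚ.toℚᵘ-injective (begin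
      ℚ.toℚᵘ (unit k * ι (suc k))                 ≈⟨ ℚ.toℚᵘ-homo-* (unit k) (ι (suc k)) ⟩
      ℚ.toℚᵘ (unit k) ℚᵘ.* ℚ.toℚᵘ (ι (suc k))     ≈⟨ ℚᵘ.*-cong (ℚ.toℚᵘ-fromℚᵘ (mkℚᵘ (+ 1) k))
                                                                (ℚ.toℚᵘ-fromℚᵘ (mkℚᵘ (+ suc k) 0)) ⟩
      mkℚᵘ (+ 1) k ℚᵘ.* mkℚᵘ (+ suc k) 0          ≈⟨ ℚᵘ.*≡* (eq k) ⟩
      ℚ.toℚᵘ 1ℚ                                   ∎)
    where
    open ℚᵘ.≃-Reasoning
    eq : ∀ k → + 1 ℤ.* + suc k ℤ.* + 1 ≡ + 1 ℤ.* (+ suc k ℤ.* + 1)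
    eq k = ℤ.*-assoc (+ 1) (+ suc k) (+ 1)

  archimedean : ∀ p → ∃ λ n → p ≤ ι n
  archimedean p@(ℚ.mkℚ i d _) = n , ℚ.toℚᵘ-cancel-≤
      (ℚᵘ.≤-trans (ℚᵘ.*≤* le) (ℚᵘ.≤-reflexive (ℚᵘ.≃-sym (ℚ.toℚᵘ-fromℚᵘ (mkℚᵘ (+ n) 0)))))
    where
    n = ℤ.∣ i ∣
    i≤ : ∀ j → j ℤ.≤ + ℤ.∣ j ∣
    i≤ (+ _) = ℤ.≤-refl
    i≤ ℤ.-[1+ _ ] = ℤ.-≤+
    le : i ℤ.* + 1 ℤ.≤ + n ℤ.* + suc d
    le = ℤ.≤-trans (ℤ.≤-reflexive (ℤ.*-identityʳ i)) (ℤ.≤-trans (i≤ i)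
           (ℤ.≤-trans (ℤ.+≤+ (ℕ.m≤m*n n (suc d))) (ℤ.≤-reflexive (ℤ.pos-* n (suc d)))))

  sum< : (ℕ → ℚ) → ℕ → ℚ
  sum< t zero    = 0ℚ
  sum< t (suc n) = sum< t n + t n

  Halving : (ℕ → ℚ) → ℕ → Set
  Halving a M = ∀ k → M ℕ.≤ k → two * a (suc k) ≤ a k

  module Dominated (a : ℕ → ℚ) (a≥0 : ∀ k → 0ℚ ≤ a k) (M : ℕ) (halving : Halving a M) where

    tail : ∀ m d → M ℕ.≤ m → sum< a (d ℕ.+ m) + two * a (d ℕ.+ m) ≤ sum< a m + two * a m
    tail m zero    M≤m = ℚ.≤-refl
    tail m (suc d) M≤m = begin
      s + a k + two * a (suc k)   ≤⟨ ℚ.+-monoʳ-≤ (s + a k) (halving k (ℕ.≤-trans M≤m (ℕ.m≤n+m m d))) ⟩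
      s + a k + a k               ≡⟨ solve 2 (λ s x → s :+ x :+ x := s :+ (con 1ℚ :+ con 1ℚ) :* x) refl s (a k) ⟩
      s + two * a k               ≤⟨ tail m d M≤m ⟩
      sum< a m + two * a m        ∎
      where
      open ℚ.≤-Reasoning
      k = d ℕ.+ m
      s = sum< a k

    2a≥0 : ∀ k → 0ℚ ≤ two * a k
    2a≥0 k = *-nonNeg (ℚ.nonNegative⁻¹ two) (a≥0 k)

    bound : ℚ
    bound = sum< a M + two * a M

    bounded : ∀ m → M ℕ.≤ m → sum< a m ≤ bound
    bounded m M≤m = begin
      sum< a m                ≤⟨ p≤p+q (sum< a m) (2a≥0 m) ⟩
      sum< a m + two * a m    ≡⟨ cong (λ j → sum< a j + two * a j) (ℕ.m∸n+n≡m M≤m) ⟨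
      sum< a (m ℕ.∸ M ℕ.+ M) + two * a (m ℕ.∸ M ℕ.+ M)   ≤⟨ tail M (m ℕ.∸ M) ℕ.≤-refl ⟩
      bound                   ∎
      where open ℚ.≤-Reasoning

    sum-nonNeg : ∀ m → 0ℚ ≤ sum< a m
    sum-nonNeg zero    = ℚ.≤-refl
    sum-nonNeg (suc m) = +-nonNeg (sum-nonNeg m) (a≥0 m)

    bound≥0 : 0ℚ ≤ bound
    bound≥0 = +-nonNeg (sum-nonNeg M) (2a≥0 M)

    decay : ∀ d → ι (suc d) * a (d ℕ.+ M) ≤ a M
    decay zero    = ℚ.≤-reflexive (ℚ.*-identityˡ (a M))
    decay (suc d) = begin
      ι (suc (suc d)) * x     ≤⟨ *-monoʳ x (a≥0 _) 2+d≤ ⟩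
      (ι (suc d) * two) * x   ≡⟨ ℚ.*-assoc (ι (suc d)) two x ⟩
      ι (suc d) * (two * x)   ≤⟨ *-monoˡ (ι (suc d)) (ι-nonNeg (suc d)) (halving (d ℕ.+ M) (ℕ.m≤n+m M d)) ⟩
      ι (suc d) * a (d ℕ.+ M) ≤⟨ decay d ⟩
      a M                     ∎
      where
      open ℚ.≤-Reasoning
      x = a (suc d ℕ.+ M)
      2+d≤ : ι (suc (suc d)) ≤ ι (suc d) * two
      2+d≤ = begin
        ι (suc (suc d))           ≡⟨ ι-suc (suc d) ⟩
        ι (suc d) + 1ℚ            ≤⟨ ℚ.+-monoʳ-≤ (ι (suc d)) (p≤p+q 1ℚ (ι-nonNeg d)) ⟩
        ι (suc d) + (1ℚ + ι d)    ≡⟨ cong (λ z → ι (suc d) + z) (trans (ℚ.+-comm 1ℚ (ι d)) (sym (ι-suc d))) ⟩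
        ι (suc d) + ι (suc d)     ≡⟨ solve 1 (λ z → z :+ z := z :* (con 1ℚ :+ con 1ℚ)) refl (ι (suc d)) ⟩
        ι (suc d) * two           ∎

    small : ∀ ε → 0ℚ < ε → ∃ λ N → M ℕ.≤ N × two * a N ≤ two * ε
    small ε 0<ε = d ℕ.+ M , ℕ.m≤n+m M d ,
        *-monoˡ two (ℚ.nonNegative⁻¹ two)
          (ℚ.*-cancelˡ-≤-pos (ι (suc d)) {{ℚ.normalize-pos (suc d) 1}} (begin
            ι (suc d) * a (d ℕ.+ M)   ≤⟨ decay d ⟩
            a M                       ≤⟨ p≤p+q (a M) (ℚ.nonNegative⁻¹ 1ℚ) ⟩
            a M + 1ℚ                  ≡⟨ trans (ℚ.+-comm (a M) 1ℚ) (sym (proj₂ (proj₂ ratio))) ⟩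
            ε * R                     ≤⟨ *-monoˡ ε (ℚ.<⇒≤ 0<ε)
                                           (ℚ.≤-trans (proj₂ (archimedean R)) (ι-mono (ℕ.n≤1+n d))) ⟩
            ε * ι (suc d)             ≡⟨ ℚ.*-comm ε (ι (suc d)) ⟩
            ι (suc d) * ε             ∎))
      where
      open ℚ.≤-Reasoning
      ratio = split ε 0<ε (1ℚ + a M) (1+-pos (a≥0 M))
      R = proj₁ ratio
      d = proj₁ (archimedean R)

    difference : ∀ t → (∀ k → ∣ t k ∣ ≤ a k) → ∀ m d →
      ∣ sum< t (d ℕ.+ m) - sum< t m ∣ ≤ sum< a (d ℕ.+ m) - sum< a m
    difference t t≤a m zero = ℚ.≤-reflexive
      (trans (cong ∣_∣ (ℚ.+-inverseʳ (sum< t m))) (sym (ℚ.+-inverseʳ (sum< a m))))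
    difference t t≤a m (suc d) = begin
      ∣ sum< t k + t k - sum< t m ∣
        ≡⟨ cong ∣_∣ (solve 3 (λ x y z → x :+ y :- z := (x :- z) :+ y) refl (sum< t k) (t k) (sum< t m)) ⟩
      ∣ (sum< t k - sum< t m) + t k ∣
        ≤⟨ ℚ.∣p+q∣≤∣p∣+∣q∣ (sum< t k - sum< t m) (t k) ⟩
      ∣ sum< t k - sum< t m ∣ + ∣ t k ∣
        ≤⟨ ℚ.+-mono-≤ (difference t t≤a m d) (t≤a k) ⟩
      (sum< a k - sum< a m) + a k
        ≡⟨ solve 3 (λ x y z → x :+ y :- z := (x :- z) :+ y) refl (sum< a k) (a k) (sum< a m) ⟨
      sum< a k + a k - sum< a m
        ∎
      where
      open ℚ.≤-Reasoning
      k = d ℕ.+ m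

    remainder : ∀ t → (∀ k → ∣ t k ∣ ≤ a k) → ∀ m n → M ℕ.≤ m → m ℕ.≤ n →
      ∣ sum< t n - sum< t m ∣ ≤ two * a m
    remainder t t≤a m n M≤m m≤n = begin
      ∣ sum< t n - sum< t m ∣
        ≡⟨ cong (λ j → ∣ sum< t j - sum< t m ∣) eq ⟨
      ∣ sum< t (d ℕ.+ m) - sum< t m ∣
        ≤⟨ difference t t≤a m d ⟩
      sum< a (d ℕ.+ m) - sum< a m
        ≤⟨ ℚ.+-monoˡ-≤ (- sum< a m) (ℚ.≤-trans (p≤p+q (sum< a (d ℕ.+ m)) (2a≥0 (d ℕ.+ m))) (tail m d M≤m)) ⟩
      sum< a m + two * a m - sum< a m
        ≡⟨ solve 2 (λ x y → x :+ y :- x := y) refl (sum< a m) (two * a m) ⟩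
      two * a m
        ∎
      where
      open ℚ.≤-Reasoning
      d = n ℕ.∸ m
      eq : d ℕ.+ m ≡ n
      eq = ℕ.m∸n+n≡m m≤n

  -- x ^ k / k !
  expTerm : ℚ → ℕ → ℚ
  expTerm x zero    = 1ℚ
  expTerm x (suc k) = expTerm x k * (x * unit k)

  expTerm-nonNeg : ∀ {x} → 0ℚ ≤ x → ∀ k → 0ℚ ≤ expTerm x k
  expTerm-nonNeg 0≤x zero    = ℚ.nonNegative⁻¹ 1ℚ
  expTerm-nonNeg 0≤x (suc k) =
    *-nonNeg (expTerm-nonNeg 0≤x k) (*-nonNeg 0≤x (ℚ.<⇒≤ (unit-pos k)))

  ∣unit∣ : ∀ k → ∣ unit k ∣ ≡ unit k
  ∣unit∣ k = ℚ.0≤p⇒∣p∣≡p (ℚ.<⇒≤ (unit-pos k))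

  module ExpBound (K : ℕ) where

    B : ℚ
    B = ι K

    expTerm-bound : ∀ {x} → ∣ x ∣ ≤ B → ∀ k → ∣ expTerm x k ∣ ≤ expTerm B k
    expTerm-bound         ∣x∣≤B zero    = ℚ.≤-refl
    expTerm-bound {x} ∣x∣≤B (suc k) = begin
      ∣ expTerm x k * (x * unit k) ∣      ≡⟨ ℚ.∣p*q∣≡∣p∣*∣q∣ (expTerm x k) (x * unit k) ⟩
      ∣ expTerm x k ∣ * ∣ x * unit k ∣    ≤⟨ *-monoʳ ∣ x * unit k ∣ (ℚ.0≤∣p∣ _) (expTerm-bound ∣x∣≤B k) ⟩
      expTerm B k * ∣ x * unit k ∣        ≡⟨ cong (expTerm B k *_) (trans (ℚ.∣p*q∣≡∣p∣*∣q∣ x (unit k))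
                                                                       (cong (∣ x ∣ *_) (∣unit∣ k))) ⟩
      expTerm B k * (∣ x ∣ * unit k)      ≤⟨ *-monoˡ (expTerm B k) (expTerm-nonNeg (ι-nonNeg K) k)
                                               (*-monoʳ (unit k) (ℚ.<⇒≤ (unit-pos k)) ∣x∣≤B) ⟩
      expTerm B k * (B * unit k)          ∎
      where open ℚ.≤-Reasoning

    halving : Halving (expTerm B) (K ℕ.+ K)
    halving k 2K≤k = begin
      two * (expTerm B k * (B * unit k))
        ≡⟨ solve 3 (λ e b u → (con 1ℚ :+ con 1ℚ) :* (e :* (b :* u)) := e :* (u :* (b :+ b))) refl (expTerm B k) B (unit k) ⟩
      expTerm B k * (unit k * (B + B))
        ≤⟨ *-monoˡ (expTerm B k) (expTerm-nonNeg (ι-nonNeg K) k)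
             (*-monoˡ (unit k) (ℚ.<⇒≤ (unit-pos k))
               (ℚ.≤-trans (ℚ.≤-reflexive (sym (ι-+ K K))) (ι-mono (ℕ.m≤n⇒m≤1+n 2K≤k)))) ⟩
      expTerm B k * (unit k * ι (suc k))
        ≡⟨ trans (cong (expTerm B k *_) (unit-inverse k)) (ℚ.*-identityʳ _) ⟩
      expTerm B k
        ∎
      where open ℚ.≤-Reasoning

    open Dominated (expTerm B) (expTerm-nonNeg (ι-nonNeg K)) (K ℕ.+ K) halving public

    expTerm-lipschitz : ∀ {x y} → ∣ x ∣ ≤ B → ∣ y ∣ ≤ B → ∀ k →
      ∣ expTerm x (suc k) - expTerm y (suc k) ∣ ≤ expTerm B k * ∣ x - y ∣
    expTerm-lipschitz {x} {y} _ _ zero = ℚ.≤-reflexive (trans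
      (cong ∣_∣ (solve 2 (λ x y → con 1ℚ :* (x :* con 1ℚ) :- con 1ℚ :* (y :* con 1ℚ) := x :- y) refl x y))
      (sym (ℚ.*-identityˡ ∣ x - y ∣)))
    expTerm-lipschitz {x} {y} ∣x∣≤B ∣y∣≤B (suc k) = begin
      ∣ X * (x * u) - Y * (y * u) ∣
        ≡⟨ cong ∣_∣ (solve 5 (λ X Y x y u → X :* (x :* u) :- Y :* (y :* u) :=
             ((X :- Y) :* x :+ Y :* (x :- y)) :* u) refl X Y x y u) ⟩
      ∣ ((X - Y) * x + Y * (x - y)) * u ∣
        ≡⟨ trans (ℚ.∣p*q∣≡∣p∣*∣q∣ ((X - Y) * x + Y * (x - y)) u) (cong (∣ (X - Y) * x + Y * (x - y) ∣ *_) (∣unit∣ (suc k))) ⟩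
      ∣ (X - Y) * x + Y * (x - y) ∣ * u
        ≤⟨ *-monoʳ u u≥0 (ℚ.∣p+q∣≤∣p∣+∣q∣ ((X - Y) * x) (Y * (x - y))) ⟩
      (∣ (X - Y) * x ∣ + ∣ Y * (x - y) ∣) * u
        ≡⟨ cong (_* u) (cong₂ _+_ (ℚ.∣p*q∣≡∣p∣*∣q∣ (X - Y) x) (ℚ.∣p*q∣≡∣p∣*∣q∣ Y (x - y))) ⟩
      (∣ X - Y ∣ * ∣ x ∣ + ∣ Y ∣ * D) * u
        ≤⟨ *-monoʳ u u≥0 (ℚ.+-mono-≤
             (ℚ.≤-trans (*-monoˡ ∣ X - Y ∣ (ℚ.0≤∣p∣ _) ∣x∣≤B)
                        (*-monoʳ B (ι-nonNeg K) (expTerm-lipschitz ∣x∣≤B ∣y∣≤B k)))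
             (*-monoʳ D (ℚ.0≤∣p∣ _) (expTerm-bound ∣y∣≤B (suc k)))) ⟩
      (b * D * B + b * (B * unit k) * D) * u
        ≡⟨ cong (λ z → (z + b * (B * unit k) * D) * u) insert ⟩
      (b * (B * unit k) * D * ι (suc k) + b * (B * unit k) * D) * u
        ≡⟨ solve 3 (λ e i u → (e :* i :+ e) :* u := e :* (u :* (i :+ con 1ℚ))) refl (b * (B * unit k) * D) (ι (suc k)) u ⟩
      b * (B * unit k) * D * (u * (ι (suc k) + 1ℚ))
        ≡⟨ cong (b * (B * unit k) * D *_) (trans (cong (u *_) (sym (ι-suc (suc k)))) (unit-inverse (suc k))) ⟩
      b * (B * unit k) * D * 1ℚ
        ≡⟨ ℚ.*-identityʳ _ ⟩
      expTerm B (suc k) * D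
        ∎
      where
      open ℚ.≤-Reasoning
      X = expTerm x (suc k)
      Y = expTerm y (suc k)
      u = unit (suc k)
      u≥0 = ℚ.<⇒≤ (unit-pos (suc k))
      D = ∣ x - y ∣
      b = expTerm B k
      insert : b * D * B ≡ b * (B * unit k) * D * ι (suc k)
      insert = trans (sym (ℚ.*-identityʳ _)) (trans (cong (b * D * B *_) (sym (unit-inverse k)))
        (solve 5 (λ b D B u i → b :* D :* B :* (u :* i) := b :* (B :* u) :* D :* i) refl b D B (unit k) (ι (suc k))))

    sum-lipschitz : ∀ {x y} → ∣ x ∣ ≤ B → ∣ y ∣ ≤ B → ∀ n →
      ∣ sum< (expTerm x) (suc n) - sum< (expTerm y) (suc n) ∣ ≤ sum< (expTerm B) n * ∣ x - y ∣
    sum-lipschitz {x} {y} _ _ zero = ℚ.≤-reflexive (sym (ℚ.*-zeroˡ ∣ x - y ∣))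
    sum-lipschitz {x} {y} ∣x∣≤B ∣y∣≤B (suc n) = begin
      ∣ S + X - (T + Y) ∣
        ≡⟨ cong ∣_∣ (solve 4 (λ p q r s → (p :+ q) :- (r :+ s) := (p :- r) :+ (q :- s)) refl S X T Y) ⟩
      ∣ (S - T) + (X - Y) ∣
        ≤⟨ ℚ.∣p+q∣≤∣p∣+∣q∣ (S - T) (X - Y) ⟩
      ∣ S - T ∣ + ∣ X - Y ∣
        ≤⟨ ℚ.+-mono-≤ (sum-lipschitz ∣x∣≤B ∣y∣≤B n) (expTerm-lipschitz ∣x∣≤B ∣y∣≤B n) ⟩
      sum< (expTerm B) n * ∣ x - y ∣ + expTerm B n * ∣ x - y ∣
        ≡⟨ ℚ.*-distribʳ-+ ∣ x - y ∣ (sum< (expTerm B) n) (expTerm B n) ⟨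
      (sum< (expTerm B) n + expTerm B n) * ∣ x - y ∣
        ∎
      where
      open ℚ.≤-Reasoning
      S = sum< (expTerm x) (suc n)
      T = sum< (expTerm y) (suc n)
      X = expTerm x (suc n)
      Y = expTerm y (suc n)

    expTerm-antitone : ∀ m n → K ℕ.+ K ℕ.≤ m → m ℕ.≤ n → expTerm B n ≤ expTerm B m
    expTerm-antitone m n M≤m m≤n =
      subst (λ j → expTerm B j ≤ expTerm B m) (ℕ.m∸n+n≡m m≤n) (go (n ℕ.∸ m))
      where
      step : ∀ k → K ℕ.+ K ℕ.≤ k → expTerm B (suc k) ≤ expTerm B k
      step k M≤k = ℚ.≤-trans (p≤p+q (expTerm B (suc k)) (expTerm-nonNeg (ι-nonNeg K) (suc k)))
        (ℚ.≤-trans (ℚ.≤-reflexive (solve 1 (λ z → z :+ z := (con 1ℚ :+ con 1ℚ) :* z) refl (expTerm B (suc k))))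
                   (halving k M≤k))
      go : ∀ d → expTerm B (d ℕ.+ m) ≤ expTerm B m
      go zero    = ℚ.≤-refl
      go (suc d) = ℚ.≤-trans (step (d ℕ.+ m) (ℕ.≤-trans M≤m (ℕ.m≤n+m m d))) (go d)

    E : ℚ → ℕ → ℚ
    E x n = sum< (expTerm x) (suc n)

    E-close : ∀ {x y} → ∣ x ∣ ≤ B → ∣ y ∣ ≤ B → ∀ L N n → K ℕ.+ K ℕ.≤ L → L ℕ.≤ N → N ℕ.≤ n →
      ∀ ε → two * expTerm B L ≤ two * ε → ∣ x - y ∣ ≤ ε → ∣ E x n - E y N ∣ ≤ (two + bound) * ε
    E-close {x} {y} ∣x∣≤B ∣y∣≤B L N n M≤L L≤N N≤n ε small-L dxy = begin
        ∣ E x n - E y N ∣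
          ≤⟨ ∣∣-triangle (E x n) (E x N) (E y N) ⟩
        ∣ E x n - E x N ∣ + ∣ E x N - E y N ∣
          ≤⟨ ℚ.+-mono-≤
               (ℚ.≤-trans
                 (remainder (expTerm x) (expTerm-bound ∣x∣≤B) (suc N) (suc n) M≤1+N (ℕ.s≤s N≤n))
                 (ℚ.≤-trans (*-monoˡ two (ℚ.nonNegative⁻¹ two)
                              (expTerm-antitone L (suc N) M≤L (ℕ.m≤n⇒m≤1+n L≤N))) small-L))
               (sum-lipschitz ∣x∣≤B ∣y∣≤B N) ⟩
        two * ε + sum< (expTerm B) N * ∣ x - y ∣
          ≤⟨ ℚ.+-monoʳ-≤ (two * ε)
               (ℚ.≤-trans (*-monoʳ ∣ x - y ∣ (ℚ.0≤∣p∣ (x - y)) (bounded N (ℕ.≤-trans M≤L L≤N)))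
                          (*-monoˡ bound bound≥0 dxy)) ⟩
        two * ε + bound * ε
          ≡⟨ ℚ.*-distribʳ-+ ε two bound ⟨
        (two + bound) * ε
          ∎
      where
      open ℚ.≤-Reasoning
      M≤1+N = ℕ.m≤n⇒m≤1+n (ℕ.≤-trans M≤L L≤N)

    exp-cauchy-bounded : ∀ {a} N₁ → (∀ n → N₁ ℕ.≤ n → ∣ a n ∣ ≤ B) → Cauchy a →
      Cauchy (λ n → E (a n) n)
    exp-cauchy-bounded {a} N₁ bd ca = mkCauchy (λ n → E (a n) n) (two + bound) 0<K λ ε 0<ε →
        close ε (proj₁ (ca ε 0<ε)) (proj₂ (ca ε 0<ε))
                (proj₁ (small ε 0<ε)) (proj₁ (proj₂ (small ε 0<ε))) (proj₂ (proj₂ (small ε 0<ε)))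
      where
      0<K : 0ℚ < two + bound
      0<K = ℚ.<-≤-trans (ℚ.positive⁻¹ two) (p≤p+q two bound≥0)
      close : ∀ ε N₂ → (∀ m n → N₂ ℕ.≤ m → N₂ ℕ.≤ n → ∣ a m - a n ∣ ≤ ε) →
        ∀ L → K ℕ.+ K ℕ.≤ L → two * expTerm B L ≤ two * ε →
        ∃ λ N → ∀ n → N ℕ.≤ n → ∣ E (a n) n - E (a N) N ∣ ≤ (two + bound) * ε
      close ε N₂ h L M≤L sm = N , λ n N≤n →
          E-close (bd n (ℕ.≤-trans N₁≤N N≤n)) (bd N N₁≤N) L N n M≤L (ℕ.m≤n⊔m (N₁ ℕ.⊔ N₂) L) N≤n ε sm
                  (h n N (ℕ.≤-trans N₂≤N N≤n) N₂≤N)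
        where
        N = (N₁ ℕ.⊔ N₂) ℕ.⊔ L
        N₁≤N = ℕ.≤-trans (ℕ.m≤m⊔n N₁ N₂) (ℕ.m≤m⊔n (N₁ ℕ.⊔ N₂) L)
        N₂≤N = ℕ.≤-trans (ℕ.m≤n⊔m N₁ N₂) (ℕ.m≤m⊔n (N₁ ℕ.⊔ N₂) L)

  exp-cauchy : ∀ {a} → Cauchy a → Cauchy (λ n → sum< (expTerm (a n)) (suc n))
  exp-cauchy {a} ca = ExpBound.exp-cauchy-bounded K {a} N₁ (λ n N₁≤n → ℚ.≤-trans (bd n N₁≤n) A≤K) ca
    where
    A   = proj₁ (eventually-bounded {a} ca)
    N₁  = proj₁ (proj₂ (proj₂ (eventually-bounded {a} ca)))
    bd  = proj₂ (proj₂ (proj₂ (eventually-bounded {a} ca)))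
    K   = proj₁ (archimedean A)
    A≤K = proj₂ (archimedean A)

  power : ℚ → ℕ → ℚ
  power q zero    = 1ℚ
  power q (suc k) = power q k * q

  -- q ^ (k + 1) / (k + 1) with q = 1 / (m + 2): the Mercator series of
  -- - ln (1 - q) = ln (m + 2) - ln (m + 1).
  lnTerm : ℕ → ℕ → ℚ
  lnTerm m k = power (unit (suc m)) (suc k) * unit k

  power-nonNeg : ∀ {q} → 0ℚ ≤ q → ∀ k → 0ℚ ≤ power q k
  power-nonNeg 0≤q zero    = ℚ.nonNegative⁻¹ 1ℚ
  power-nonNeg 0≤q (suc k) = *-nonNeg (power-nonNeg 0≤q k) 0≤q

  unit-nonNeg : ∀ k → 0ℚ ≤ unit k
  unit-nonNeg k = ℚ.<⇒≤ (unit-pos k)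

  lnTerm-nonNeg : ∀ m k → 0ℚ ≤ lnTerm m k
  lnTerm-nonNeg m k = *-nonNeg (power-nonNeg (unit-nonNeg (suc m)) (suc k)) (unit-nonNeg k)

  unit-step : ∀ k → unit (suc k) ≤ unit k
  unit-step k = begin
      v                             ≡⟨ ℚ.*-identityʳ v ⟨
      v * 1ℚ                        ≡⟨ cong (v *_) (unit-inverse k) ⟨
      v * (u * ι (suc k))           ≤⟨ *-monoˡ v (unit-nonNeg (suc k))
                                         (*-monoˡ u (unit-nonNeg k) (ι-mono (ℕ.n≤1+n (suc k)))) ⟩
      v * (u * ι (suc (suc k)))     ≡⟨ solve 3 (λ v u i → v :* (u :* i) := u :* (v :* i)) refl v u (ι (suc (suc k))) ⟩
      u * (v * ι (suc (suc k)))     ≡⟨ cong (u *_) (unit-inverse (suc k)) ⟩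
      u * 1ℚ                        ≡⟨ ℚ.*-identityʳ u ⟩
      u                             ∎
    where
    open ℚ.≤-Reasoning
    u = unit k
    v = unit (suc k)

  two*unit≤1 : ∀ m → two * unit (suc m) ≤ 1ℚ
  two*unit≤1 m = begin
      two * unit (suc m)                ≡⟨ ℚ.*-comm two (unit (suc m)) ⟩
      unit (suc m) * ι 2                ≤⟨ *-monoˡ (unit (suc m)) (unit-nonNeg (suc m)) (ι-mono {2} {suc (suc m)} (ℕ.s≤s (ℕ.s≤s ℕ.z≤n))) ⟩
      unit (suc m) * ι (suc (suc m))    ≡⟨ unit-inverse (suc m) ⟩
      1ℚ                                ∎
    where open ℚ.≤-Reasoning

  lnTerm-halving : ∀ m → Halving (lnTerm m) 0
  lnTerm-halving m k _ = begin
      two * (p * q * unit (suc k))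
        ≡⟨ solve 4 (λ t p q u → t :* (p :* q :* u) := p :* (t :* q) :* u) refl two p q (unit (suc k)) ⟩
      p * (two * q) * unit (suc k)
        ≤⟨ *-monoʳ (unit (suc k)) (unit-nonNeg (suc k)) (*-monoˡ p p≥0 (two*unit≤1 m)) ⟩
      p * 1ℚ * unit (suc k)
        ≡⟨ cong (_* unit (suc k)) (ℚ.*-identityʳ p) ⟩
      p * unit (suc k)
        ≤⟨ *-monoˡ p p≥0 (unit-step k) ⟩
      p * unit k
        ∎
    where
    open ℚ.≤-Reasoning
    q = unit (suc m)
    p = power q (suc k)
    p≥0 = power-nonNeg (unit-nonNeg (suc m)) (suc k)

  ln-cauchy : ∀ m → Cauchy (sum< (lnTerm m))
  ln-cauchy m = mkCauchy (sum< (lnTerm m)) two (ℚ.positive⁻¹ two) λ ε 0<ε →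
      proj₁ (small ε 0<ε) , λ n N≤n →
        ℚ.≤-trans (remainder (lnTerm m) (λ k → ℚ.≤-reflexive (ℚ.0≤p⇒∣p∣≡p (lnTerm-nonNeg m k)))
                    (proj₁ (small ε 0<ε)) n ℕ.z≤n N≤n)
                  (proj₂ (proj₂ (small ε 0<ε)))
    where open Dominated (lnTerm m) (lnTerm-nonNeg m) 0 (lnTerm-halving m)

  sum<-nonNeg : ∀ t → (∀ k → 0ℚ ≤ t k) → ∀ n → 0ℚ ≤ sum< t n
  sum<-nonNeg t t≥0 zero    = ℚ.≤-refl
  sum<-nonNeg t t≥0 (suc n) = +-nonNeg (sum<-nonNeg t t≥0 n) (t≥0 n)

  1≤exp : ∀ {x} → 0ℚ ≤ x → ∀ n → 1ℚ ≤ sum< (expTerm x) (suc n)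
  1≤exp 0≤x zero    = ℚ.≤-refl
  1≤exp {x} 0≤x (suc n) = ℚ.≤-trans (1≤exp 0≤x n) (p≤p+q (sum< (expTerm x) (suc n)) (expTerm-nonNeg 0≤x (suc n)))

------------------------------------------------------------------------
-- Real numbers

record ℝ : Set where
  constructor mkℝ
  field
    seq    : ℕ → ℚ
    cauchy : RationalAnalysis.Cauchy seq

open ℝ public
open RationalAnalysis using
  (const-cauchy; neg-cauchy; abs-cauchy; add-cauchy; mul-cauchy; recip; recip-cauchy;
   sum<; expTerm; exp-cauchy; lnTerm; lnTerm-nonNeg; ln-cauchy)

infixl 6 _+_ _-_
infixl 7 _*_ _/ℕ_ _/_by_
infix  8 -_ _^_
infix  4 _<_ _≤_ _⟶_

fromℚ : ℚ → ℝ
fromℚ q = mkℝ (λ _ → q) (const-cauchy q)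

0ℝ 1ℝ : ℝ
0ℝ = fromℚ 0ℚ
1ℝ = fromℚ 1ℚ

_+_ : ℝ → ℝ → ℝ
x + y = mkℝ (λ n → seq x n ℚ.+ seq y n) (add-cauchy {seq x} {seq y} (cauchy x) (cauchy y))

-_ : ℝ → ℝ
- x = mkℝ (λ n → ℚ.- seq x n) (neg-cauchy {seq x} (cauchy x))

_-_ : ℝ → ℝ → ℝ
x - y = x + (- y)

_*_ : ℝ → ℝ → ℝ
x * y = mkℝ (λ n → seq x n ℚ.* seq y n) (mul-cauchy {seq x} {seq y} (cauchy x) (cauchy y))

∣_∣ : ℝ → ℝ
∣ x ∣ = mkℝ (λ n → ℚ.∣ seq x n ∣) (abs-cauchy {seq x} (cauchy x))

record _<_ (x y : ℝ) : Set where
  constructor mk<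
  field
    gap     : ℚ
    gap-pos : 0ℚ ℚ.< gap
    start   : ℕ
    apart   : ∀ n → start ℕ.≤ n → seq x n ℚ.+ gap ℚ.≤ seq y n

record _≤_ (x y : ℝ) : Set where
  constructor mk≤
  field
    eventually : ∀ ε → 0ℚ ℚ.< ε → ∃ λ N → ∀ n → N ℕ.≤ n → seq x n ℚ.≤ seq y n ℚ.+ ε

-- A witness of positivity supplies an eventual lower bound δ of the sequence,
-- so that truncating at δ changes only finitely many terms.
inverse : (x : ℝ) → 0ℝ < x → ℝ
inverse x (mk< δ 0<δ _ _) = mkℝ (λ n → recip δ 0<δ (seq x n)) (recip-cauchy {seq x} δ 0<δ (cauchy x))

_/_by_ : ℝ → (y : ℝ) → 0ℝ < y → ℝ
x / y by y>0 = x * inverse y y>0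

_/ℕ_ : ℝ → (n : ℕ) → .{{NonZero n}} → ℝ
x /ℕ n = x * fromℚ (+ 1 ℚ./ n)

exp : ℝ → ℝ
exp x = mkℝ (λ n → sum< (expTerm (seq x n)) (suc n)) (exp-cauchy {seq x} (cauchy x))

-- ln-suc m is ln (m + 1), obtained by telescoping.
ln-suc : ℕ → ℝ
ln-suc zero    = 0ℝ
ln-suc (suc m) = ln-suc m + mkℝ (sum< (lnTerm m)) (ln-cauchy m)

-- Only used for positive exponents, for which 0 ^ α = 0.
_^_ : ℕ → ℝ → ℝ
zero  ^ α = 0ℝ
suc m ^ α = exp (α * ln-suc m)

^-pos : ∀ m α → 0ℝ < α → 0ℝ < suc m ^ α
^-pos m α (mk< δ 0<δ N δ≤α) =
    mk< 1ℚ (ℚ.positive⁻¹ 1ℚ) N λ n N≤n →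
      ℚ.≤-trans (ℚ.≤-reflexive (ℚ.+-identityˡ 1ℚ))
        (RationalAnalysis.1≤exp (RationalAnalysis.*-nonNeg (α≥0 n N≤n) (ln≥0 m n)) n)
  where
  α≥0 : ∀ n → N ℕ.≤ n → 0ℚ ℚ.≤ seq α n
  α≥0 n N≤n = ℚ.≤-trans (ℚ.<⇒≤ 0<δ)
    (ℚ.≤-trans (ℚ.≤-reflexive (sym (ℚ.+-identityˡ δ))) (δ≤α n N≤n))
  ln≥0 : ∀ m n → 0ℚ ℚ.≤ seq (ln-suc m) n
  ln≥0 zero    n = ℚ.≤-refl
  ln≥0 (suc m) n = RationalAnalysis.+-nonNeg (ln≥0 m n)
    (RationalAnalysis.sum<-nonNeg (lnTerm m) (lnTerm-nonNeg m) n)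

Sequence : Set
Sequence = (n : ℕ) → .{{NonZero n}} → ℝ

_⟶_ : Sequence → ℝ → Set
a ⟶ L = ∀ ε → 0ℝ < ε → ∃ λ N → ∀ n → .{{_ : NonZero n}} → N ℕ.≤ n → ∣ a n - L ∣ < ε

------------------------------------------------------------------------
-- The adversarial-order secretary problem with an α-power signal

-- Time t + 1 is represented by t : Fin n.
record Instance (n : ℕ) : Set where
  field
    value          : Vec ℕ n
    i⋆             : Fin n
    unique-maximum : ∀ j → j ≢ i⋆ → lookup value j ℕ.< lookup value i⋆

open Instance public

record DeterministicPolicy (n : ℕ) : Set where
  field
    -- Whether to stop at time t, given the pairs (v_u , S = u) for u ≤ t.
    stop : (t : Fin n) → Vec (ℕ × Bool) (suc (toℕ t)) → Bool

open DeterministicPolicy public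

upTo : ∀ {n} (t : Fin n) → Fin (suc (toℕ t)) → Fin n
upTo t u = inject≤ u (Fin.toℕ<n t)

observations : ∀ {n} → Vec ℕ n → (s t : Fin n) → Vec (ℕ × Bool) (suc (toℕ t))
observations v s t = tabulate λ u → lookup v (upTo t u) , does (upTo t u Fin.≟ s)

StopsAt : ∀ {n} → DeterministicPolicy n → Vec ℕ n → (s t : Fin n) → Set
StopsAt π v s t =
  stop π t (observations v s t) ≡ true ×
  (∀ u → u Fin.< t → stop π u (observations v s u) ≡ false)

stopsAt? : ∀ {n} π v (s t : Fin n) → Dec (StopsAt π v s t)
stopsAt? π v s t =
  (stop π t (observations v s t) Bool.≟ true) ×-dec
  Fin.all? λ u → (u Fin.<? t) →-dec (stop π u (observations v s u) Bool.≟ false)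

module _ (α : ℝ) (α>0 : 0ℝ < α) where

  -- Pr[S = s] when the maximum is at i; the time of s is toℕ s + 1.
  signalProbability : ∀ {n} (i : Fin n) → Fin (suc (toℕ i)) → ℝ
  signalProbability i s =
    (suc (toℕ s) ^ α - toℕ s ^ α) / (suc (toℕ i) ^ α) by ^-pos (toℕ i) α α>0

  successProbability : ∀ {n} → DeterministicPolicy n → Instance n → ℝ
  successProbability π I = foldr _+_ 0ℝ λ (s : Fin (suc (toℕ (i⋆ I)))) →
    if does (stopsAt? π (value I) (upTo (i⋆ I) s) (i⋆ I))
    then signalProbability (i⋆ I) s
    else 0ℝ

  -- w is at least, respectively at most, the infimum over the infinitely many
  -- instances.  Constructively that infimum need not exist as a real number,
  -- so only its comparisons with real numbers are defined.
  WorstCase≤ WorstCase≥ : ∀ {n} → DeterministicPolicy n → ℝ → Set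
  WorstCase≤ {n} π w = ∀ ε → 0ℝ < ε → ∃ λ (I : Instance n) → successProbability π I < w + ε
  WorstCase≥ {n} π w = (I : Instance n) → w ≤ successProbability π I

  -- x is the supremum of those infima over all deterministic policies.
  IsOPTdet : ℕ → ℝ → Set
  IsOPTdet n x =
    ((π : DeterministicPolicy n) → WorstCase≤ π x) ×
    (∀ ε → 0ℝ < ε → ∃ λ (π : DeterministicPolicy n) → WorstCase≥ π (x - ε))

{-# OPTIONS --safe #-}
module Submission where

-- A policy that has seen no signal must wait.  On increasing values the policy is then
-- determined by the time τ s ≥ s at which it stops after a signal at s, so OPTdet is
-- the maximum over τ of the minimum over i of Σ_{τ s = i} (s ^ α - (s - 1) ^ α) / i ^ α,
-- because a policy that stops at τ s whatever the values are attains these terms.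
--
-- Taking τ s = s gives 1 - ((i - 1) / i) ^ α ≥ 1 - e ^ (- α / n).  Conversely, if all i
-- succeed with probability at least y, then multiplying by i ^ α and adding up counts
-- every s at most once, so y Σ i ^ α ≤ n ^ α.  For n = J + m and k ≥ m we have
-- k ^ α ≥ e ^ (- α / m) (k + 1) ^ α.  Hence Σ i ^ α is at least J m ^ α, and
-- (1 - e ^ (- α / m)) Σ i ^ α is at least n ^ α - m ^ α, which gives
-- y ≤ 1 - e ^ (- α / m) + 1 / J.  For fixed J, α / m has the same limit as α / n.

open import Defs using (module RationalAnalysis)
import Algebra.Properties.CommutativeMonoid.Sum as CommutativeMonoidSum
import Algebra.Properties.Monoid.Sum as MonoidSum
open import Algebra.Structures using (IsMagma; IsSemigroup; IsMonoid; IsCommutativeMonoid)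
open import Data.Bool using (Bool; true; false; if_then_else_)
import Data.Bool.Properties as Bool
open import Data.Fin as Fin using (Fin; toℕ; inject≤)
import Data.Fin.Properties as Fin
open import Data.Integer using (+_)
open import Data.Nat as ℕ using (ℕ; zero; suc; NonZero)
import Data.Nat.Properties as ℕ
open import Data.Product using (∃; _×_; _,_; proj₁; proj₂)
open import Data.Rational as ℚ using (ℚ; 0ℚ; 1ℚ)
import Data.Rational.Properties as ℚ
open import Data.Rational.Solver using (module +-*-Solver)
open import Data.Sum using (_⊎_; inj₁; inj₂)
open import Data.Vec as Vec using (Vec; lookup; tabulate)
open import Data.Vec.Functional using (foldr; head; tail; init; last)
import Data.Vec.Functional.Relation.Binary.Pointwise.Properties as Pointwise
open import Data.Vec.Properties using (lookup∘tabulate; tabulate-cong)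
open import Function using (_∘_; id)
open import Relation.Binary using (IsPreorder; Preorder)
open import Relation.Binary.Definitions using (tri<; tri≈; tri>)
open import Relation.Binary.PropositionalEquality as ≡
  using (_≡_; _≢_; refl; sym; trans; cong; cong₂; subst)
open import Relation.Nullary using (Dec; does; yes; no; contradiction)
open import Relation.Nullary.Decidable using (dec-true; dec-false; _×-dec_)
open +-*-Solver

-- The exponential series over ℚ

-- Real numbers are Cauchy sequences of rationals with an undecidable order. Hence a maximum over
-- finitely many tables is attained only up to each positive rational, and sign distinctions are
-- replaced by identities with absolute values.
--
-- `exp` is diagonal, the n-th partial sum at the n-th approximation, so its functional equation
-- requires an error estimate uniform in the argument. All bounds on powers then come from e ^ x e ^
-- y = e ^ (x + y), from 1 + x ≤ e ^ x, and from 1 / (k + 1) ≤ ln (k + 1) - ln k ≤ 1 / k.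
--
-- Of the two lower bounds on Σ i ^ α, the one with the factor 1 - e ^ (- α / m) is asymptotically
-- sharp but leaves the remainder m ^ α, and the other shows that this remainder is at most 1 / J of
-- the sum. J stays fixed while n grows because α / m = (α / n) (1 + J / m). The claim for α = o(n)
-- is the case c = 0 of the same estimates.

module ExponentialSeries where

  open import Data.Rational using (_+_; _-_; _*_; -_; ∣_∣; _≤_; _<_)
  open RationalAnalysis

  p≤∣p∣ : ∀ p → p ≤ ∣ p ∣
  p≤∣p∣ p with ℚ.≤-total 0ℚ p
  ... | inj₁ 0≤p = ℚ.≤-reflexive (sym (ℚ.0≤p⇒∣p∣≡p 0≤p))
  ... | inj₂ p≤0 = ℚ.≤-trans p≤0 (ℚ.0≤∣p∣ p)

  -- Σ_{i ≤ n} a i * b (n - i)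
  conv : (ℕ → ℚ) → (ℕ → ℚ) → ℕ → ℚ
  conv a b zero    = a 0 * b 0
  conv a b (suc n) = a 0 * b (suc n) + conv (a ∘ suc) b n

  conv-sucʳ : ∀ a b n → conv a b (suc n) ≡ conv a (b ∘ suc) n + a (suc n) * b 0
  conv-sucʳ a b zero    = refl
  conv-sucʳ a b (suc n) = trans
    (cong (λ z → a 0 * b (suc (suc n)) + z) (conv-sucʳ (a ∘ suc) b n))
    (sym (ℚ.+-assoc (a 0 * b (suc (suc n))) (conv (a ∘ suc) (b ∘ suc) n) (a (suc (suc n)) * b 0)))

  conv-+ : ∀ a a′ b n → conv (λ k → a k + a′ k) b n ≡ conv a b n + conv a′ b n
  conv-+ a a′ b zero    = ℚ.*-distribʳ-+ (b 0) (a 0) (a′ 0)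
  conv-+ a a′ b (suc n) = trans
    (cong (λ z → (a 0 + a′ 0) * b (suc n) + z) (conv-+ (a ∘ suc) (a′ ∘ suc) b n))
    (solve 5 (λ a a′ b x y → (a :+ a′) :* b :+ (x :+ y) := (a :* b :+ x) :+ (a′ :* b :+ y)) refl
      (a 0) (a′ 0) (b (suc n)) (conv (a ∘ suc) b n) (conv (a′ ∘ suc) b n))

  conv-congˡ : ∀ {a a′} b n → (∀ k → a k ≡ a′ k) → conv a b n ≡ conv a′ b n
  conv-congˡ b zero    eq = cong (_* b 0) (eq 0)
  conv-congˡ b (suc n) eq = cong₂ (λ x y → x * b (suc n) + y) (eq 0) (conv-congˡ b n (eq ∘ suc))

  conv-congʳ : ∀ a {b b′} n → (∀ k → b k ≡ b′ k) → conv a b n ≡ conv a b′ n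
  conv-congʳ a zero    eq = cong (a 0 *_) (eq 0)
  conv-congʳ a (suc n) eq = cong₂ (λ x y → a 0 * x + y) (eq (suc n)) (conv-congʳ (a ∘ suc) n eq)

  conv-*ˡ : ∀ x a b n → conv (λ k → x * a k) b n ≡ x * conv a b n
  conv-*ˡ x a b zero    = ℚ.*-assoc x (a 0) (b 0)
  conv-*ˡ x a b (suc n) = trans (cong (λ z → x * a 0 * b (suc n) + z) (conv-*ˡ x (a ∘ suc) b n))
    (solve 4 (λ x a b z → x :* a :* b :+ x :* z := x :* (a :* b :+ z)) refl x (a 0) (b (suc n)) (conv (a ∘ suc) b n))

  conv-*ʳ : ∀ y a b n → conv a (λ k → y * b k) n ≡ y * conv a b n
  conv-*ʳ y a b zero    = solve 3 (λ y a b → a :* (y :* b) := y :* (a :* b)) refl y (a 0) (b 0)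
  conv-*ʳ y a b (suc n) = trans (cong (λ z → a 0 * (y * b (suc n)) + z) (conv-*ʳ y (a ∘ suc) b n))
    (solve 4 (λ y a b z → a :* (y :* b) :+ y :* z := y :* (a :* b :+ z)) refl y (a 0) (b (suc n)) (conv (a ∘ suc) b n))

  -- The coefficients of z f′(z); convolution makes this a derivation.
  weighted : (ℕ → ℚ) → ℕ → ℚ
  weighted a k = ι k * a k

  weighted-suc : ∀ a k → weighted a (suc k) ≡ weighted (a ∘ suc) k + a (suc k)
  weighted-suc a k = trans (cong (_* a (suc k)) (ι-suc k))
    (solve 2 (λ i x → (i :+ con 1ℚ) :* x := i :* x :+ x) refl (ι k) (a (suc k)))

  -- Leibniz rule: on the product a i * b (n - i) the weight n splits as i + (n - i).
  weighted-conv : ∀ a b n → ι n * conv a b n ≡ conv (weighted a) b n + conv a (weighted b) n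
  weighted-conv a b zero    = solve 2 (λ a b → con 0ℚ :* (a :* b) := con 0ℚ :* a :* b :+ a :* (con 0ℚ :* b)) refl (a 0) (b 0)
  weighted-conv a b (suc n) = begin
      ι (suc n) * (a 0 * b (suc n) + c)
        ≡⟨ solve 4 (λ i a b c → i :* (a :* b :+ c) := a :* (i :* b) :+ i :* c) refl (ι (suc n)) (a 0) (b (suc n)) c ⟩
      a 0 * weighted b (suc n) + ι (suc n) * c
        ≡⟨ cong (λ z → a 0 * weighted b (suc n) + z) (trans (cong (_* c) (ι-suc n))
             (solve 2 (λ i c → (i :+ con 1ℚ) :* c := i :* c :+ c) refl (ι n) c)) ⟩
      a 0 * weighted b (suc n) + (ι n * c + c)
        ≡⟨ cong (λ z → a 0 * weighted b (suc n) + (z + c)) (weighted-conv (a ∘ suc) b n) ⟩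
      a 0 * weighted b (suc n) + (conv (weighted (a ∘ suc)) b n + d + c)
        ≡⟨ solve 6 (λ a v w d c b → a :* v :+ (w :+ d :+ c) := con 0ℚ :* a :* b :+ (w :+ c) :+ (a :* v :+ d)) refl
             (a 0) (weighted b (suc n)) (conv (weighted (a ∘ suc)) b n) d c (b (suc n)) ⟩
      0ℚ * a 0 * b (suc n) + (conv (weighted (a ∘ suc)) b n + c) + (a 0 * weighted b (suc n) + d)
        ≡⟨ cong (λ z → 0ℚ * a 0 * b (suc n) + z + (a 0 * weighted b (suc n) + d))
             (trans (sym (conv-+ (weighted (a ∘ suc)) (a ∘ suc) b n))
                    (conv-congˡ b n (sym ∘ weighted-suc a))) ⟩
      conv (weighted a) b (suc n) + conv a (weighted b) (suc n) ∎
    where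
    open ≡.≡-Reasoning
    c = conv (a ∘ suc) b n
    d = conv (a ∘ suc) (weighted b) n

  weighted-expTerm : ∀ x k → weighted (expTerm x) (suc k) ≡ x * expTerm x k
  weighted-expTerm x k = trans
    (solve 4 (λ i e x u → i :* (e :* (x :* u)) := u :* i :* (x :* e)) refl (ι (suc k)) (expTerm x k) x (unit k))
    (trans (cong (_* (x * expTerm x k)) (unit-inverse k)) (ℚ.*-identityˡ (x * expTerm x k)))

  -- The binomial theorem without binomial coefficients: by the Leibniz rule the convolution c
  -- satisfies (n + 1) c (n + 1) = (x + y) c n, the recurrence that defines `expTerm (x + y)`.
  conv-expTerm : ∀ x y n → conv (expTerm x) (expTerm y) n ≡ expTerm (x + y) n
  conv-expTerm x y zero    = refl
  conv-expTerm x y (suc n) = begin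
      C
        ≡⟨ ℚ.*-identityˡ C ⟨
      1ℚ * C
        ≡⟨ cong (_* C) (unit-inverse n) ⟨
      unit n * ι (suc n) * C
        ≡⟨ ℚ.*-assoc (unit n) (ι (suc n)) C ⟩
      unit n * (ι (suc n) * C)
        ≡⟨ cong (unit n *_) (weighted-conv (expTerm x) (expTerm y) (suc n)) ⟩
      unit n * (conv (weighted (expTerm x)) (expTerm y) (suc n) + conv (expTerm x) (weighted (expTerm y)) (suc n))
        ≡⟨ cong₂ (λ u v → unit n * (u + v)) shiftˡ shiftʳ ⟩
      unit n * (x * c + y * c)
        ≡⟨ solve 4 (λ u x y c → u :* (x :* c :+ y :* c) := c :* ((x :+ y) :* u)) refl (unit n) x y c ⟩
      c * ((x + y) * unit n)
        ≡⟨ cong (_* ((x + y) * unit n)) (conv-expTerm x y n) ⟩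
      expTerm (x + y) (suc n) ∎
    where
    open ≡.≡-Reasoning
    C = conv (expTerm x) (expTerm y) (suc n)
    c = conv (expTerm x) (expTerm y) n
    shiftˡ : conv (weighted (expTerm x)) (expTerm y) (suc n) ≡ x * c
    shiftˡ = trans
      (cong₂ _+_ (solve 2 (λ a b → con 0ℚ :* a :* b := con 0ℚ) refl (expTerm x 0) (expTerm y (suc n)))
        (trans (conv-congˡ (expTerm y) n (weighted-expTerm x)) (conv-*ˡ x (expTerm x) (expTerm y) n)))
      (ℚ.+-identityˡ (x * c))
    shiftʳ : conv (expTerm x) (weighted (expTerm y)) (suc n) ≡ y * c
    shiftʳ = trans (conv-sucʳ (expTerm x) (weighted (expTerm y)) n)
      (trans (cong₂ _+_
        (trans (conv-congʳ (expTerm x) n (weighted-expTerm y)) (conv-*ʳ y (expTerm x) (expTerm y) n))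
        (solve 2 (λ a b → a :* (con 0ℚ :* b) := con 0ℚ) refl (expTerm x (suc n)) (expTerm y 0)))
      (ℚ.+-identityʳ (y * c)))

  sum<-cong : ∀ {a b} n → (∀ k → a k ≡ b k) → sum< a n ≡ sum< b n
  sum<-cong zero    eq = refl
  sum<-cong (suc n) eq = cong₂ _+_ (sum<-cong n eq) (eq n)

  sum<-head : ∀ a n → sum< a (suc n) ≡ a 0 + sum< (a ∘ suc) n
  sum<-head a zero    = ℚ.+-comm 0ℚ (a 0)
  sum<-head a (suc n) = trans (cong (_+ a (suc n)) (sum<-head a n)) (ℚ.+-assoc (a 0) (sum< (a ∘ suc) n) (a (suc n)))

  -- Row i = 0 of the triangle i + j ≤ n + 1 is split off; the other rows form a smaller triangle
  -- for the shifted a.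
  sum<-conv : ∀ a b n → sum< (conv a b) (suc (suc n)) ≡ a 0 * sum< b (suc (suc n)) + sum< (conv (a ∘ suc) b) (suc n)
  sum<-conv a b zero    = solve 4 (λ a b b′ c → con 0ℚ :+ a :* b :+ (a :* b′ :+ c) := a :* (con 0ℚ :+ b :+ b′) :+ (con 0ℚ :+ c))
    refl (a 0) (b 0) (b 1) (a 1 * b 0)
  sum<-conv a b (suc n) = trans (cong (_+ conv a b (suc (suc n))) (sum<-conv a b n))
    (solve 5 (λ a s t b c → a :* s :+ t :+ (a :* b :+ c) := a :* (s :+ b) :+ (t :+ c)) refl
      (a 0) (sum< b (suc (suc n))) (sum< (conv (a ∘ suc) b) (suc n)) (b (suc (suc n))) (conv (a ∘ suc) b (suc n)))

  sum<-difference : ∀ {b b̂ : ℕ → ℚ} → (∀ k → ∣ b k ∣ ≤ b̂ k) → ∀ m d →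
    ∣ sum< b (d ℕ.+ m) - sum< b m ∣ ≤ sum< b̂ (d ℕ.+ m) - sum< b̂ m
  sum<-difference {b} {b̂} b≤ m zero = ℚ.≤-reflexive
    (trans (cong ∣_∣ (ℚ.+-inverseʳ (sum< b m))) (sym (ℚ.+-inverseʳ (sum< b̂ m))))
  sum<-difference {b} {b̂} b≤ m (suc d) = begin
      ∣ sum< b k + b k - sum< b m ∣
        ≡⟨ cong ∣_∣ (solve 3 (λ x y z → x :+ y :- z := (x :- z) :+ y) refl (sum< b k) (b k) (sum< b m)) ⟩
      ∣ (sum< b k - sum< b m) + b k ∣
        ≤⟨ ℚ.∣p+q∣≤∣p∣+∣q∣ (sum< b k - sum< b m) (b k) ⟩
      ∣ sum< b k - sum< b m ∣ + ∣ b k ∣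
        ≤⟨ ℚ.+-mono-≤ (sum<-difference b≤ m d) (b≤ k) ⟩
      (sum< b̂ k - sum< b̂ m) + b̂ k
        ≡⟨ solve 3 (λ x y z → x :+ y :- z := (x :- z) :+ y) refl (sum< b̂ k) (b̂ k) (sum< b̂ m) ⟨
      sum< b̂ k + b̂ k - sum< b̂ m
        ∎
    where
    open ℚ.≤-Reasoning
    k = d ℕ.+ m

  -- Square minus triangle is a sum of products a i * b j, so it is dominated
  -- by square minus triangle of the dominating sequences.
  square-triangle : ∀ {a â b b̂ : ℕ → ℚ} → (∀ k → ∣ a k ∣ ≤ â k) → (∀ k → ∣ b k ∣ ≤ b̂ k) → ∀ m d →
    ∣ sum< a (suc m) * sum< b (suc (d ℕ.+ m)) - sum< (conv a b) (suc m) ∣ ≤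
    sum< â (suc m) * sum< b̂ (suc (d ℕ.+ m)) - sum< (conv â b̂) (suc m)
  square-triangle {a} {â} {b} {b̂} a≤ b≤ zero d = begin
      ∣ (0ℚ + a 0) * S - (0ℚ + a 0 * b 0) ∣
        ≡⟨ cong ∣_∣ (factor (a 0) S (b 0)) ⟩
      ∣ a 0 * (S - (0ℚ + b 0)) ∣
        ≡⟨ ℚ.∣p*q∣≡∣p∣*∣q∣ (a 0) (S - (0ℚ + b 0)) ⟩
      ∣ a 0 ∣ * ∣ S - (0ℚ + b 0) ∣
        ≤⟨ *-mono (ℚ.0≤∣p∣ _) (a≤ 0) diff (ℚ.≤-trans (ℚ.0≤∣p∣ (a 0)) (a≤ 0)) ⟩
      â 0 * (Ŝ - (0ℚ + b̂ 0))
        ≡⟨ factor (â 0) Ŝ (b̂ 0) ⟨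
      (0ℚ + â 0) * Ŝ - (0ℚ + â 0 * b̂ 0) ∎
    where
    open ℚ.≤-Reasoning
    S = sum< b (suc (d ℕ.+ 0))
    Ŝ = sum< b̂ (suc (d ℕ.+ 0))
    factor : ∀ a s b → (0ℚ + a) * s - (0ℚ + a * b) ≡ a * (s - (0ℚ + b))
    factor = solve 3 (λ a s b → (con 0ℚ :+ a) :* s :- (con 0ℚ :+ a :* b) := a :* (s :- (con 0ℚ :+ b))) refl
    diff : ∣ S - (0ℚ + b 0) ∣ ≤ Ŝ - (0ℚ + b̂ 0)
    diff = subst (λ j → ∣ sum< b j - (0ℚ + b 0) ∣ ≤ sum< b̂ j - (0ℚ + b̂ 0)) (ℕ.+-suc d 0)
      (sum<-difference b≤ 1 d)
  square-triangle {a} {â} {b} {b̂} a≤ b≤ (suc m) d = begin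
      ∣ sum< a (2+ m) * S - sum< (conv a b) (2+ m) ∣
        ≡⟨ cong ∣_∣ (peel a b) ⟩
      ∣ a 0 * (S - s) + (sum< a′ (suc m) * S - t) ∣
        ≤⟨ ℚ.∣p+q∣≤∣p∣+∣q∣ (a 0 * (S - s)) (sum< a′ (suc m) * S - t) ⟩
      ∣ a 0 * (S - s) ∣ + ∣ sum< a′ (suc m) * S - t ∣
        ≡⟨ cong (_+ ∣ sum< a′ (suc m) * S - t ∣) (ℚ.∣p*q∣≡∣p∣*∣q∣ (a 0) (S - s)) ⟩
      ∣ a 0 ∣ * ∣ S - s ∣ + ∣ sum< a′ (suc m) * S - t ∣
        ≤⟨ ℚ.+-mono-≤ (*-mono (ℚ.0≤∣p∣ _) (a≤ 0) diff (ℚ.≤-trans (ℚ.0≤∣p∣ (a 0)) (a≤ 0))) rest ⟩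
      â 0 * (Ŝ - sum< b̂ (2+ m)) + (sum< (â ∘ suc) (suc m) * Ŝ - sum< (conv (â ∘ suc) b̂) (suc m))
        ≡⟨ peel â b̂ ⟨
      sum< â (2+ m) * Ŝ - sum< (conv â b̂) (2+ m) ∎
    where
    open ℚ.≤-Reasoning
    2+ : ℕ → ℕ
    2+ n = suc (suc n)
    a′ = a ∘ suc
    S = sum< b (suc (d ℕ.+ suc m))
    Ŝ = sum< b̂ (suc (d ℕ.+ suc m))
    s = sum< b (2+ m)
    t = sum< (conv a′ b) (suc m)
    peel : ∀ a b → sum< a (2+ m) * sum< b (suc (d ℕ.+ suc m)) - sum< (conv a b) (2+ m) ≡
      a 0 * (sum< b (suc (d ℕ.+ suc m)) - sum< b (2+ m)) +
      (sum< (a ∘ suc) (suc m) * sum< b (suc (d ℕ.+ suc m)) - sum< (conv (a ∘ suc) b) (suc m))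
    peel a b = trans
      (cong₂ (λ u v → u * sum< b (suc (d ℕ.+ suc m)) - v) (sum<-head a (suc m)) (sum<-conv a b m))
      (solve 5 (λ a A S s t → (a :+ A) :* S :- (a :* s :+ t) := a :* (S :- s) :+ (A :* S :- t)) refl
        (a 0) (sum< (a ∘ suc) (suc m)) (sum< b (suc (d ℕ.+ suc m))) (sum< b (2+ m)) (sum< (conv (a ∘ suc) b) (suc m)))
    diff : ∣ S - s ∣ ≤ Ŝ - sum< b̂ (2+ m)
    diff = subst (λ j → ∣ sum< b j - s ∣ ≤ sum< b̂ j - sum< b̂ (2+ m)) (ℕ.+-suc d (suc m))
      (sum<-difference b≤ (2+ m) d)
    -- Removing a row of the rectangle leaves the length of the rows unchanged, so d grows by one as
    -- m drops by one. This is why the statement allows rectangles and not only squares.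
    rest : ∣ sum< a′ (suc m) * S - t ∣ ≤ sum< (â ∘ suc) (suc m) * Ŝ - sum< (conv (â ∘ suc) b̂) (suc m)
    rest = subst (λ j → ∣ sum< a′ (suc m) * sum< b j - t ∣ ≤
                        sum< (â ∘ suc) (suc m) * sum< b̂ j - sum< (conv (â ∘ suc) b̂) (suc m))
      (cong suc (sym (ℕ.+-suc d m))) (square-triangle {a′} {â ∘ suc} {b} {b̂} (a≤ ∘ suc) b≤ m (suc d))

  sum<-mono : ∀ {a : ℕ → ℚ} → (∀ k → 0ℚ ≤ a k) → ∀ {m n} → m ℕ.≤ n → sum< a m ≤ sum< a n
  sum<-mono {a} a≥0 {m} {n} m≤n = subst (λ j → sum< a m ≤ sum< a j) (ℕ.m∸n+n≡m m≤n) (go (n ℕ.∸ m))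
    where
    go : ∀ d → sum< a m ≤ sum< a (d ℕ.+ m)
    go zero    = ℚ.≤-refl
    go (suc d) = ℚ.≤-trans (go d) (p≤p+q (sum< a (d ℕ.+ m)) (a≥0 (d ℕ.+ m)))

  -- The rectangle i ≤ m, j ≤ n lies inside the triangle i + j ≤ m + n, and all products are
  -- nonnegative.
  square≤triangle : ∀ {a b : ℕ → ℚ} → (∀ k → 0ℚ ≤ a k) → (∀ k → 0ℚ ≤ b k) → ∀ m n →
    sum< a (suc m) * sum< b (suc n) ≤ sum< (conv a b) (suc (m ℕ.+ n))
  square≤triangle {a} {b} a≥0 b≥0 zero n = begin
      (0ℚ + a 0) * sum< b (suc n)
        ≡⟨ cong (_* sum< b (suc n)) (ℚ.+-identityˡ (a 0)) ⟩
      a 0 * sum< b (suc n)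
        ≤⟨ base n ⟩
      sum< (conv a b) (suc n) ∎
    where
    open ℚ.≤-Reasoning
    conv≥0 : ∀ {a} → (∀ k → 0ℚ ≤ a k) → ∀ n → 0ℚ ≤ conv a b n
    conv≥0 a≥0 zero    = *-nonNeg (a≥0 0) (b≥0 0)
    conv≥0 a≥0 (suc n) = +-nonNeg (*-nonNeg (a≥0 0) (b≥0 (suc n))) (conv≥0 (a≥0 ∘ suc) n)
    base : ∀ n → a 0 * sum< b (suc n) ≤ sum< (conv a b) (suc n)
    base zero    = ℚ.≤-reflexive (solve 2 (λ a b → a :* (con 0ℚ :+ b) := con 0ℚ :+ a :* b) refl (a 0) (b 0))
    base (suc n) = ℚ.≤-trans (p≤p+q _ (sum<-nonNeg (conv (a ∘ suc) b) (conv≥0 (a≥0 ∘ suc)) (suc n)))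
      (ℚ.≤-reflexive (sym (sum<-conv a b n)))
  square≤triangle {a} {b} a≥0 b≥0 (suc m) n = begin
      sum< a (suc (suc m)) * S
        ≡⟨ trans (cong (_* S) (sum<-head a (suc m))) (ℚ.*-distribʳ-+ S (a 0) (sum< (a ∘ suc) (suc m))) ⟩
      a 0 * S + sum< (a ∘ suc) (suc m) * S
        ≤⟨ ℚ.+-mono-≤ (*-monoˡ (a 0) (a≥0 0) (sum<-mono b≥0 (ℕ.s≤s (ℕ.m≤n+m n (suc m)))))
                      (square≤triangle {a ∘ suc} {b} (a≥0 ∘ suc) b≥0 m n) ⟩
      a 0 * sum< b (suc (suc (m ℕ.+ n))) + sum< (conv (a ∘ suc) b) (suc (m ℕ.+ n))
        ≡⟨ sum<-conv a b (m ℕ.+ n) ⟨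
      sum< (conv a b) (suc (suc (m ℕ.+ n))) ∎
    where
    open ℚ.≤-Reasoning
    S = sum< b (suc n)

  E : ℚ → ℕ → ℚ
  E x n = sum< (expTerm x) (suc n)

  -- `square-triangle` reduces the error to the case x = y = K, where the square of side n lies in
  -- the triangle of side 2 n. Triangles are partial sums of the series for K + K, so the error is
  -- bounded by a Cauchy difference of a single convergent series.
  E-+ : ∀ K {x y} → ∣ x ∣ ≤ ι K → ∣ y ∣ ≤ ι K → ∀ n →
    ∣ E x n * E y n - E (x + y) n ∣ ≤ E (ι K + ι K) (n ℕ.+ n) - E (ι K + ι K) n
  E-+ K {x} {y} ∣x∣≤K ∣y∣≤K n = begin
      ∣ E x n * E y n - E (x + y) n ∣
        ≡⟨ cong (λ t → ∣ E x n * E y n - t ∣) (sum<-cong (suc n) (conv-expTerm x y)) ⟨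
      ∣ E x n * E y n - sum< (conv (expTerm x) (expTerm y)) (suc n) ∣
        ≤⟨ square-triangle (ExpBound.expTerm-bound K ∣x∣≤K) (ExpBound.expTerm-bound K ∣y∣≤K) n 0 ⟩
      E B n * E B n - sum< (conv (expTerm B) (expTerm B)) (suc n)
        ≤⟨ ℚ.+-monoˡ-≤ (- sum< (conv (expTerm B) (expTerm B)) (suc n)) (square≤triangle e≥0 e≥0 n n) ⟩
      sum< (conv (expTerm B) (expTerm B)) (suc (n ℕ.+ n)) - sum< (conv (expTerm B) (expTerm B)) (suc n)
        ≡⟨ cong₂ _-_ (sum<-cong (suc (n ℕ.+ n)) (conv-expTerm B B)) (sum<-cong (suc n) (conv-expTerm B B)) ⟩
      E (B + B) (n ℕ.+ n) - E (B + B) n ∎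
    where
    open ℚ.≤-Reasoning
    B = ι K
    e≥0 = expTerm-nonNeg (ι-nonNeg K)

  -- The error of the functional equation tends to 0, uniformly for bounded arguments.
  E-+-uniform : ∀ K ε → 0ℚ < ε → ∃ λ N → ∀ n → N ℕ.≤ n → ∀ {x y} → ∣ x ∣ ≤ ι K → ∣ y ∣ ≤ ι K →
    ∣ E x n * E y n - E (x + y) n ∣ ≤ ε
  E-+-uniform K ε 0<ε =
    let N , close = exp-cauchy (const-cauchy (ι K + ι K)) ε 0<ε
    in N , λ n N≤n ∣x∣≤K ∣y∣≤K → ℚ.≤-trans (E-+ K ∣x∣≤K ∣y∣≤K n)
      (ℚ.≤-trans (p≤∣p∣ (E (ι K + ι K) (n ℕ.+ n) - E (ι K + ι K) n))
                 (close (n ℕ.+ n) n (ℕ.≤-trans N≤n (ℕ.m≤m+n n n)) N≤n))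

  E-zero : ∀ n → E 0ℚ n ≡ 1ℚ
  E-zero zero    = refl
  E-zero (suc n) = trans (cong₂ _+_ (E-zero n)
      (solve 2 (λ e u → e :* (con 0ℚ :* u) := con 0ℚ) refl (expTerm 0ℚ n) (unit n)))
    (ℚ.+-identityʳ 1ℚ)

  1+x≤E : ∀ {x} → 0ℚ ≤ x → ∀ {n} → 1 ℕ.≤ n → 1ℚ + x ≤ E x n
  1+x≤E {x} x≥0 1≤n = ℚ.≤-trans
    (ℚ.≤-reflexive (solve 1 (λ x → con 1ℚ :+ x := con 0ℚ :+ con 1ℚ :+ con 1ℚ :* (x :* con 1ℚ)) refl x))
    (sum<-mono (expTerm-nonNeg x≥0) (ℕ.s≤s 1≤n))

  unit≤1 : ∀ k → unit k ≤ 1ℚ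
  unit≤1 zero    = ℚ.≤-refl
  unit≤1 (suc k) = ℚ.≤-trans (unit-step k) (unit≤1 k)

  -- A form of (1 - x) e ^ x ≤ 1, from which 1 + x ≤ e ^ x follows for negative arguments. Each term
  -- is at most x times its predecessor, since `unit n` is at most 1.
  E≤1+xE : ∀ {x} → 0ℚ ≤ x → ∀ n → E x n ≤ 1ℚ + x * E x n
  E≤1+xE {x} x≥0 n = ℚ.≤-trans (go n) (ℚ.+-monoʳ-≤ 1ℚ (*-monoˡ x x≥0 (p≤p+q (sum< (expTerm x) n) (e≥0 n))))
    where
    e≥0 = expTerm-nonNeg x≥0
    go : ∀ n → E x n ≤ 1ℚ + x * sum< (expTerm x) n
    go zero    = ℚ.≤-reflexive (solve 1 (λ x → con 0ℚ :+ con 1ℚ := con 1ℚ :+ x :* con 0ℚ) refl x)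
    go (suc n) = begin
        E x n + e * (x * unit n)
          ≤⟨ ℚ.+-mono-≤ (go n) (*-monoˡ e (e≥0 n) (*-monoˡ x x≥0 (unit≤1 n))) ⟩
        1ℚ + x * s + e * (x * 1ℚ)
          ≡⟨ solve 3 (λ x s e → con 1ℚ :+ x :* s :+ e :* (x :* con 1ℚ) := con 1ℚ :+ x :* (s :+ e)) refl x s e ⟩
        1ℚ + x * (s + e) ∎
      where
      open ℚ.≤-Reasoning
      e = expTerm x n
      s = sum< (expTerm x) n

  -- For x = - t < 0, multiply by E t n, which inverts E x n up to ε.
  1+x≤E+ε : ∀ x n ε → 1 ℕ.≤ n → 0ℚ ≤ ε → ∣ E x n * E (- x) n - E (x + - x) n ∣ ≤ ε →
    1ℚ + x ≤ E x n + ε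
  1+x≤E+ε x n ε 1≤n ε≥0 inv with ℚ.≤-total 0ℚ x
  ... | inj₁ x≥0 = ℚ.≤-trans (1+x≤E x≥0 1≤n) (p≤p+q (E x n) ε≥0)
  ... | inj₂ x≤0 = ℚ.*-cancelʳ-≤-pos T {{ℚ.positive (ℚ.<-≤-trans (ℚ.positive⁻¹ 1ℚ) 1≤T)}} (begin
        (1ℚ + x) * T
          ≡⟨ solve 2 (λ x T → (con 1ℚ :+ x) :* T := T :- (:- x) :* T) refl x T ⟩
        T - t * T
          ≤⟨ ℚ.+-monoˡ-≤ (- (t * T)) (E≤1+xE t≥0 n) ⟩
        1ℚ + t * T - t * T
          ≡⟨ solve 2 (λ z e → con 1ℚ :+ z :- z := con 1ℚ :- e :+ e) refl (t * T) (X * T) ⟩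
        1ℚ - X * T + X * T
          ≤⟨ ℚ.+-monoˡ-≤ (X * T) 1-XT≤ε ⟩
        ε + X * T
          ≤⟨ ℚ.+-monoˡ-≤ (X * T) (ℚ.≤-trans (ℚ.≤-reflexive (sym (ℚ.*-identityʳ ε))) (*-monoˡ ε ε≥0 1≤T)) ⟩
        ε * T + X * T
          ≡⟨ solve 3 (λ e X T → e :* T :+ X :* T := (X :+ e) :* T) refl ε X T ⟩
        (X + ε) * T ∎)
    where
    open ℚ.≤-Reasoning
    t = - x
    T = E (- x) n
    X = E x n
    t≥0 : 0ℚ ≤ t
    t≥0 = ℚ.neg-antimono-≤ x≤0
    1≤T : 1ℚ ≤ T
    1≤T = 1≤exp t≥0 n
    1-XT≤ε : 1ℚ - X * T ≤ ε
    1-XT≤ε = begin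
      1ℚ - X * T                   ≤⟨ p≤∣p∣ (1ℚ - X * T) ⟩
      ∣ 1ℚ - X * T ∣               ≡⟨ ∣∣-sym 1ℚ (X * T) ⟩
      ∣ X * T - 1ℚ ∣               ≡⟨ cong (λ r → ∣ X * T - r ∣) (trans (cong (λ r → E r n) (ℚ.+-inverseʳ x)) (E-zero n)) ⟨
      ∣ X * T - E (x + - x) n ∣    ≤⟨ inv ⟩
      ε                            ∎

open import Defs
open ExponentialSeries
open RationalAnalysis using
  (*-monoˡ; *-monoʳ; *-nonNeg; +-nonNeg; p≤p+q; split; two; eventually-bounded; ι; ι-suc; ι-+;
   ι-mono; ι-nonNeg; archimedean; unit; unit-pos; unit-nonNeg; unit-step; unit-inverse;
   sum<; lnTerm; lnTerm-nonNeg)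

-- Real numbers as an ordered ring

infix 4 _≈_

record _≈_ (x y : ℝ) : Set where
  constructor mk≈
  field
    ≈⇒≤ : x ≤ y
    ≈⇒≥ : y ≤ x

open _≈_

halve : ∀ ε → 0ℚ ℚ.< ε → ∃ λ η → 0ℚ ℚ.< η × η ℚ.+ η ≡ ε
halve ε 0<ε with split two (ℚ.positive⁻¹ two) ε 0<ε
... | η , 0<η , eq = η , 0<η ,
  ≡.trans (solve 1 (λ e → e :+ e := (con 1ℚ :+ con 1ℚ) :* e) ≡.refl η) eq

eventually⇒≤ : ∀ {x y} N → (∀ n → N ℕ.≤ n → seq x n ℚ.≤ seq y n) → x ≤ y
eventually⇒≤ {x} {y} N h = mk≤ λ ε 0<ε → N , λ n N≤n →
  ℚ.≤-trans (h n N≤n) (p≤p+q (seq y n) (ℚ.<⇒≤ 0<ε))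

pointwise : ∀ {x y} → (∀ n → seq x n ≡ seq y n) → x ≈ y
pointwise eq = mk≈ (eventually⇒≤ 0 λ n _ → ℚ.≤-reflexive (eq n))
                   (eventually⇒≤ 0 λ n _ → ℚ.≤-reflexive (≡.sym (eq n)))

fromℚ-mono : ∀ {p q} → p ℚ.≤ q → fromℚ p ≤ fromℚ q
fromℚ-mono p≤q = eventually⇒≤ 0 λ _ _ → p≤q

≤-refl : ∀ {x} → x ≤ x
≤-refl = eventually⇒≤ 0 λ _ _ → ℚ.≤-refl

≤-trans : ∀ {x y z} → x ≤ y → y ≤ z → x ≤ z
≤-trans {x} {y} {z} (mk≤ f) (mk≤ g) = mk≤ λ ε 0<ε →
  let η , 0<η , η+η≡ε = halve ε 0<ε
      M , hM = f η 0<η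
      N , hN = g η 0<η
  in M ℕ.⊔ N , λ n le → let open ℚ.≤-Reasoning in begin
    seq x n                   ≤⟨ hM n (ℕ.m⊔n≤o⇒m≤o M N le) ⟩
    seq y n ℚ.+ η             ≤⟨ ℚ.+-monoˡ-≤ η (hN n (ℕ.m⊔n≤o⇒n≤o M N le)) ⟩
    seq z n ℚ.+ η ℚ.+ η       ≡⟨ ℚ.+-assoc (seq z n) η η ⟩
    seq z n ℚ.+ (η ℚ.+ η)     ≡⟨ cong (λ e → seq z n ℚ.+ e) η+η≡ε ⟩
    seq z n ℚ.+ ε             ∎

+-mono : ∀ x y u v → x ≤ y → u ≤ v → x + u ≤ y + v
+-mono x y u v (mk≤ f) (mk≤ g) = mk≤ λ ε 0<ε →
  let η , 0<η , η+η≡ε = halve ε 0<ε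
      M , hM = f η 0<η
      N , hN = g η 0<η
  in M ℕ.⊔ N , λ n le → let open ℚ.≤-Reasoning in begin
    seq x n ℚ.+ seq u n
      ≤⟨ ℚ.+-mono-≤ (hM n (ℕ.m⊔n≤o⇒m≤o M N le)) (hN n (ℕ.m⊔n≤o⇒n≤o M N le)) ⟩
    (seq y n ℚ.+ η) ℚ.+ (seq v n ℚ.+ η)
      ≡⟨ solve 3 (λ y v e → (y :+ e) :+ (v :+ e) := y :+ v :+ (e :+ e)) ≡.refl (seq y n) (seq v n) η ⟩
    seq y n ℚ.+ seq v n ℚ.+ (η ℚ.+ η)
      ≡⟨ cong (λ e → seq y n ℚ.+ seq v n ℚ.+ e) η+η≡ε ⟩
    seq y n ℚ.+ seq v n ℚ.+ ε ∎

neg-anti : ∀ x y → x ≤ y → - y ≤ - x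
neg-anti x y (mk≤ f) = mk≤ λ ε 0<ε → let N , h = f ε 0<ε in N , λ n le →
  let open ℚ.≤-Reasoning in begin
    ℚ.- seq y n
      ≡⟨ solve 2 (λ y e → :- y := :- (y :+ e) :+ e) ≡.refl (seq y n) ε ⟩
    ℚ.- (seq y n ℚ.+ ε) ℚ.+ ε
      ≤⟨ ℚ.+-monoˡ-≤ ε (ℚ.neg-antimono-≤ (h n le)) ⟩
    ℚ.- seq x n ℚ.+ ε ∎

∣p∣≤q⇒-q≤p : ∀ p q → ℚ.∣ p ∣ ℚ.≤ q → 0ℚ ℚ.≤ p ℚ.+ q
∣p∣≤q⇒-q≤p p q ∣p∣≤q = begin
    0ℚ                     ≡⟨ ℚ.+-inverseʳ p ⟨
    p ℚ.- p                ≤⟨ ℚ.+-monoʳ-≤ p (ℚ.≤-trans (p≤∣p∣ (ℚ.- p)) (ℚ.≤-reflexive (ℚ.∣-p∣≡∣p∣ p))) ⟩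
    p ℚ.+ ℚ.∣ p ∣          ≤⟨ ℚ.+-monoʳ-≤ p ∣p∣≤q ⟩
    p ℚ.+ q                ∎
  where open ℚ.≤-Reasoning

-- If p, q ≥ - η then 0 ≤ (p + η) (q + η), so p q ≥ - η (p + q + η).
*-nonNegative : ∀ x y → 0ℝ ≤ x → 0ℝ ≤ y → 0ℝ ≤ x * y
*-nonNegative x y (mk≤ f) (mk≤ g) = mk≤ λ ε 0<ε →
  let A , 0≤A , M₁ , boundA = eventually-bounded {seq x} (cauchy x)
      B , 0≤B , M₂ , boundB = eventually-bounded {seq y} (cauchy y)
      -- The summand 1 makes room for η in p + q + η, and the summand ε ensures η ≤ 1, because K η =
      -- ε ≤ K.
      K = A ℚ.+ B ℚ.+ 1ℚ ℚ.+ ε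
      0≤A+B+1 = +-nonNeg (+-nonNeg 0≤A 0≤B) (ℚ.nonNegative⁻¹ 1ℚ)
      0<K = ℚ.+-mono-≤-< 0≤A+B+1 0<ε
      η , 0<η , Kη≡ε = split K 0<K ε 0<ε
      N₁ , hN₁ = f η 0<η
      N₂ , hN₂ = g η 0<η
      η≤1 : η ℚ.≤ 1ℚ
      η≤1 = ℚ.*-cancelˡ-≤-pos K {{ℚ.positive 0<K}} (ℚ.≤-trans (ℚ.≤-reflexive Kη≡ε)
              (ℚ.≤-trans (ℚ.≤-trans (ℚ.≤-reflexive (≡.sym (ℚ.+-identityˡ ε))) (ℚ.+-monoˡ-≤ ε 0≤A+B+1))
                         (ℚ.≤-reflexive (≡.sym (ℚ.*-identityʳ K)))))
  in (M₁ ℕ.⊔ M₂) ℕ.⊔ (N₁ ℕ.⊔ N₂) , λ n le →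
  let leM = ℕ.m⊔n≤o⇒m≤o (M₁ ℕ.⊔ M₂) (N₁ ℕ.⊔ N₂) le
      leN = ℕ.m⊔n≤o⇒n≤o (M₁ ℕ.⊔ M₂) (N₁ ℕ.⊔ N₂) le
      p = seq x n
      q = seq y n
      p≤A = ℚ.≤-trans (p≤∣p∣ p) (boundA n (ℕ.m⊔n≤o⇒m≤o M₁ M₂ leM))
      q≤B = ℚ.≤-trans (p≤∣p∣ q) (boundB n (ℕ.m⊔n≤o⇒n≤o M₁ M₂ leM))
      open ℚ.≤-Reasoning
  in begin
    0ℚ
      ≤⟨ *-nonNeg (hN₁ n (ℕ.m⊔n≤o⇒m≤o N₁ N₂ leN)) (hN₂ n (ℕ.m⊔n≤o⇒n≤o N₁ N₂ leN)) ⟩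
    (p ℚ.+ η) ℚ.* (q ℚ.+ η)
      ≡⟨ solve 3 (λ p q e → (p :+ e) :* (q :+ e) := p :* q :+ (p :+ q :+ e) :* e) ≡.refl p q η ⟩
    p ℚ.* q ℚ.+ (p ℚ.+ q ℚ.+ η) ℚ.* η
      ≤⟨ ℚ.+-monoʳ-≤ (p ℚ.* q) (*-monoʳ η (ℚ.<⇒≤ 0<η)
           (ℚ.≤-trans (ℚ.+-mono-≤ (ℚ.+-mono-≤ p≤A q≤B) η≤1) (p≤p+q (A ℚ.+ B ℚ.+ 1ℚ) (ℚ.<⇒≤ 0<ε)))) ⟩
    p ℚ.* q ℚ.+ K ℚ.* η
      ≡⟨ cong (λ e → p ℚ.* q ℚ.+ e) Kη≡ε ⟩
    p ℚ.* q ℚ.+ ε ∎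

≈-refl : ∀ {x} → x ≈ x
≈-refl = mk≈ ≤-refl ≤-refl

≈-sym : ∀ {x y} → x ≈ y → y ≈ x
≈-sym (mk≈ p q) = mk≈ q p

≈-trans : ∀ {x y z} → x ≈ y → y ≈ z → x ≈ z
≈-trans (mk≈ p q) (mk≈ r s) = mk≈ (≤-trans p r) (≤-trans s q)

≤-isPreorder : IsPreorder _≈_ _≤_
≤-isPreorder = record
  { isEquivalence = record { refl = ≈-refl ; sym = ≈-sym ; trans = ≈-trans }
  ; reflexive     = ≈⇒≤
  ; trans         = ≤-trans
  }

≤-preorder : Preorder _ _ _
≤-preorder = record { isPreorder = ≤-isPreorder }

module ≤-Reasoning where
  open import Relation.Binary.Reasoning.Preorder ≤-preorder public

+-cong : ∀ x y u v → x ≈ y → u ≈ v → x + u ≈ y + v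
+-cong x y u v (mk≈ p q) (mk≈ r s) = mk≈ (+-mono x y u v p r) (+-mono y x v u q s)

≤⇒0≤- : ∀ x y → x ≤ y → 0ℝ ≤ y - x
≤⇒0≤- x y x≤y = begin
    0ℝ       ≈⟨ pointwise (λ n → ℚ.+-inverseʳ (seq x n)) ⟨
    x - x    ≲⟨ +-mono x y (- x) (- x) x≤y ≤-refl ⟩
    y - x    ∎
  where open ≤-Reasoning

0≤-⇒≤ : ∀ x y → 0ℝ ≤ y - x → x ≤ y
0≤-⇒≤ x y h = begin
    x            ≈⟨ pointwise (λ n → ℚ.+-identityˡ (seq x n)) ⟨
    0ℝ + x       ≲⟨ +-mono 0ℝ (y - x) x x h ≤-refl ⟩
    y - x + x    ≈⟨ pointwise (λ n → solve 2 (λ x y → y :- x :+ x := y) ≡.refl (seq x n) (seq y n)) ⟩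
    y            ∎
  where open ≤-Reasoning

*-monoˡ-≤ : ∀ z x y → 0ℝ ≤ z → x ≤ y → z * x ≤ z * y
*-monoˡ-≤ z x y 0≤z x≤y = 0≤-⇒≤ (z * x) (z * y) (begin
    0ℝ               ≲⟨ *-nonNegative z (y - x) 0≤z (≤⇒0≤- x y x≤y) ⟩
    z * (y - x)      ≈⟨ pointwise (λ n → solve 3 (λ x y z → z :* (y :- x) := z :* y :- z :* x) ≡.refl (seq x n) (seq y n) (seq z n)) ⟩
    z * y - z * x    ∎)
  where open ≤-Reasoning

-- Two inequalities with the same difference of sides are equivalent, so a
-- rearrangement is an instance of the ring solver.
≤-rearrange : ∀ x y u v → x ≤ y →
  (∀ n → seq y n ℚ.- seq x n ≡ seq v n ℚ.- seq u n) → u ≤ v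
≤-rearrange x y u v x≤y eq = 0≤-⇒≤ u v (≤-trans (≤⇒0≤- x y x≤y) (≈⇒≤ (pointwise eq)))

*-comm-≈ : ∀ x y → x * y ≈ y * x
*-comm-≈ x y = pointwise λ n → ℚ.*-comm (seq x n) (seq y n)

*-monoʳ-≤ : ∀ z x y → 0ℝ ≤ z → x ≤ y → x * z ≤ y * z
*-monoʳ-≤ z x y 0≤z x≤y = ≤-trans (≈⇒≤ (*-comm-≈ x z))
  (≤-trans (*-monoˡ-≤ z x y 0≤z x≤y) (≈⇒≤ (*-comm-≈ z y)))

≤-limit : ∀ x y z → (∀ q → 0ℚ ℚ.< q → x ≤ y + fromℚ q * z) → x ≤ y
≤-limit x y z h = mk≤ λ ε 0<ε →
  let η , 0<η , η+η≡ε = halve ε 0<ε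
      B , 0≤B , M , bound = eventually-bounded {seq z} (cauchy z)
      q , 0<q , Kq≡η = split (1ℚ ℚ.+ B) (RationalAnalysis.1+-pos 0≤B) η 0<η
      mk≤ f = h q 0<q
      N , hN = f η 0<η
  in M ℕ.⊔ N , λ n le →
  let z≤1+B = ℚ.≤-trans (p≤∣p∣ (seq z n)) (ℚ.≤-trans (bound n (ℕ.m⊔n≤o⇒m≤o M N le))
                (ℚ.≤-trans (p≤p+q B (ℚ.nonNegative⁻¹ 1ℚ)) (ℚ.≤-reflexive (ℚ.+-comm B 1ℚ))))
      open ℚ.≤-Reasoning
  in begin
    seq x n
      ≤⟨ hN n (ℕ.m⊔n≤o⇒n≤o M N le) ⟩
    seq y n ℚ.+ q ℚ.* seq z n ℚ.+ η
      ≤⟨ ℚ.+-monoˡ-≤ η (ℚ.+-monoʳ-≤ (seq y n) (*-monoˡ q (ℚ.<⇒≤ 0<q) z≤1+B)) ⟩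
    seq y n ℚ.+ q ℚ.* (1ℚ ℚ.+ B) ℚ.+ η
      ≡⟨ cong (λ e → seq y n ℚ.+ e ℚ.+ η) (≡.trans (ℚ.*-comm q (1ℚ ℚ.+ B)) Kq≡η) ⟩
    seq y n ℚ.+ η ℚ.+ η
      ≡⟨ ≡.trans (ℚ.+-assoc (seq y n) η η) (cong (λ e → seq y n ℚ.+ e) η+η≡ε) ⟩
    seq y n ℚ.+ ε ∎

≤-limit₁ : ∀ x y → (∀ q → 0ℚ ℚ.< q → x ≤ y + fromℚ q) → x ≤ y
≤-limit₁ x y h = ≤-limit x y 1ℝ λ q 0<q → ≤-trans (h q 0<q)
  (≈⇒≤ (pointwise λ n → cong (λ e → seq y n ℚ.+ e) (≡.sym (ℚ.*-identityʳ q))))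

fromℚ-pos : ∀ q → 0ℚ ℚ.< q → 0ℝ < fromℚ q
fromℚ-pos q 0<q = mk< q 0<q 0 λ _ _ → ℚ.≤-reflexive (ℚ.+-identityˡ q)

fromℚ-nonNeg : ∀ q → 0ℚ ℚ.< q → 0ℝ ≤ fromℚ q
fromℚ-nonNeg q 0<q = fromℚ-mono (ℚ.<⇒≤ 0<q)

<⇒≤ : ∀ x y → x < y → x ≤ y
<⇒≤ x y (mk< g 0<g N h) = eventually⇒≤ N λ n le → ℚ.≤-trans (p≤p+q (seq x n) (ℚ.<⇒≤ 0<g)) (h n le)

≤-<-trans : ∀ x y z → x ≤ y → y < z → x < z
≤-<-trans x y z (mk≤ f) (mk< g 0<g N h) =
  let η , 0<η , η+η≡g = halve g 0<g
      M , hM = f η 0<η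
  in mk< η 0<η (M ℕ.⊔ N) λ n le → let open ℚ.≤-Reasoning in begin
    seq x n ℚ.+ η           ≤⟨ ℚ.+-monoˡ-≤ η (hM n (ℕ.m⊔n≤o⇒m≤o M N le)) ⟩
    seq y n ℚ.+ η ℚ.+ η     ≡⟨ ≡.trans (ℚ.+-assoc (seq y n) η η) (cong (λ e → seq y n ℚ.+ e) η+η≡g) ⟩
    seq y n ℚ.+ g           ≤⟨ h n (ℕ.m⊔n≤o⇒n≤o M N le) ⟩
    seq z n                 ∎

pos⇒fromℚ≤ : ∀ {ε} → 0ℝ < ε → ∃ λ q → 0ℚ ℚ.< q × fromℚ q ≤ ε
pos⇒fromℚ≤ {ε} (mk< g 0<g N h) = g , 0<g , eventually⇒≤ N λ n le →
  ℚ.≤-trans (ℚ.≤-reflexive (≡.sym (ℚ.+-identityˡ g))) (h n le)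

eventually⇒≈ : ∀ {x y} N → (∀ n → N ℕ.≤ n → seq x n ≡ seq y n) → x ≈ y
eventually⇒≈ N h = mk≈ (eventually⇒≤ N λ n le → ℚ.≤-reflexive (h n le))
                       (eventually⇒≤ N λ n le → ℚ.≤-reflexive (≡.sym (h n le)))

-- `inverse` takes the reciprocal of the truncation at δ, and the positivity witness says that the
-- truncation changes nothing from index N on.
*-inverseʳ : ∀ x (0<x : 0ℝ < x) → x * inverse x 0<x ≈ 1ℝ
*-inverseʳ x (mk< δ 0<δ N h) = eventually⇒≈ N λ n le → eq n
    (ℚ.p≥q⇒p⊔q≡p (ℚ.≤-trans (ℚ.≤-reflexive (≡.sym (ℚ.+-identityˡ δ))) (h n le)))
  where
  eq : ∀ n → seq x n ℚ.⊔ δ ≡ seq x n → seq x n ℚ.* RationalAnalysis.recip δ 0<δ (seq x n) ≡ 1ℚ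
  eq n x⊔δ≡x = ≡.trans (cong (λ p → p ℚ.* RationalAnalysis.recip δ 0<δ (seq x n)) (≡.sym x⊔δ≡x))
    (ℚ.*-inverseʳ (seq x n ℚ.⊔ δ)
      {{ℚ.pos⇒nonZero (seq x n ℚ.⊔ δ) {{ℚ.positive (ℚ.<-≤-trans 0<δ (ℚ.p≤q⊔p (seq x n) δ))}}}})

inverse-nonNegative : ∀ x (0<x : 0ℝ < x) → 0ℝ ≤ inverse x 0<x
inverse-nonNegative x (mk< δ 0<δ N h) = eventually⇒≤ 0 λ n _ → ℚ.<⇒≤ (ℚ.positive⁻¹ _
  {{ℚ.1/pos⇒pos (seq x n ℚ.⊔ δ) {{ℚ.positive (ℚ.<-≤-trans 0<δ (ℚ.p≤q⊔p (seq x n) δ))}}}})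

-- The sign of w is undecidable, but w = (∣ w ∣ + w) - ∣ w ∣.
*-congˡ : ∀ w u v → u ≈ v → w * u ≈ w * v
*-congˡ w u v (mk≈ u≤v v≤u) = mk≈ (half u v u≤v v≤u) (half v u v≤u u≤v)
  where
  w⁺ = ∣ w ∣ + w
  half : ∀ u v → u ≤ v → v ≤ u → w * u ≤ w * v
  half u v u≤v v≤u = ≤-rearrange
      (w⁺ * u + ∣ w ∣ * v) (w⁺ * v + ∣ w ∣ * u) (w * u) (w * v)
      (+-mono (w⁺ * u) (w⁺ * v) (∣ w ∣ * v) (∣ w ∣ * u)
        (*-monoˡ-≤ w⁺ u v 0≤w⁺ u≤v) (*-monoˡ-≤ ∣ w ∣ v u (eventually⇒≤ 0 λ n _ → ℚ.0≤∣p∣ (seq w n)) v≤u))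
      λ n → solve 4 (λ a w u v → (a :+ w) :* v :+ a :* u :- ((a :+ w) :* u :+ a :* v) := w :* v :- w :* u)
              ≡.refl ℚ.∣ seq w n ∣ (seq w n) (seq u n) (seq v n)
    where
    0≤w⁺ : 0ℝ ≤ w⁺
    0≤w⁺ = eventually⇒≤ 0 λ n _ → ℚ.≤-trans (∣p∣≤q⇒-q≤p (seq w n) ℚ.∣ seq w n ∣ ℚ.≤-refl)
      (ℚ.≤-reflexive (ℚ.+-comm (seq w n) ℚ.∣ seq w n ∣))

*-cancelˡ-≤ : ∀ z z⁻¹ x y → 0ℝ ≤ z⁻¹ → z * z⁻¹ ≈ 1ℝ → z * x ≤ z * y → x ≤ y
*-cancelˡ-≤ z z⁻¹ x y 0≤z⁻¹ zz⁻¹≈1 zx≤zy = begin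
    x              ≈⟨ unfold x ⟩
    z⁻¹ * (z * x)  ≲⟨ *-monoˡ-≤ z⁻¹ (z * x) (z * y) 0≤z⁻¹ zx≤zy ⟩
    z⁻¹ * (z * y)  ≈⟨ unfold y ⟨
    y              ∎
  where
  open ≤-Reasoning
  unfold : ∀ w → w ≈ z⁻¹ * (z * w)
  unfold w = begin-equality
    w               ≈⟨ pointwise (λ n → ℚ.*-identityʳ (seq w n)) ⟨
    w * 1ℝ          ≈⟨ *-congˡ w (z * z⁻¹) 1ℝ zz⁻¹≈1 ⟨
    w * (z * z⁻¹)   ≈⟨ pointwise (λ n → solve 3 (λ w z i → w :* (z :* i) := i :* (z :* w)) ≡.refl (seq w n) (seq z n) (seq z⁻¹ n)) ⟩
    z⁻¹ * (z * w)   ∎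

+-assoc-≈ : ∀ x y z → x + y + z ≈ x + (y + z)
+-assoc-≈ x y z = pointwise λ n → ℚ.+-assoc (seq x n) (seq y n) (seq z n)

+-comm-≈ : ∀ x y → x + y ≈ y + x
+-comm-≈ x y = pointwise λ n → ℚ.+-comm (seq x n) (seq y n)

+-identityˡ-≈ : ∀ x → 0ℝ + x ≈ x
+-identityˡ-≈ x = pointwise λ n → ℚ.+-identityˡ (seq x n)

+-identityʳ-≈ : ∀ x → x + 0ℝ ≈ x
+-identityʳ-≈ x = pointwise λ n → ℚ.+-identityʳ (seq x n)

+-0-isMagma : IsMagma _≈_ _+_
+-0-isMagma = record
  { isEquivalence = IsPreorder.isEquivalence ≤-isPreorder
  ; ∙-cong        = λ {x} {y} {u} {v} → +-cong x y u v
  }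

+-0-isSemigroup : IsSemigroup _≈_ _+_
+-0-isSemigroup = record { isMagma = +-0-isMagma ; assoc = +-assoc-≈ }

+-0-isMonoid : IsMonoid _≈_ _+_ 0ℝ
+-0-isMonoid = record { isSemigroup = +-0-isSemigroup ; identity = +-identityˡ-≈ , +-identityʳ-≈ }

+-0-isCommutativeMonoid : IsCommutativeMonoid _≈_ _+_ 0ℝ
+-0-isCommutativeMonoid = record { isMonoid = +-0-isMonoid ; comm = +-comm-≈ }

-- Comparing the two sequences at one late index decides the alternative.
≤-cototal : ∀ x y q → 0ℚ ℚ.< q → x ≤ y + fromℚ q ⊎ y ≤ x + fromℚ q
≤-cototal x y q 0<q = decide (ℚ.≤-total (seq x N) (seq y N))
  where
  halves = halve q 0<q
  η = proj₁ halves
  0<η = proj₁ (proj₂ halves)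
  η+η≡q = proj₂ (proj₂ halves)
  N₁ = proj₁ (cauchy x η 0<η)
  N₂ = proj₁ (cauchy y η 0<η)
  N = N₁ ℕ.⊔ N₂
  below : ∀ p r → ℚ.∣ p ℚ.- r ∣ ℚ.≤ η → p ℚ.≤ r ℚ.+ η
  below p r d = ℚ.≤-trans (ℚ.≤-reflexive (solve 2 (λ p r → p := r :+ (p :- r)) ≡.refl p r))
    (ℚ.+-monoʳ-≤ r (ℚ.≤-trans (p≤∣p∣ (p ℚ.- r)) d))
  late : ∀ u v → (∀ m n → N ℕ.≤ m → N ℕ.≤ n → ℚ.∣ seq u m ℚ.- seq u n ∣ ℚ.≤ η) →
    (∀ m n → N ℕ.≤ m → N ℕ.≤ n → ℚ.∣ seq v m ℚ.- seq v n ∣ ℚ.≤ η) →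
    seq u N ℚ.≤ seq v N → u ≤ v + fromℚ q
  late u v cu cv u≤v = eventually⇒≤ N λ n le → let open ℚ.≤-Reasoning in begin
    seq u n                  ≤⟨ below (seq u n) (seq u N) (cu n N le ℕ.≤-refl) ⟩
    seq u N ℚ.+ η            ≤⟨ ℚ.+-monoˡ-≤ η u≤v ⟩
    seq v N ℚ.+ η            ≤⟨ ℚ.+-monoˡ-≤ η (below (seq v N) (seq v n) (cv N n ℕ.≤-refl le)) ⟩
    seq v n ℚ.+ η ℚ.+ η      ≡⟨ ≡.trans (ℚ.+-assoc (seq v n) η η) (cong (λ e → seq v n ℚ.+ e) η+η≡q) ⟩
    seq v n ℚ.+ q            ∎
  cx : ∀ m n → N ℕ.≤ m → N ℕ.≤ n → ℚ.∣ seq x m ℚ.- seq x n ∣ ℚ.≤ η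
  cx m n N≤m N≤n = proj₂ (cauchy x η 0<η) m n (ℕ.m⊔n≤o⇒m≤o N₁ N₂ N≤m) (ℕ.m⊔n≤o⇒m≤o N₁ N₂ N≤n)
  cy : ∀ m n → N ℕ.≤ m → N ℕ.≤ n → ℚ.∣ seq y m ℚ.- seq y n ∣ ℚ.≤ η
  cy m n N≤m N≤n = proj₂ (cauchy y η 0<η) m n (ℕ.m⊔n≤o⇒n≤o N₁ N₂ N≤m) (ℕ.m⊔n≤o⇒n≤o N₁ N₂ N≤n)
  decide : seq x N ℚ.≤ seq y N ⊎ seq y N ℚ.≤ seq x N → x ≤ y + fromℚ q ⊎ y ≤ x + fromℚ q
  decide (inj₁ x≤y) = inj₁ (late x y cx cy x≤y)
  decide (inj₂ y≤x) = inj₂ (late y x cy cx y≤x)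

infixl 6 _⊔_

_⊔_ : ℝ → ℝ → ℝ
x ⊔ y = (x + y + ∣ x - y ∣) * fromℚ ℚ.½

⊔-terms : ∀ p q → let m = (p ℚ.+ q ℚ.+ ℚ.∣ p ℚ.- q ∣) ℚ.* ℚ.½ in m ≡ p ⊎ m ≡ q
⊔-terms p q with ℚ.∣p∣≡p∨∣p∣≡-p (p ℚ.- q)
... | inj₁ eq = inj₁ (≡.trans (cong (λ d → (p ℚ.+ q ℚ.+ d) ℚ.* ℚ.½) eq)
  (solve 2 (λ p q → (p :+ q :+ (p :- q)) :* con ℚ.½ := p) ≡.refl p q))
... | inj₂ eq = inj₂ (≡.trans (cong (λ d → (p ℚ.+ q ℚ.+ d) ℚ.* ℚ.½) eq)
  (solve 2 (λ p q → (p :+ q :+ :- (p :- q)) :* con ℚ.½ := q) ≡.refl p q))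

x≤x⊔y : ∀ x y → x ≤ x ⊔ y
x≤x⊔y x y = eventually⇒≤ 0 λ n _ → let open ℚ.≤-Reasoning ; p = seq x n ; q = seq y n in begin
  p                                         ≡⟨ solve 2 (λ p q → (p :+ q :+ (p :- q)) :* con ℚ.½ := p) ≡.refl p q ⟨
  (p ℚ.+ q ℚ.+ (p ℚ.- q)) ℚ.* ℚ.½           ≤⟨ *-monoʳ ℚ.½ (ℚ.nonNegative⁻¹ ℚ.½) (ℚ.+-monoʳ-≤ (p ℚ.+ q) (p≤∣p∣ (p ℚ.- q))) ⟩
  (p ℚ.+ q ℚ.+ ℚ.∣ p ℚ.- q ∣) ℚ.* ℚ.½       ∎

y≤x⊔y : ∀ x y → y ≤ x ⊔ y
y≤x⊔y x y = ≤-trans (x≤x⊔y y x) (≈⇒≤ (pointwise λ n →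
  cong (ℚ._* ℚ.½) (cong₂ ℚ._+_ (ℚ.+-comm (seq y n) (seq x n)) (RationalAnalysis.∣∣-sym (seq y n) (seq x n)))))

⊔-lub : ∀ x y z → x ≤ z → y ≤ z → x ⊔ y ≤ z
⊔-lub x y z (mk≤ f) (mk≤ g) = mk≤ λ ε 0<ε →
  let M , hM = f ε 0<ε
      N , hN = g ε 0<ε
  in M ℕ.⊔ N , λ n le → pick n (hM n (ℕ.m⊔n≤o⇒m≤o M N le)) (hN n (ℕ.m⊔n≤o⇒n≤o M N le))
  where
  pick : ∀ n {r} → seq x n ℚ.≤ r → seq y n ℚ.≤ r → seq (x ⊔ y) n ℚ.≤ r
  pick n x≤r y≤r with ⊔-terms (seq x n) (seq y n)
  ... | inj₁ eq = ℚ.≤-trans (ℚ.≤-reflexive eq) x≤r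
  ... | inj₂ eq = ℚ.≤-trans (ℚ.≤-reflexive eq) y≤r

-- Suprema of finite families

-- Attainment is required only up to each q: an exact maximiser of real values cannot be selected
-- when the order is undecidable.
Sup : {A : Set} → (A → ℝ) → ℝ → Set
Sup {A} F m = (∀ a → F a ≤ m) × (∀ q → 0ℚ ℚ.< q → ∃ λ a → m ≤ F a + fromℚ q)

Inf : {A : Set} → (A → ℝ) → ℝ → Set
Inf {A} F m = (∀ a → m ≤ F a) × (∀ q → 0ℚ ℚ.< q → ∃ λ a → F a ≤ m + fromℚ q)

HasSuprema : Set → Set
HasSuprema A = ∀ (F : A → ℝ) → ∃ (Sup F)

x≤x+q : ∀ x q → 0ℚ ℚ.< q → x ≤ x + fromℚ q
x≤x+q x q 0<q = eventually⇒≤ 0 λ n _ → p≤p+q (seq x n) (ℚ.<⇒≤ 0<q)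

+-monoˡ-≤ : ∀ z x y → x ≤ y → x + z ≤ y + z
+-monoˡ-≤ z x y x≤y = +-mono x y z z x≤y ≤-refl

merge-halves : ∀ x η q → η ℚ.+ η ≡ q → x + fromℚ η + fromℚ η ≈ x + fromℚ q
merge-halves x η q η+η≡q = pointwise λ n →
  ≡.trans (ℚ.+-assoc (seq x n) η η) (cong (λ e → seq x n ℚ.+ e) η+η≡q)

Fin-suprema : ∀ n → HasSuprema (Fin (suc n))
Fin-suprema zero F = F Fin.zero ,
  (λ { Fin.zero → ≤-refl }) , λ q 0<q → Fin.zero , x≤x+q (F Fin.zero) q 0<q
Fin-suprema (suc n) F = extend (Fin-suprema n (λ a → F (Fin.suc a)))
  where
  extend : ∃ (Sup (λ a → F (Fin.suc a))) → ∃ (Sup F)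
  extend (m , upper , attained) = F Fin.zero ⊔ m , upper′ , attained′
    where
    upper′ : ∀ a → F a ≤ F Fin.zero ⊔ m
    upper′ Fin.zero    = x≤x⊔y (F Fin.zero) m
    upper′ (Fin.suc a) = ≤-trans (upper a) (y≤x⊔y (F Fin.zero) m)
    attained′ : ∀ q → 0ℚ ℚ.< q → ∃ λ a → F Fin.zero ⊔ m ≤ F a + fromℚ q
    attained′ q 0<q = choose (≤-cototal (F Fin.zero) m η 0<η) (attained η 0<η)
      where
      η = proj₁ (halve q 0<q)
      0<η = proj₁ (proj₂ (halve q 0<q))
      η+η≡q = proj₂ (proj₂ (halve q 0<q))
      -- One η pays for the undecided comparison of `F Fin.zero` with m, the other for the
      -- approximate attainment of m by the remaining values.
      choose : F Fin.zero ≤ m + fromℚ η ⊎ m ≤ F Fin.zero + fromℚ η →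
        (∃ λ a → m ≤ F (Fin.suc a) + fromℚ η) → ∃ λ a → F Fin.zero ⊔ m ≤ F a + fromℚ q
      choose (inj₁ F₀≤m) (a , m≤Fa) = Fin.suc a ,
        ≤-trans (⊔-lub (F Fin.zero) m (m + fromℚ η) F₀≤m (x≤x+q m η 0<η))
          (≤-trans (+-monoˡ-≤ (fromℚ η) m (F (Fin.suc a) + fromℚ η) m≤Fa)
                   (≈⇒≤ (merge-halves (F (Fin.suc a)) η q η+η≡q)))
      choose (inj₂ m≤F₀) _ = Fin.zero ,
        ≤-trans (⊔-lub (F Fin.zero) m (F Fin.zero + fromℚ η) (x≤x+q (F Fin.zero) η 0<η) m≤F₀)
          (≤-trans (x≤x+q (F Fin.zero + fromℚ η) η 0<η) (≈⇒≤ (merge-halves (F Fin.zero) η q η+η≡q)))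

-- The supremum is iterated, over the tails for each head and then over the heads, so the
-- exponentially many tables need not be listed.
Vec-suprema : ∀ {A} → HasSuprema A → ∀ k → HasSuprema (Vec A k)
Vec-suprema sup zero F = F Vec.[] ,
  (λ { Vec.[] → ≤-refl }) , λ q 0<q → Vec.[] , x≤x+q (F Vec.[]) q 0<q
Vec-suprema {A} sup (suc k) F = combine (λ a → Vec-suprema sup k (λ as → F (a Vec.∷ as)))
  where
  combine : (∀ a → ∃ (Sup (λ as → F (a Vec.∷ as)))) → ∃ (Sup F)
  combine inner = collect (sup (λ a → proj₁ (inner a)))
    where
    collect : ∃ (Sup (λ a → proj₁ (inner a))) → ∃ (Sup F)
    collect (m , upper , attained) = m ,
        (λ { (a Vec.∷ as) → ≤-trans (proj₁ (proj₂ (inner a)) as) (upper a) }) , attained′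
      where
      attained′ : ∀ q → 0ℚ ℚ.< q → ∃ λ as → m ≤ F as + fromℚ q
      attained′ q 0<q =
        let η , 0<η , η+η≡q = halve q 0<q
            a , m≤Ma = attained η 0<η
            as , Ma≤F = proj₂ (proj₂ (inner a)) η 0<η
        in a Vec.∷ as ,
           ≤-trans m≤Ma (≤-trans (+-monoˡ-≤ (fromℚ η) (proj₁ (inner a)) (F (a Vec.∷ as) + fromℚ η) Ma≤F)
                                 (≈⇒≤ (merge-halves (F (a Vec.∷ as)) η q η+η≡q)))

suprema⇒infima : ∀ {A} → HasSuprema A → (F : A → ℝ) → ∃ (Inf F)
suprema⇒infima sup F = negate (sup (λ a → - F a))
  where
  negate : ∃ (Sup (λ a → - F a)) → ∃ (Inf F)
  negate (m , upper , attained) = - m ,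
    (λ a → ≤-rearrange (- F a) m (- m) (F a) (upper a)
      λ n → solve 2 (λ f m → m :- :- f := f :- :- m) ≡.refl (seq (F a) n) (seq m n)) ,
    λ q 0<q → let a , m≤ = attained q 0<q in a ,
      ≤-rearrange m (- F a + fromℚ q) (F a) (- m + fromℚ q) m≤
        λ n → solve 3 (λ f m q → (:- f :+ q) :- m := (:- m :+ q) :- f) ≡.refl (seq (F a) n) (seq m n) q

-- Exponentials and powers

eventually-≤ι : ∀ x → ∃ λ K → ∃ λ N → ∀ n → N ℕ.≤ n → ℚ.∣ seq x n ∣ ℚ.≤ ι K
eventually-≤ι x =
  let A , _ , N , bound = eventually-bounded {seq x} (cauchy x)
      K , A≤K = archimedean A
  in K , N , λ n N≤n → ℚ.≤-trans (bound n N≤n) A≤K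

∣p-r∣≤ε⇒p≤r+ε : ∀ p r {ε} → ℚ.∣ p ℚ.- r ∣ ℚ.≤ ε → p ℚ.≤ r ℚ.+ ε
∣p-r∣≤ε⇒p≤r+ε p r d = ℚ.≤-trans (ℚ.≤-reflexive (solve 2 (λ p r → p := r :+ (p :- r)) ≡.refl p r))
  (ℚ.+-monoʳ-≤ r (ℚ.≤-trans (p≤∣p∣ (p ℚ.- r)) d))

exp-+ : ∀ x y → exp x * exp y ≈ exp (x + y)
exp-+ x y = mk≈
    (mk≤ λ ε 0<ε → proj₁ (close ε 0<ε) , λ n le →
      ∣p-r∣≤ε⇒p≤r+ε (E (seq x n) n ℚ.* E (seq y n) n) (E (seq x n ℚ.+ seq y n) n) (proj₂ (close ε 0<ε) n le))
    (mk≤ λ ε 0<ε → proj₁ (close ε 0<ε) , λ n le →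
      ∣p-r∣≤ε⇒p≤r+ε (E (seq x n ℚ.+ seq y n) n) (E (seq x n) n ℚ.* E (seq y n) n)
        (ℚ.≤-trans (ℚ.≤-reflexive (RationalAnalysis.∣∣-sym (E (seq x n ℚ.+ seq y n) n) (E (seq x n) n ℚ.* E (seq y n) n)))
                   (proj₂ (close ε 0<ε) n le)))
  where
  close : ∀ ε → 0ℚ ℚ.< ε → ∃ λ N → ∀ n → N ℕ.≤ n →
    ℚ.∣ E (seq x n) n ℚ.* E (seq y n) n ℚ.- E (seq x n ℚ.+ seq y n) n ∣ ℚ.≤ ε
  close ε 0<ε =
    let K₁ , N₁ , bound₁ = eventually-≤ι x
        K₂ , N₂ , bound₂ = eventually-≤ι y
        K = K₁ ℕ.⊔ K₂
        N₃ , uniform = E-+-uniform K ε 0<ε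
    in (N₁ ℕ.⊔ N₂) ℕ.⊔ N₃ , λ n le →
       let le₁₂ = ℕ.m⊔n≤o⇒m≤o (N₁ ℕ.⊔ N₂) N₃ le in
       uniform n (ℕ.m⊔n≤o⇒n≤o (N₁ ℕ.⊔ N₂) N₃ le)
         (ℚ.≤-trans (bound₁ n (ℕ.m⊔n≤o⇒m≤o N₁ N₂ le₁₂)) (ι-mono (ℕ.m≤m⊔n K₁ K₂)))
         (ℚ.≤-trans (bound₂ n (ℕ.m⊔n≤o⇒n≤o N₁ N₂ le₁₂)) (ι-mono (ℕ.m≤n⊔m K₁ K₂)))

1+x≤exp : ∀ x → 1ℝ + x ≤ exp x
1+x≤exp x = mk≤ λ ε 0<ε →
  let K , N₁ , bound = eventually-≤ι x
      N₂ , uniform = E-+-uniform K ε 0<ε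
  in (N₁ ℕ.⊔ N₂) ℕ.⊔ 1 , λ n le →
     let le₁₂ = ℕ.m⊔n≤o⇒m≤o (N₁ ℕ.⊔ N₂) 1 le
         b = bound n (ℕ.m⊔n≤o⇒m≤o N₁ N₂ le₁₂)
     in 1+x≤E+ε (seq x n) n ε (ℕ.m⊔n≤o⇒n≤o (N₁ ℕ.⊔ N₂) 1 le) (ℚ.<⇒≤ 0<ε)
          (uniform n (ℕ.m⊔n≤o⇒n≤o N₁ N₂ le₁₂) b
            (ℚ.≤-trans (ℚ.≤-reflexive (ℚ.∣-p∣≡∣p∣ (seq x n))) b))

exp-pointwise : ∀ x y → (∀ n → seq x n ≡ seq y n) → exp x ≈ exp y
exp-pointwise x y eq = pointwise λ n → cong (λ p → E p n) (eq n)

0≤p² : ∀ p → 0ℚ ℚ.≤ p ℚ.* p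
0≤p² p = ℚ.≤-trans (*-nonNeg (ℚ.0≤∣p∣ p) (ℚ.0≤∣p∣ p))
  (ℚ.≤-reflexive (≡.trans (≡.sym (ℚ.∣p*q∣≡∣p∣*∣q∣ p p)) (∣p²∣≡p² (ℚ.∣p∣≡p∨∣p∣≡-p p))))
  where
  ∣p²∣≡p² : ℚ.∣ p ∣ ≡ p ⊎ ℚ.∣ p ∣ ≡ ℚ.- p → ℚ.∣ p ℚ.* p ∣ ≡ p ℚ.* p
  ∣p²∣≡p² (inj₁ eq) = ≡.trans (ℚ.∣p*q∣≡∣p∣*∣q∣ p p) (cong₂ ℚ._*_ eq eq)
  ∣p²∣≡p² (inj₂ eq) = ≡.trans (ℚ.∣p*q∣≡∣p∣*∣q∣ p p) (≡.trans (cong₂ ℚ._*_ eq eq)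
    (solve 1 (λ p → (:- p) :* (:- p) := p :* p) ≡.refl p))

-- The partial sums can be negative for negative x, so the sign comes from e ^ x = (e ^ (x / 2)) ^
-- 2.
exp-nonNegative : ∀ x → 0ℝ ≤ exp x
exp-nonNegative x = begin
    0ℝ                                      ≲⟨ eventually⇒≤ 0 (λ n _ → 0≤p² (E (seq x n ℚ.* ℚ.½) n)) ⟩
    exp (x * fromℚ ℚ.½) * exp (x * fromℚ ℚ.½)  ≈⟨ exp-+ (x * fromℚ ℚ.½) (x * fromℚ ℚ.½) ⟩
    exp (x * fromℚ ℚ.½ + x * fromℚ ℚ.½)     ≈⟨ exp-pointwise (x * fromℚ ℚ.½ + x * fromℚ ℚ.½) x (λ n → solve 1 (λ x → x :* con ℚ.½ :+ x :* con ℚ.½ := x) ≡.refl (seq x n)) ⟩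
    exp x                                   ∎
  where open ≤-Reasoning

exp-mono : ∀ x y → x ≤ y → exp x ≤ exp y
exp-mono x y x≤y = begin
    exp x                        ≈⟨ pointwise (λ n → ℚ.*-identityʳ (E (seq x n) n)) ⟨
    exp x * 1ℝ                   ≲⟨ *-monoˡ-≤ (exp x) 1ℝ (1ℝ + (y - x)) (exp-nonNegative x)
                                      (≤-rearrange x y 1ℝ (1ℝ + (y - x)) x≤y
                                        λ n → solve 2 (λ x y → y :- x := con 1ℚ :+ (y :- x) :- con 1ℚ) ≡.refl (seq x n) (seq y n)) ⟩
    exp x * (1ℝ + (y - x))       ≲⟨ *-monoˡ-≤ (exp x) (1ℝ + (y - x)) (exp (y - x)) (exp-nonNegative x) (1+x≤exp (y - x)) ⟩
    exp x * exp (y - x)          ≈⟨ exp-+ x (y - x) ⟩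
    exp (x + (y - x))            ≈⟨ exp-pointwise (x + (y - x)) y (λ n → solve 2 (λ x y → x :+ (y :- x) := y) ≡.refl (seq x n) (seq y n)) ⟩
    exp y                        ∎
  where open ≤-Reasoning

exp-neg≤1 : ∀ x → 0ℝ ≤ x → exp (- x) ≤ 1ℝ
exp-neg≤1 x 0≤x = begin
    exp (- x)    ≲⟨ exp-mono (- x) 0ℝ (≤-rearrange 0ℝ x (- x) 0ℝ 0≤x
                      λ n → solve 1 (λ x → x :- con 0ℚ := con 0ℚ :- :- x) ≡.refl (seq x n)) ⟩
    exp 0ℝ       ≈⟨ pointwise E-zero ⟩
    1ℝ           ∎
  where open ≤-Reasoning

-- The tangent of e ^ (- t) at t = c lies below the curve, e ^ (- c) (1 + (c - b)) ≤ e ^ (- b), and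
-- c ≥ 0 makes its slope at most 1 in absolute value. This turns errors of the rate α / n into
-- errors of the limiting probability.
exp-neg-lipschitz : ∀ b c q → 0ℝ ≤ c → 0ℝ ≤ q → b ≤ c + q → exp (- c) ≤ exp (- b) + q
exp-neg-lipschitz b c q 0≤c 0≤q b≤c+q = begin
    exp (- c)
      ≈⟨ pointwise (λ n → ℚ.*-identityʳ (E (ℚ.- seq c n) n)) ⟨
    exp (- c) * 1ℝ
      ≲⟨ *-monoˡ-≤ (exp (- c)) 1ℝ (1ℝ + (c - b) + q) (exp-nonNegative (- c))
           (≤-rearrange b (c + q) 1ℝ (1ℝ + (c - b) + q) b≤c+q
             λ n → solve 3 (λ b c q → c :+ q :- b := con 1ℚ :+ (c :- b) :+ q :- con 1ℚ) ≡.refl (seq b n) (seq c n) (seq q n)) ⟩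
    exp (- c) * (1ℝ + (c - b) + q)
      ≈⟨ pointwise (λ n → ℚ.*-distribˡ-+ (E (ℚ.- seq c n) n) (1ℚ ℚ.+ (seq c n ℚ.- seq b n)) (seq q n)) ⟩
    exp (- c) * (1ℝ + (c - b)) + exp (- c) * q
      ≲⟨ +-mono (exp (- c) * (1ℝ + (c - b))) (exp (- c) * exp (c - b)) (exp (- c) * q) (1ℝ * q)
           (*-monoˡ-≤ (exp (- c)) (1ℝ + (c - b)) (exp (c - b)) (exp-nonNegative (- c)) (1+x≤exp (c - b)))
           (*-monoʳ-≤ q (exp (- c)) 1ℝ 0≤q (exp-neg≤1 c 0≤c)) ⟩
    exp (- c) * exp (c - b) + 1ℝ * q
      ≈⟨ +-cong (exp (- c) * exp (c - b)) (exp (- c + (c - b))) (1ℝ * q) q (exp-+ (- c) (c - b))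
           (pointwise λ n → ℚ.*-identityˡ (seq q n)) ⟩
    exp (- c + (c - b)) + q
      ≈⟨ +-cong (exp (- c + (c - b))) (exp (- b)) q q
           (exp-pointwise (- c + (c - b)) (- b) λ n → solve 2 (λ b c → :- c :+ (c :- b) := :- b) ≡.refl (seq b n) (seq c n))
           ≈-refl ⟩
    exp (- b) + q ∎
  where open ≤-Reasoning

-- The increment is a series of nonnegative terms whose first term is 1 / (j + 2).
ln-suc-lower : ∀ j → ln-suc j + fromℚ (unit (suc j)) ≤ ln-suc (suc j)
ln-suc-lower j = eventually⇒≤ 1 λ n 1≤n → ℚ.+-monoʳ-≤ (seq (ln-suc j) n) (ℚ.≤-trans
  (ℚ.≤-reflexive (solve 1 (λ q → q := con 0ℚ :+ con 1ℚ :* q :* con 1ℚ) ≡.refl (unit (suc j))))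
  (sum<-mono (lnTerm-nonNeg j) 1≤n))

-- With q = 1 / (j + 2) and r = 1 / (j + 1), geometric summation: r = q + q r.
ln-suc-upper : ∀ j → ln-suc (suc j) ≤ ln-suc j + fromℚ (unit j)
ln-suc-upper j = eventually⇒≤ 0 λ n _ → ℚ.+-monoʳ-≤ (seq (ln-suc j) n) (ℚ.≤-trans (p≤p+q (sum< (lnTerm j) n) (*-nonNeg (power-nonNeg (unit-nonNeg (suc j)) n) (unit-nonNeg j))) (go n))
  where
  open RationalAnalysis using (power; power-nonNeg)
  open ℚ.≤-Reasoning
  q = unit (suc j)
  r = unit j
  r≡q+qr : r ≡ q ℚ.+ q ℚ.* r
  r≡q+qr = begin-equality
    r                                ≡⟨ ℚ.*-identityˡ r ⟨
    1ℚ ℚ.* r                         ≡⟨ cong (ℚ._* r) (≡.trans (cong (q ℚ.*_) (≡.sym (ι-suc (suc j)))) (unit-inverse (suc j))) ⟨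
    q ℚ.* (ι (suc j) ℚ.+ 1ℚ) ℚ.* r   ≡⟨ solve 3 (λ q i r → q :* (i :+ con 1ℚ) :* r := q :* (r :* i) :+ q :* r) ≡.refl q (ι (suc j)) r ⟩
    q ℚ.* (r ℚ.* ι (suc j)) ℚ.+ q ℚ.* r  ≡⟨ cong (λ z → q ℚ.* z ℚ.+ q ℚ.* r) (unit-inverse j) ⟩
    q ℚ.* 1ℚ ℚ.+ q ℚ.* r             ≡⟨ cong (ℚ._+ q ℚ.* r) (ℚ.*-identityʳ q) ⟩
    q ℚ.+ q ℚ.* r                    ∎
  -- Since r = q / (1 - q), `power q n * r` is the tail of the geometric series from its n-th term
  -- on.
  go : ∀ n → sum< (lnTerm j) n ℚ.+ power q n ℚ.* r ℚ.≤ r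
  go zero    = ℚ.≤-reflexive (solve 1 (λ r → con 0ℚ :+ con 1ℚ :* r := r) ≡.refl r)
  go (suc n) = begin
    s ℚ.+ p ℚ.* q ℚ.* unit n ℚ.+ p ℚ.* q ℚ.* r
      ≤⟨ ℚ.+-monoˡ-≤ (p ℚ.* q ℚ.* r) (ℚ.+-monoʳ-≤ s
           (*-monoˡ (p ℚ.* q) (power-nonNeg (unit-nonNeg (suc j)) (suc n)) (unit≤1 n))) ⟩
    s ℚ.+ p ℚ.* q ℚ.* 1ℚ ℚ.+ p ℚ.* q ℚ.* r
      ≡⟨ solve 4 (λ s p q r → s :+ p :* q :* con 1ℚ :+ p :* q :* r := s :+ p :* (q :+ q :* r)) ≡.refl s p q r ⟩
    s ℚ.+ p ℚ.* (q ℚ.+ q ℚ.* r)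
      ≡⟨ cong (λ z → s ℚ.+ p ℚ.* z) r≡q+qr ⟨
    s ℚ.+ p ℚ.* r
      ≤⟨ go n ⟩
    r ∎
    where
    s = sum< (lnTerm j) n
    p = power q n

-- The powers appear as variables p and q because unfolding k ^ α under another
-- operation on ℝ makes Agda compare moduli of convergence.
exp-ratio-≤ : ∀ α u l L p q → p ≡ exp (α * l) → q ≡ exp (α * L) →
  0ℝ ≤ α → l + u ≤ L → p ≤ exp (- (α * u)) * q
exp-ratio-≤ α u l L _ _ ≡.refl ≡.refl 0≤α l+u≤L = begin
    exp (α * l)
      ≲⟨ exp-mono (α * l) (- (α * u) + α * L)
           (≤-rearrange (α * (l + u)) (α * L) (α * l) (- (α * u) + α * L) (*-monoˡ-≤ α (l + u) L 0≤α l+u≤L)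
             λ n → solve 4 (λ a u l L → a :* L :- a :* (l :+ u) := :- (a :* u) :+ a :* L :- a :* l) ≡.refl
                     (seq α n) (seq u n) (seq l n) (seq L n)) ⟩
    exp (- (α * u) + α * L)
      ≈⟨ exp-+ (- (α * u)) (α * L) ⟨
    exp (- (α * u)) * exp (α * L) ∎
  where open ≤-Reasoning

exp-ratio-≥ : ∀ α u l L p q → p ≡ exp (α * l) → q ≡ exp (α * L) →
  0ℝ ≤ α → L ≤ l + u → exp (- (α * u)) * q ≤ p
exp-ratio-≥ α u l L _ _ ≡.refl ≡.refl 0≤α L≤l+u = begin
    exp (- (α * u)) * exp (α * L)
      ≈⟨ exp-+ (- (α * u)) (α * L) ⟩
    exp (- (α * u) + α * L)
      ≲⟨ exp-mono (- (α * u) + α * L) (α * l)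
           (≤-rearrange (α * L) (α * (l + u)) (- (α * u) + α * L) (α * l) (*-monoˡ-≤ α L (l + u) 0≤α L≤l+u)
             λ n → solve 4 (λ a u l L → a :* (l :+ u) :- a :* L := a :* l :- (:- (a :* u) :+ a :* L)) ≡.refl
                     (seq α n) (seq u n) (seq l n) (seq L n)) ⟩
    exp (α * l) ∎
  where open ≤-Reasoning

module Powers (α : ℝ) (0≤α : 0ℝ ≤ α) where

  ^-nonNegative : ∀ k → 0ℝ ≤ k ^ α
  ^-nonNegative zero    = ≤-refl
  ^-nonNegative (suc j) = exp-nonNegative (α * ln-suc j)

  -- (k / (k + 1)) ^ α ≤ e ^ (- α / (k + 1))
  ^-ratio-≤ : ∀ k → k ^ α ≤ exp (- (α * fromℚ (unit k))) * suc k ^ α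
  ^-ratio-≤ zero    = *-nonNegative (exp (- (α * fromℚ (unit zero)))) (suc zero ^ α)
    (exp-nonNegative (- (α * fromℚ (unit zero)))) (^-nonNegative (suc zero))
  ^-ratio-≤ (suc j) = exp-ratio-≤ α (fromℚ (unit (suc j))) (ln-suc j) (ln-suc (suc j)) (suc j ^ α) (suc (suc j) ^ α) ≡.refl ≡.refl 0≤α (ln-suc-lower j)

  -- (k / (k + 1)) ^ α ≥ e ^ (- α / k)
  ^-ratio-≥ : ∀ j → exp (- (α * fromℚ (unit j))) * suc (suc j) ^ α ≤ suc j ^ α
  ^-ratio-≥ j = exp-ratio-≥ α (fromℚ (unit j)) (ln-suc j) (ln-suc (suc j)) (suc j ^ α) (suc (suc j) ^ α) ≡.refl ≡.refl 0≤α (ln-suc-upper j)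

  ^-mono-suc : ∀ k → k ^ α ≤ suc k ^ α
  ^-mono-suc k = begin
      k ^ α           ≲⟨ ^-ratio-≤ k ⟩
      exp (- (α * fromℚ (unit k))) * suc k ^ α
                      ≲⟨ *-monoʳ-≤ (suc k ^ α) (exp (- (α * fromℚ (unit k)))) 1ℝ (^-nonNegative (suc k))
                           (exp-neg≤1 (α * fromℚ (unit k))
                             (*-nonNegative α (fromℚ (unit k)) 0≤α (fromℚ-nonNeg (unit k) (RationalAnalysis.unit-pos k)))) ⟩
      1ℝ * suc k ^ α  ≈⟨ pointwise (λ n → ℚ.*-identityˡ (seq (suc k ^ α) n)) ⟩
      suc k ^ α       ∎
    where open ≤-Reasoning

-- Finite sums and increasing instances

does-true : {P : Set} (p? : Dec P) → does p? ≡ true → P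
does-true (yes p) _ = p

-- Stated for variable operations: unfolding _+_ on ℝ makes Agda compare moduli of
-- convergence, so the instances below must match syntactically.
foldr-suc : ∀ {A B : Set} {n} (_∙_ : A → B → B) ε (f : Fin (suc n) → A) →
  foldr _∙_ ε f ≡ (head f ∙ foldr _∙_ ε (tail f))
foldr-suc _∙_ ε f = ≡.refl

foldr-last : ∀ {A : Set} {_≈_ : A → A → Set} {_∙_ ε} → IsMonoid _≈_ _∙_ ε → ∀ {n} (f : Fin (suc n) → A) →
  foldr _∙_ ε f ≈ (foldr _∙_ ε (init f) ∙ last f)
foldr-last isMonoid = MonoidSum.sum-init-last (record { isMonoid = isMonoid })

foldr-swap : ∀ {A : Set} {_≈_ : A → A → Set} {_∙_ ε} → IsCommutativeMonoid _≈_ _∙_ ε →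
  ∀ {m n} (f : Fin m → Fin n → A) →
  foldr _∙_ ε (λ i → foldr _∙_ ε (f i)) ≈ foldr _∙_ ε (λ j → foldr _∙_ ε (λ i → f i j))
foldr-swap isCommutativeMonoid =
  CommutativeMonoidSum.∑-comm (record { isCommutativeMonoid = isCommutativeMonoid })

sum-mono : ∀ {n} (f g : Fin n → ℝ) → (∀ i → f i ≤ g i) → foldr _+_ 0ℝ f ≤ foldr _+_ 0ℝ g
sum-mono f g = Pointwise.foldr-cong {R = _≤_} {S = _≤_} (λ {w} {x} {y} {z} → +-mono w x y z) ≤-refl {xs = f} {ys = g}

*-sum-≤ : ∀ {n} a (f g : Fin n → ℝ) → (∀ i → a * f i ≤ g i) →
  a * foldr _+_ 0ℝ f ≤ foldr _+_ 0ℝ g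
*-sum-≤ a f g h = Pointwise.foldr-cong {R = λ u v → a * u ≤ v} {S = λ u v → a * u ≤ v} {f = _+_} {g = _+_}
    (λ {u} {u′} {v} {v′} → distrib u u′ v v′)
    {d = 0ℝ} {e = 0ℝ} (≈⇒≤ (pointwise λ n → ℚ.*-zeroʳ (seq a n))) {xs = f} {ys = g} h
  where
  distrib : ∀ u u′ v v′ → a * u ≤ u′ → a * v ≤ v′ → a * (u + v) ≤ u′ + v′
  distrib u u′ v v′ au≤u′ av≤v′ = ≤-trans
    (≈⇒≤ (pointwise λ n → ℚ.*-distribˡ-+ (seq a n) (seq u n) (seq v n)))
    (+-mono (a * u) u′ (a * v) v′ au≤u′ av≤v′)

sum-nonNegative : ∀ {n} (f : Fin n → ℝ) → (∀ i → 0ℝ ≤ f i) → 0ℝ ≤ foldr _+_ 0ℝ f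
sum-nonNegative {zero}  f f≥0 = ≤-refl
sum-nonNegative {suc _} f f≥0 = begin
    0ℝ                       ≈⟨ +-identityˡ-≈ 0ℝ ⟨
    0ℝ + 0ℝ                  ≲⟨ +-mono 0ℝ (head f) 0ℝ (foldr _+_ 0ℝ (tail f)) (f≥0 Fin.zero) (sum-nonNegative (tail f) (f≥0 ∘ Fin.suc)) ⟩
    head f + foldr _+_ 0ℝ (tail f)    ≡⟨ foldr-suc _+_ 0ℝ f ⟨
    foldr _+_ 0ℝ f    ∎
  where open ≤-Reasoning

term≤sum : ∀ {n} (f : Fin n → ℝ) → (∀ i → 0ℝ ≤ f i) → ∀ i → f i ≤ foldr _+_ 0ℝ f
term≤sum f f≥0 Fin.zero = begin
    head f                   ≈⟨ +-identityʳ-≈ (head f) ⟨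
    head f + 0ℝ              ≲⟨ +-mono (head f) (head f) 0ℝ (foldr _+_ 0ℝ (tail f)) ≤-refl (sum-nonNegative (tail f) (f≥0 ∘ Fin.suc)) ⟩
    head f + foldr _+_ 0ℝ (tail f)    ≡⟨ foldr-suc _+_ 0ℝ f ⟨
    foldr _+_ 0ℝ f           ∎
  where open ≤-Reasoning
term≤sum f f≥0 (Fin.suc i) = begin
    tail f i                 ≲⟨ term≤sum (tail f) (f≥0 ∘ Fin.suc) i ⟩
    foldr _+_ 0ℝ (tail f)             ≈⟨ +-identityˡ-≈ (foldr _+_ 0ℝ (tail f)) ⟨
    0ℝ + foldr _+_ 0ℝ (tail f)        ≲⟨ +-mono 0ℝ (head f) (foldr _+_ 0ℝ (tail f)) (foldr _+_ 0ℝ (tail f)) (f≥0 Fin.zero) ≤-refl ⟩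
    head f + foldr _+_ 0ℝ (tail f)    ≡⟨ foldr-suc _+_ 0ℝ f ⟨
    foldr _+_ 0ℝ f           ∎
  where open ≤-Reasoning

sum-inject≤ : ∀ {k n} (f : Fin k → ℝ) (g : Fin n → ℝ) .(k≤n : k ℕ.≤ n) →
  (∀ i → f i ≤ g (inject≤ i k≤n)) → (∀ i → 0ℝ ≤ g i) → foldr _+_ 0ℝ f ≤ foldr _+_ 0ℝ g
sum-inject≤ {zero}           f g k≤n f≤g g≥0 = sum-nonNegative g g≥0
sum-inject≤ {suc k} {suc n}  f g k≤n f≤g g≥0 = begin
    foldr _+_ 0ℝ f
      ≡⟨ foldr-suc _+_ 0ℝ f ⟩
    head f + foldr _+_ 0ℝ (tail f)
      ≲⟨ +-mono (head f) (head g) (foldr _+_ 0ℝ (tail f)) (foldr _+_ 0ℝ (tail g)) (f≤g Fin.zero)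
           (sum-inject≤ (tail f) (tail g) (ℕ.s≤s⁻¹ k≤n) (f≤g ∘ Fin.suc) (g≥0 ∘ Fin.suc)) ⟩
    head g + foldr _+_ 0ℝ (tail g)
      ≡⟨ foldr-suc _+_ 0ℝ g ⟨
    foldr _+_ 0ℝ g ∎
  where open ≤-Reasoning

sum-nonPositive : ∀ {n} (f : Fin n → ℝ) → (∀ i → f i ≤ 0ℝ) → foldr _+_ 0ℝ f ≤ 0ℝ
sum-nonPositive {zero}  f f≤0 = ≤-refl
sum-nonPositive {suc _} f f≤0 = begin
    foldr _+_ 0ℝ f           ≡⟨ foldr-suc _+_ 0ℝ f ⟩
    head f + foldr _+_ 0ℝ (tail f)    ≲⟨ +-mono (head f) 0ℝ (foldr _+_ 0ℝ (tail f)) 0ℝ (f≤0 Fin.zero) (sum-nonPositive (tail f) (f≤0 ∘ Fin.suc)) ⟩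
    0ℝ + 0ℝ                  ≈⟨ +-identityˡ-≈ 0ℝ ⟩
    0ℝ                       ∎
  where open ≤-Reasoning

sum-≤-single : ∀ {n} (f : Fin n → ℝ) t w → 0ℝ ≤ w → f t ≤ w → (∀ i → i ≢ t → f i ≤ 0ℝ) → foldr _+_ 0ℝ f ≤ w
sum-≤-single f Fin.zero w w≥0 ft≤w else≤0 = begin
    foldr _+_ 0ℝ f           ≡⟨ foldr-suc _+_ 0ℝ f ⟩
    head f + foldr _+_ 0ℝ (tail f)    ≲⟨ +-mono (head f) w (foldr _+_ 0ℝ (tail f)) 0ℝ ft≤w (sum-nonPositive (tail f) λ i → else≤0 (Fin.suc i) λ ()) ⟩
    w + 0ℝ                   ≈⟨ +-identityʳ-≈ w ⟩
    w                        ∎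
  where open ≤-Reasoning
sum-≤-single f (Fin.suc t) w w≥0 ft≤w else≤0 = begin
    foldr _+_ 0ℝ f           ≡⟨ foldr-suc _+_ 0ℝ f ⟩
    head f + foldr _+_ 0ℝ (tail f)    ≲⟨ +-mono (head f) 0ℝ (foldr _+_ 0ℝ (tail f)) w (else≤0 Fin.zero λ ())
                                  (sum-≤-single (tail f) t w w≥0 ft≤w λ i i≢t → else≤0 (Fin.suc i) (i≢t ∘ Fin.suc-injective)) ⟩
    0ℝ + w                   ≈⟨ +-identityˡ-≈ w ⟩
    w                        ∎
  where open ≤-Reasoning

sum-last : ∀ {n} (f : Fin (suc n) → ℝ) →
  foldr _+_ 0ℝ f ≈ foldr _+_ 0ℝ (init f) + last f
sum-last = foldr-last +-0-isMonoid

sum-swap : ∀ {m n} (f : Fin m → Fin n → ℝ) →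
  foldr _+_ 0ℝ (λ i → foldr _+_ 0ℝ (f i)) ≈ foldr _+_ 0ℝ (λ j → foldr _+_ 0ℝ (λ i → f i j))
sum-swap = foldr-swap +-0-isCommutativeMonoid

-- The index k with `toℕ i ≡ k` is separate because the induction splits off the last summand, and
-- `toℕ` of `inject₁ i` and of `fromℕ n` reduces only along a proved equation.
sum-telescope : ∀ n (a : ℕ → ℝ) (f : Fin n → ℝ) →
  (∀ i k → toℕ i ≡ k → f i ≤ a (suc k) - a k) → foldr _+_ 0ℝ f ≤ a n - a zero
sum-telescope zero    a f h = eventually⇒≤ 0 λ n _ → ℚ.≤-reflexive (≡.sym (ℚ.+-inverseʳ (seq (a zero) n)))
sum-telescope (suc n) a f h = begin
    foldr _+_ 0ℝ f
      ≈⟨ sum-last f ⟩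
    foldr _+_ 0ℝ (init f) + last f
      ≲⟨ +-mono (foldr _+_ 0ℝ (init f)) (a n - a zero) (last f) (a (suc n) - a n)
           (sum-telescope n a (init f) λ i k eq → h (Fin.inject₁ i) k (≡.trans (Fin.toℕ-inject₁ i) eq))
           (h (Fin.fromℕ n) n (Fin.toℕ-fromℕ n)) ⟩
    (a n - a zero) + (a (suc n) - a n)
      ≈⟨ pointwise (λ k → solve 3 (λ x y z → (y :- x) :+ (z :- y) := z :- x) ≡.refl (seq (a zero) k) (seq (a n) k) (seq (a (suc n)) k)) ⟩
    a (suc n) - a zero ∎
  where open ≤-Reasoning

module TailSum (a : ℕ → ℝ) (d : ℝ) (m : ℕ) (a≥0 : ∀ k → 0ℝ ≤ a k) (d≥0 : 0ℝ ≤ d)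
  (mono : ∀ k → a k ≤ a (suc k)) (slow : ∀ k → m ℕ.≤ k → a (suc k) ≤ a k + d * a (suc k)) where

  -- The increments of a from m on telescope, and by `slow` each is at most d times the summand it
  -- leads to. The first m summands enter only through their sign.
  ∑-tail-geometric : ∀ j (f : Fin (j ℕ.+ m) → ℝ) → (∀ i k → toℕ i ≡ k → a (suc k) ≤ f i) →
    a (j ℕ.+ m) ≤ d * foldr _+_ 0ℝ f + a m
  ∑-tail-geometric zero f h = begin
      a m
        ≈⟨ +-identityˡ-≈ (a m) ⟨
      0ℝ + a m
        ≲⟨ +-mono 0ℝ (d * foldr _+_ 0ℝ f) (a m) (a m)
             (*-nonNegative d (foldr _+_ 0ℝ f) d≥0
               (sum-nonNegative f λ i → ≤-trans (a≥0 (suc (toℕ i))) (h i (toℕ i) ≡.refl)))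
             ≤-refl ⟩
      d * foldr _+_ 0ℝ f + a m ∎
    where open ≤-Reasoning
  ∑-tail-geometric (suc j) f h = begin
      a (suc (j ℕ.+ m))
        ≲⟨ slow (j ℕ.+ m) (ℕ.m≤n+m m j) ⟩
      a (j ℕ.+ m) + d * a (suc (j ℕ.+ m))
        ≲⟨ +-mono (a (j ℕ.+ m)) (d * foldr _+_ 0ℝ (init f) + a m) (d * a (suc (j ℕ.+ m))) (d * last f)
             (∑-tail-geometric j (init f) λ i k eq → h (Fin.inject₁ i) k (≡.trans (Fin.toℕ-inject₁ i) eq))
             (*-monoˡ-≤ d (a (suc (j ℕ.+ m))) (last f) d≥0 (h (Fin.fromℕ (j ℕ.+ m)) (j ℕ.+ m) (Fin.toℕ-fromℕ (j ℕ.+ m)))) ⟩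
      d * foldr _+_ 0ℝ (init f) + a m + d * last f
        ≈⟨ pointwise (λ n → solve 4 (λ d s x l → d :* s :+ x :+ d :* l := d :* (s :+ l) :+ x) ≡.refl
             (seq d n) (seq (foldr _+_ 0ℝ (init f)) n) (seq (a m) n) (seq (last f) n)) ⟩
      d * (foldr _+_ 0ℝ (init f) + last f) + a m
        ≈⟨ +-cong (d * (foldr _+_ 0ℝ (init f) + last f)) (d * foldr _+_ 0ℝ f) (a m) (a m)
             (*-congˡ d (foldr _+_ 0ℝ (init f) + last f) (foldr _+_ 0ℝ f) (≈-sym (sum-last f))) ≈-refl ⟩
      d * foldr _+_ 0ℝ f + a m ∎
    where open ≤-Reasoning

  a-mono : ∀ j → a m ≤ a (j ℕ.+ m)
  a-mono zero    = ≤-refl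
  a-mono (suc j) = ≤-trans (a-mono j) (mono (j ℕ.+ m))

  -- Only the last j summands are kept, and by monotonicity each of them is at least `a m`.
  ∑-tail-linear : ∀ j (f : Fin (j ℕ.+ m) → ℝ) → (∀ i k → toℕ i ≡ k → a (suc k) ≤ f i) →
    fromℚ (ι j) * a m ≤ foldr _+_ 0ℝ f
  ∑-tail-linear zero    f h = ≤-trans (≈⇒≤ (pointwise λ n → ℚ.*-zeroˡ (seq (a m) n)))
    (sum-nonNegative f λ i → ≤-trans (a≥0 (suc (toℕ i))) (h i (toℕ i) ≡.refl))
  ∑-tail-linear (suc j) f h = begin
      fromℚ (ι (suc j)) * a m
        ≈⟨ pointwise (λ n → ≡.trans (cong (ℚ._* seq (a m) n) (ι-suc j))
             (solve 2 (λ i x → (i :+ con 1ℚ) :* x := i :* x :+ x) ≡.refl (ι j) (seq (a m) n))) ⟩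
      fromℚ (ι j) * a m + a m
        ≲⟨ +-mono (fromℚ (ι j) * a m) (foldr _+_ 0ℝ (init f)) (a m) (last f)
             (∑-tail-linear j (init f) λ i k eq → h (Fin.inject₁ i) k (≡.trans (Fin.toℕ-inject₁ i) eq))
             (≤-trans (≤-trans (a-mono j) (mono (j ℕ.+ m))) (h (Fin.fromℕ (j ℕ.+ m)) (j ℕ.+ m) (Fin.toℕ-fromℕ (j ℕ.+ m)))) ⟩
      foldr _+_ 0ℝ (init f) + last f
        ≈⟨ sum-last f ⟨
      foldr _+_ 0ℝ f ∎
    where open ≤-Reasoning

if-mono : ∀ {b c : Bool} {p} → 0ℝ ≤ p → (b ≡ true → c ≡ true) →
  (if b then p else 0ℝ) ≤ (if c then p else 0ℝ)
if-mono {true}  {true}  p≥0 b⇒c = ≤-refl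
if-mono {false} {true}  p≥0 b⇒c = p≥0
if-mono {false} {false} p≥0 b⇒c = ≤-refl
if-mono {true}  {false} p≥0 b⇒c with () ← b⇒c ≡.refl

if-nonNegative : ∀ (b : Bool) {p} → 0ℝ ≤ p → 0ℝ ≤ (if b then p else 0ℝ)
if-nonNegative true  p≥0 = p≥0
if-nonNegative false p≥0 = ≤-refl

increasing : ∀ n → Vec ℕ n
increasing n = tabulate (suc ∘ toℕ)

-- The successor keeps even a maximum at the first time strictly above the zeros that follow it.
rise : ∀ {n} → Fin n → Fin n → ℕ
rise i t = if does (t Fin.≤? i) then suc (toℕ t) else 0

rise-≤ : ∀ {n} (i t : Fin n) → t Fin.≤ i → rise i t ≡ suc (toℕ t)
rise-≤ i t t≤i = cong (λ b → if b then suc (toℕ t) else 0) (dec-true (t Fin.≤? i) t≤i)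

rise-max : ∀ {n} (i j : Fin n) → j ≢ i → rise i j ℕ.< suc (toℕ i)
rise-max i j j≢i with j Fin.≤? i
... | yes j≤i = subst (ℕ._< suc (toℕ i)) (≡.sym (rise-≤ i j j≤i)) (ℕ.s≤s (ℕ.≤∧≢⇒< j≤i (j≢i ∘ Fin.toℕ-injective)))
... | no  j≰i = subst (ℕ._< suc (toℕ i))
  (≡.sym (cong (λ b → if b then suc (toℕ j) else 0) (dec-false (j Fin.≤? i) j≰i))) ℕ.z<s

-- Increasing values up to the maximum reveal nothing about its position.
riseInstance : ∀ {n} → Fin n → Instance n
riseInstance i = record
  { value = tabulate (rise i)
  ; i⋆ = i
  ; unique-maximum = λ j j≢i → ≡.subst₂ ℕ._<_ (≡.sym (lookup∘tabulate (rise i) j))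
      (≡.sym (≡.trans (lookup∘tabulate (rise i) i) (rise-≤ i i ℕ.≤-refl))) (rise-max i j j≢i)
  }

upTo-≤ : ∀ {n} (t : Fin n) u → upTo t u Fin.≤ t
upTo-≤ t u = ℕ.≤-trans (ℕ.≤-reflexive (Fin.toℕ-inject≤ u (Fin.toℕ<n t))) (ℕ.s≤s⁻¹ (Fin.toℕ<n u))

observations-rise : ∀ {n} (i s t : Fin n) → t Fin.≤ i →
  observations (tabulate (rise i)) s t ≡ observations (increasing n) s t
observations-rise i s t t≤i = tabulate-cong λ u → cong (_, does (upTo t u Fin.≟ s))
  (≡.trans (lookup∘tabulate (rise i) (upTo t u))
    (≡.trans (rise-≤ i (upTo t u) (ℕ.≤-trans (upTo-≤ t u) t≤i))
             (≡.sym (lookup∘tabulate (suc ∘ toℕ) (upTo t u)))))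

StopsAt-rise : ∀ {n} (π : DeterministicPolicy n) s i →
  StopsAt π (tabulate (rise i)) s i → StopsAt π (increasing n) s i
StopsAt-rise π s i (stops , earlier) =
  ≡.trans (cong (stop π i) (≡.sym (observations-rise i s i ℕ.≤-refl))) stops ,
  λ u u<i → ≡.trans (cong (stop π u) (≡.sym (observations-rise i s u (ℕ.<⇒≤ u<i)))) (earlier u u<i)

StopsAt-unique : ∀ {n} (π : DeterministicPolicy n) v s i j → StopsAt π v s i → StopsAt π v s j → i ≡ j
StopsAt-unique π v s i j (stop-i , before-i) (stop-j , before-j) with Fin.<-cmp i j
... | tri≈ _ i≡j _ = i≡j
... | tri< i<j _ _ with () ← ≡.trans (≡.sym stop-i) (before-j i i<j)
... | tri> _ _ j<i with () ← ≡.trans (≡.sym stop-j) (before-i j j<i)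

-- The default value for policies that never stop is irrelevant.
stopTime : ∀ {n} → DeterministicPolicy n → Fin n → Fin n
stopTime π s with Fin.any? (stopsAt? π (increasing _) s)
... | yes (t , _) = t
... | no  _       = s

stopTime-correct : ∀ {n} (π : DeterministicPolicy n) s i → StopsAt π (increasing n) s i → stopTime π s ≡ i
stopTime-correct π s i stops with Fin.any? (stopsAt? π (increasing _) s)
... | yes (t , stops′) = StopsAt-unique π (increasing _) s t i stops′ stops
... | no  never        = contradiction (i , stops) never

-- After the signal at s, stop at time τ s.
delayPolicy : ∀ {n} → Vec (Fin n) n → DeterministicPolicy n
delayPolicy τ = record
  { stop = λ t obs → does (Fin.any? λ u → (proj₂ (lookup obs u) Bool.≟ true) ×-dec (lookup τ (upTo t u) Fin.≟ t)) }

module _ {n} (τ : Vec (Fin n) n) (v : Vec ℕ n) (s t : Fin n) where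

  private
    observed = λ u → lookup v (upTo t u) , does (upTo t u Fin.≟ s)
    decision = Fin.any? λ u → (proj₂ (lookup (observations v s t) u) Bool.≟ true) ×-dec (lookup τ (upTo t u) Fin.≟ t)

  delayPolicy-stop⇒ : stop (delayPolicy τ) t (observations v s t) ≡ true → lookup τ s ≡ t
  delayPolicy-stop⇒ stops =
    let u , signal , τu≡t = does-true decision stops
        u≡s = does-true (upTo t u Fin.≟ s) (≡.trans (≡.sym (cong proj₂ (lookup∘tabulate observed u))) signal)
    in ≡.trans (cong (lookup τ) (≡.sym u≡s)) τu≡t

  delayPolicy-stop⇐ : s Fin.≤ t → lookup τ s ≡ t → stop (delayPolicy τ) t (observations v s t) ≡ true
  delayPolicy-stop⇐ s≤t τs≡t = dec-true decision
      (u , ≡.trans (cong proj₂ (lookup∘tabulate observed u)) (dec-true (upTo t u Fin.≟ s) u≡s)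
         , ≡.trans (cong (lookup τ) u≡s) τs≡t)
    where
    u = Fin.fromℕ< (ℕ.s≤s s≤t)
    u≡s : upTo t u ≡ s
    u≡s = Fin.toℕ-injective (≡.trans (Fin.toℕ-inject≤ u (Fin.toℕ<n t)) (Fin.toℕ-fromℕ< (ℕ.s≤s s≤t)))

delayPolicy-StopsAt : ∀ {n} (τ : Vec (Fin n) n) v s i → s Fin.≤ i → lookup τ s ≡ i → StopsAt (delayPolicy τ) v s i
delayPolicy-StopsAt τ v s i s≤i τs≡i =
  delayPolicy-stop⇐ τ v s i s≤i τs≡i ,
  λ u u<i → Bool.¬-not λ stops → Fin.<⇒≢ u<i (≡.trans (≡.sym (delayPolicy-stop⇒ τ v s u stops)) τs≡i)

-- The value of delayed stopping

unit-anti : ∀ {m n} → m ℕ.≤ n → unit n ℚ.≤ unit m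
unit-anti {m} {n} m≤n = subst (λ k → unit k ℚ.≤ unit m) (ℕ.m∸n+n≡m m≤n) (go (n ℕ.∸ m))
  where
  go : ∀ d → unit (d ℕ.+ m) ℚ.≤ unit m
  go zero    = ℚ.≤-refl
  go (suc d) = ℚ.≤-trans (unit-step (d ℕ.+ m)) (go d)

exp-unit-mono : ∀ α → 0ℝ ≤ α → ∀ m n → m ℕ.≤ n →
  exp (- (α * fromℚ (unit m))) ≤ exp (- (α * fromℚ (unit n)))
exp-unit-mono α 0≤α m n m≤n = exp-mono (- (α * fromℚ (unit m))) (- (α * fromℚ (unit n)))
  (neg-anti (α * fromℚ (unit n)) (α * fromℚ (unit m))
    (*-monoˡ-≤ α (fromℚ (unit n)) (fromℚ (unit m)) 0≤α (fromℚ-mono (unit-anti m≤n))))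

if-relate : ∀ (R : ℝ → ℝ → Set) (b : Bool) {x x′ y y′} → R x y → R x′ y′ →
  R (if b then x else x′) (if b then y else y′)
if-relate R true  r _ = r
if-relate R false _ r = r

scale-if : ∀ (b : Bool) A w A⁻¹ p → p ≡ w * A⁻¹ → A * A⁻¹ ≈ 1ℝ →
  A * (if b then p else 0ℝ) ≤ (if b then w else 0ℝ)
scale-if b A w A⁻¹ p p≡wA⁻¹ AA⁻¹≈1 =
    if-relate (λ u v → A * u ≤ v) b (scale p p≡wA⁻¹) (≈⇒≤ (pointwise λ n → ℚ.*-zeroʳ (seq A n)))
  where
  open ≤-Reasoning
  scale : ∀ p → p ≡ w * A⁻¹ → A * p ≤ w
  scale _ ≡.refl = begin
    A * (w * A⁻¹)    ≈⟨ pointwise (λ n → solve 3 (λ A w i → A :* (w :* i) := w :* (A :* i)) ≡.refl (seq A n) (seq w n) (seq A⁻¹ n)) ⟩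
    w * (A * A⁻¹)    ≈⟨ *-congˡ w (A * A⁻¹) 1ℝ AA⁻¹≈1 ⟩
    w * 1ℝ           ≈⟨ pointwise (λ n → ℚ.*-identityʳ (seq w n)) ⟩
    w                ∎

one-minus-ratio : ∀ A B A⁻¹ e → 0ℝ ≤ A⁻¹ → A * A⁻¹ ≈ 1ℝ → B ≤ e * A → 1ℝ - e ≤ (A - B) * A⁻¹
one-minus-ratio A B A⁻¹ e 0≤A⁻¹ AA⁻¹≈1 B≤eA = begin
    1ℝ - e                   ≈⟨ pointwise (λ n → ≡.sym (ℚ.*-identityʳ (1ℚ ℚ.- seq e n))) ⟩
    (1ℝ - e) * 1ℝ            ≈⟨ *-congˡ (1ℝ - e) (A * A⁻¹) 1ℝ AA⁻¹≈1 ⟨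
    (1ℝ - e) * (A * A⁻¹)     ≈⟨ pointwise (λ n → solve 3 (λ e A i → (con 1ℚ :- e) :* (A :* i) := (A :- e :* A) :* i) ≡.refl (seq e n) (seq A n) (seq A⁻¹ n)) ⟩
    (A - e * A) * A⁻¹        ≲⟨ *-monoʳ-≤ A⁻¹ (A - e * A) (A - B) 0≤A⁻¹
                                  (+-mono A A (- (e * A)) (- B) ≤-refl (neg-anti B (e * A) B≤eA)) ⟩
    (A - B) * A⁻¹            ∎
  where open ≤-Reasoning

≤-if-true : ∀ {b : Bool} {p} → b ≡ true → p ≤ (if b then p else 0ℝ)
≤-if-true ≡.refl = ≤-refl

minus-≤ : ∀ x y ε q → fromℚ q ≤ ε → x ≤ y + fromℚ q → x - ε ≤ y
minus-≤ x y ε q q≤ε x≤y+q = begin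
    x - ε                    ≲⟨ +-mono x (y + fromℚ q) (- ε) (- fromℚ q) x≤y+q (neg-anti (fromℚ q) ε q≤ε) ⟩
    y + fromℚ q - fromℚ q    ≈⟨ pointwise (λ n → solve 2 (λ y q → y :+ q :- q := y) ≡.refl (seq y n) q) ⟩
    y                        ∎
  where open ≤-Reasoning

plus-< : ∀ x ε → 0ℝ < ε → ∃ λ q → 0ℚ ℚ.< q × x + fromℚ q < x + ε
plus-< x ε (mk< g 0<g N h) =
  let η , 0<η , η+η≡g = halve g 0<g
  in η , 0<η , mk< η 0<η N λ n N≤n → let open ℚ.≤-Reasoning in begin
    seq x n ℚ.+ η ℚ.+ η     ≡⟨ ≡.trans (ℚ.+-assoc (seq x n) η η) (cong (λ e → seq x n ℚ.+ e) η+η≡g) ⟩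
    seq x n ℚ.+ g           ≤⟨ ℚ.+-monoʳ-≤ (seq x n) (ℚ.≤-trans (ℚ.≤-reflexive (≡.sym (ℚ.+-identityˡ g))) (h n N≤n)) ⟩
    seq x n ℚ.+ seq ε n     ∎

-- Existence of the optimum and its lower bound

module Secretary (α : ℝ) (α>0 : 0ℝ < α) where

  0≤α : 0ℝ ≤ α
  0≤α = <⇒≤ 0ℝ α α>0

  open Powers α 0≤α

  weight-nonNegative : ∀ k → 0ℝ ≤ suc k ^ α - k ^ α
  weight-nonNegative k = ≤⇒0≤- (k ^ α) (suc k ^ α) (^-mono-suc k)

  signalProbability-nonNegative : ∀ {n} (i : Fin n) s → 0ℝ ≤ signalProbability α α>0 i s
  signalProbability-nonNegative i s =
    *-nonNegative (suc (toℕ s) ^ α - toℕ s ^ α) (inverse (suc (toℕ i) ^ α) (^-pos (toℕ i) α α>0))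
      (weight-nonNegative (toℕ s)) (inverse-nonNegative (suc (toℕ i) ^ α) (^-pos (toℕ i) α α>0))

  -- Tables are unrestricted: the sum runs over s ≤ i, so an entry τ s < s never contributes, just
  -- as `delayPolicy` never stops after such a signal.
  delayValue : ∀ {n} → Vec (Fin n) n → Fin n → ℝ
  delayValue τ i = foldr _+_ 0ℝ λ (s : Fin (suc (toℕ i))) →
    if does (lookup τ (upTo i s) Fin.≟ i) then signalProbability α α>0 i s else 0ℝ

  delayValue≤success : ∀ {n} (τ : Vec (Fin n) n) (I : Instance n) →
    delayValue τ (i⋆ I) ≤ successProbability α α>0 (delayPolicy τ) I
  delayValue≤success τ I = sum-mono
    (λ (s : Fin (suc (toℕ (i⋆ I)))) → if does (lookup τ (upTo (i⋆ I) s) Fin.≟ i⋆ I)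
      then signalProbability α α>0 (i⋆ I) s else 0ℝ)
    (λ (s : Fin (suc (toℕ (i⋆ I)))) → if does (stopsAt? (delayPolicy τ) (value I) (upTo (i⋆ I) s) (i⋆ I))
      then signalProbability α α>0 (i⋆ I) s else 0ℝ)
    λ s → if-mono (signalProbability-nonNegative (i⋆ I) s) λ hit →
      dec-true (stopsAt? (delayPolicy τ) (value I) (upTo (i⋆ I) s) (i⋆ I))
        (delayPolicy-StopsAt τ (value I) (upTo (i⋆ I) s) (i⋆ I) (upTo-≤ (i⋆ I) s)
          (does-true (lookup τ (upTo (i⋆ I) s) Fin.≟ i⋆ I) hit))

  success≤delayValue : ∀ {n} (π : DeterministicPolicy n) (I : Instance n) (τ : Vec (Fin n) n) →
    (∀ s → StopsAt π (value I) s (i⋆ I) → lookup τ s ≡ i⋆ I) →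
    successProbability α α>0 π I ≤ delayValue τ (i⋆ I)
  success≤delayValue π I τ τ-correct = sum-mono
    (λ (s : Fin (suc (toℕ (i⋆ I)))) → if does (stopsAt? π (value I) (upTo (i⋆ I) s) (i⋆ I))
      then signalProbability α α>0 (i⋆ I) s else 0ℝ)
    (λ (s : Fin (suc (toℕ (i⋆ I)))) → if does (lookup τ (upTo (i⋆ I) s) Fin.≟ i⋆ I)
      then signalProbability α α>0 (i⋆ I) s else 0ℝ)
    λ s → if-mono (signalProbability-nonNegative (i⋆ I) s) λ hit →
      dec-true (lookup τ (upTo (i⋆ I) s) Fin.≟ i⋆ I)
        (τ-correct (upTo (i⋆ I) s) (does-true (stopsAt? π (value I) (upTo (i⋆ I) s) (i⋆ I)) hit))

  -- Up to time i the policy observes what it would observe on `increasing n`, so the single table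
  -- `stopTime π` serves all positions i at once.
  success-rise≤ : ∀ {n} (π : DeterministicPolicy n) i →
    successProbability α α>0 π (riseInstance i) ≤ delayValue (tabulate (stopTime π)) i
  success-rise≤ π i = subst
    (λ j → successProbability α α>0 π (riseInstance i) ≤ delayValue (tabulate (stopTime π)) j)
    {x = i⋆ (riseInstance i)} {y = i} ≡.refl
    (success≤delayValue π (riseInstance i) (tabulate (stopTime π)) λ s stops →
      ≡.trans (lookup∘tabulate (stopTime π) s) (stopTime-correct π s i (StopsAt-rise π s i stops)))

  success-nonNegative : ∀ {n} (π : DeterministicPolicy n) I → 0ℝ ≤ successProbability α α>0 π I
  success-nonNegative π I = sum-nonNegative
    (λ (s : Fin (suc (toℕ (i⋆ I)))) → if does (stopsAt? π (value I) (upTo (i⋆ I) s) (i⋆ I))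
      then signalProbability α α>0 (i⋆ I) s else 0ℝ)
    λ s → if-nonNegative (does (stopsAt? π (value I) (upTo (i⋆ I) s) (i⋆ I))) (signalProbability-nonNegative (i⋆ I) s)

  -- Positions and tables are finite in number, so this max-min exists as a real number, which an
  -- infimum over all instances need not.
  delayValue-optimum : ∀ n → ∃ λ x →
    (∀ (τ : Vec (Fin (suc n)) (suc n)) q → 0ℚ ℚ.< q → ∃ λ i → delayValue τ i ≤ x + fromℚ q) ×
    (∀ q → 0ℚ ℚ.< q → ∃ λ (τ : Vec (Fin (suc n)) (suc n)) → ∀ i → x ≤ delayValue τ i + fromℚ q)
  delayValue-optimum n = combine (λ τ → suprema⇒infima (Fin-suprema n) (delayValue τ))
    where
    Table = Vec (Fin (suc n)) (suc n)
    combine : (∀ (τ : Table) → ∃ (Inf (delayValue τ))) → _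
    combine inner = collect (Vec-suprema (Fin-suprema n) (suc n) (λ τ → proj₁ (inner τ)))
      where
      collect : ∃ (Sup (λ τ → proj₁ (inner τ))) → _
      collect (x , upper , attained) = x ,
        (λ τ q 0<q → let i , value≤ = proj₂ (proj₂ (inner τ)) q 0<q in i ,
          ≤-trans value≤ (+-monoˡ-≤ (fromℚ q) (proj₁ (inner τ)) x (upper τ))) ,
        λ q 0<q → let τ , x≤ = attained q 0<q in τ , λ i →
          ≤-trans x≤ (+-monoˡ-≤ (fromℚ q) (proj₁ (inner τ)) (delayValue τ i) (proj₁ (proj₂ (inner τ)) i))

  -- Policies become tables by `stopTime`, judged on the increasing instances, and tables become
  -- policies by `delayPolicy`, judged on every instance. Neither passage lowers the value, so the
  -- optimum over tables is the optimum over policies.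
  OPTdet-exists : ∀ n → ∃ (IsOPTdet α α>0 (suc n))
  OPTdet-exists n = collect (delayValue-optimum n)
    where
    collect : _ → ∃ (IsOPTdet α α>0 (suc n))
    collect (x , upper , attained) = x ,
      (λ π ε 0<ε →
        let q , 0<q , x+q<x+ε = plus-< x ε 0<ε
            i , value≤ = upper (tabulate (stopTime π)) q 0<q
        in riseInstance i ,
           ≤-<-trans (successProbability α α>0 π (riseInstance i)) (x + fromℚ q) (x + ε)
             (≤-trans (success-rise≤ π i) value≤) x+q<x+ε) ,
      λ ε 0<ε →
        let q , 0<q , q≤ε = pos⇒fromℚ≤ 0<ε
            τ , x≤ = attained q 0<q
        in delayPolicy τ , λ I →
           minus-≤ x (successProbability α α>0 (delayPolicy τ) I) ε q q≤ε
             (≤-trans (x≤ (i⋆ I)) (+-monoˡ-≤ (fromℚ q) (delayValue τ (i⋆ I))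
               (successProbability α α>0 (delayPolicy τ) I) (delayValue≤success τ I)))

  -- Keeping the summand of a signal at the maximum itself is enough. Its bound is weakest for a
  -- maximum at the last time n + 1, hence `unit n`.
  delayValue-id : ∀ {n} (i : Fin (suc n)) →
    1ℝ - exp (- (α * fromℚ (unit n))) ≤ delayValue (tabulate id) i
  delayValue-id {n} i = ≤-trans (≤-trans lower (≤-if-true hit)) (term≤sum
      (λ (s : Fin (suc (toℕ i))) → if does (lookup (tabulate id) (upTo i s) Fin.≟ i) then signalProbability α α>0 i s else 0ℝ)
      (λ s → if-nonNegative (does (lookup (tabulate id) (upTo i s) Fin.≟ i)) (signalProbability-nonNegative i s))
      (Fin.fromℕ (toℕ i)))
    where
    hit : does (lookup (tabulate id) (upTo i (Fin.fromℕ (toℕ i))) Fin.≟ i) ≡ true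
    hit = dec-true (lookup (tabulate id) (upTo i (Fin.fromℕ (toℕ i))) Fin.≟ i)
      (≡.trans (lookup∘tabulate id (upTo i (Fin.fromℕ (toℕ i)))) (Fin.toℕ-injective
        (≡.trans (Fin.toℕ-inject≤ (Fin.fromℕ (toℕ i)) (Fin.toℕ<n i)) (Fin.toℕ-fromℕ (toℕ i)))))
    bound : ∀ k → k ≡ toℕ i → 1ℝ - exp (- (α * fromℚ (unit n))) ≤
      (suc k ^ α - k ^ α) * inverse (suc (toℕ i) ^ α) (^-pos (toℕ i) α α>0)
    bound _ ≡.refl = one-minus-ratio (suc (toℕ i) ^ α) (toℕ i ^ α)
      (inverse (suc (toℕ i) ^ α) (^-pos (toℕ i) α α>0)) (exp (- (α * fromℚ (unit n))))
      (inverse-nonNegative (suc (toℕ i) ^ α) (^-pos (toℕ i) α α>0))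
      (*-inverseʳ (suc (toℕ i) ^ α) (^-pos (toℕ i) α α>0))
      (≤-trans (^-ratio-≤ (toℕ i))
        (*-monoʳ-≤ (suc (toℕ i) ^ α) (exp (- (α * fromℚ (unit (toℕ i))))) (exp (- (α * fromℚ (unit n))))
          (^-nonNegative (suc (toℕ i))) (exp-unit-mono α 0≤α (toℕ i) n (ℕ.s≤s⁻¹ (Fin.toℕ<n i)))))
    lower : 1ℝ - exp (- (α * fromℚ (unit n))) ≤ signalProbability α α>0 i (Fin.fromℕ (toℕ i))
    lower = bound (toℕ (Fin.fromℕ (toℕ i))) (Fin.toℕ-fromℕ (toℕ i))

  -- The first half of `IsOPTdet`, applied to the policy that stops at the signal, yields an
  -- instance on which its success stays below x + q; the bound of `delayValue-id` holds there too.
  OPTdet-lower : ∀ n x → IsOPTdet α α>0 (suc n) x → 1ℝ - exp (- (α * fromℚ (unit n))) ≤ x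
  OPTdet-lower n x (upper , _) = ≤-limit₁ (1ℝ - exp (- (α * fromℚ (unit n)))) x λ q 0<q →
    let I , success< = upper (delayPolicy (tabulate id)) (fromℚ q) (fromℚ-pos q 0<q)
    in ≤-trans (delayValue-id (i⋆ I)) (≤-trans (delayValue≤success (tabulate id) I)
         (<⇒≤ (successProbability α α>0 (delayPolicy (tabulate id)) I) (x + fromℚ q) success<))

-- Upper bound by double counting

slow-growth : ∀ e A B y → 0ℝ ≤ y → e * A ≤ B → A * y ≤ B * y + (1ℝ - e) * (A * y)
slow-growth e A B y 0≤y eA≤B = ≤-rearrange (e * A * y) (B * y) (A * y) (B * y + (1ℝ - e) * (A * y))
  (*-monoʳ-≤ y (e * A) B 0≤y eA≤B)
  λ n → solve 4 (λ e A B y → B :* y :- e :* A :* y := B :* y :+ (con 1ℚ :- e) :* (A :* y) :- A :* y) ≡.refl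
    (seq e n) (seq A n) (seq B n) (seq y n)

-- Here A = n ^ α, S = Σ i ^ α y, p = m ^ α y and u = 1 / J with J = i. Then A y ≤ d S + p ≤ d S + S
-- / J ≤ (d + 1 / J) A, and A cancels.
average : ∀ A S d y p u i → 0ℝ < A → 0ℝ ≤ d → 0ℚ ℚ.≤ u → u ℚ.* i ≡ 1ℚ → A * y ≤ d * S + p →
  fromℚ i * p ≤ S → S ≤ A → y ≤ d + fromℚ u
average A S d y p u i 0<A 0≤d 0≤u ui≡1 Ay≤ ip≤S S≤A =
  *-cancelˡ-≤ A (inverse A 0<A) y (d + fromℚ u) (inverse-nonNegative A 0<A) (*-inverseʳ A 0<A) (begin
    A * y
      ≲⟨ Ay≤ ⟩
    d * S + p
      ≈⟨ +-cong (d * S) (d * S) p (fromℚ u * (fromℚ i * p)) ≈-refl (pointwise λ n →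
           ≡.trans (≡.trans (≡.sym (ℚ.*-identityˡ (seq p n))) (cong (ℚ._* seq p n) (≡.sym ui≡1)))
                   (ℚ.*-assoc u i (seq p n))) ⟩
    d * S + fromℚ u * (fromℚ i * p)
      ≲⟨ +-mono (d * S) (d * A) (fromℚ u * (fromℚ i * p)) (fromℚ u * A)
           (*-monoˡ-≤ d S A 0≤d S≤A)
           (*-monoˡ-≤ (fromℚ u) (fromℚ i * p) A (fromℚ-mono 0≤u) (≤-trans ip≤S S≤A)) ⟩
    d * A + fromℚ u * A
      ≈⟨ pointwise (λ n → solve 3 (λ d u A → d :* A :+ u :* A := A :* (d :+ u)) ≡.refl (seq d n) u (seq A n)) ⟩
    A * (d + fromℚ u) ∎)
  where open ≤-Reasoning

module UpperBound (α : ℝ) (α>0 : 0ℝ < α) where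

  open Secretary α α>0
  open Powers α 0≤α

  -- Signal weights without the denominator i ^ α, and for all s rather than s ≤ i: the rows then
  -- form a square matrix whose double sum can be exchanged, and the added entries are nonnegative.
  hits : ∀ {n} → Vec (Fin n) n → Fin n → Fin n → ℝ
  hits τ i s = if does (lookup τ s Fin.≟ i) then suc (toℕ s) ^ α - toℕ s ^ α else 0ℝ

  row : ∀ {n} (τ : Vec (Fin n) n) y i → y ≤ delayValue τ i →
    suc (toℕ i) ^ α * y ≤ foldr _+_ 0ℝ (hits τ i)
  row {n} τ y i y≤value = ≤-trans
      (*-monoˡ-≤ (suc (toℕ i) ^ α) y
        (foldr _+_ 0ℝ (λ (s : Fin (suc (toℕ i))) → if does (lookup τ (upTo i s) Fin.≟ i) then signalProbability α α>0 i s else 0ℝ))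
        (^-nonNegative (suc (toℕ i))) y≤value)
      (≤-trans (*-sum-≤ (suc (toℕ i) ^ α)
        (λ (s : Fin (suc (toℕ i))) → if does (lookup τ (upTo i s) Fin.≟ i) then signalProbability α α>0 i s else 0ℝ)
        g λ s → scaled s (toℕ s) ≡.refl)
        (sum-inject≤ g (hits τ i) (Fin.toℕ<n i) (λ s → shifted s) λ s →
          if-nonNegative (does (lookup τ s Fin.≟ i)) (weight-nonNegative (toℕ s))))
    where
    g : Fin (suc (toℕ i)) → ℝ
    g s = if does (lookup τ (upTo i s) Fin.≟ i) then suc (toℕ s) ^ α - toℕ s ^ α else 0ℝ
    scaled : ∀ s k → k ≡ toℕ s →
      suc (toℕ i) ^ α * (if does (lookup τ (upTo i s) Fin.≟ i) then signalProbability α α>0 i s else 0ℝ) ≤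
      (if does (lookup τ (upTo i s) Fin.≟ i) then suc k ^ α - k ^ α else 0ℝ)
    scaled s _ ≡.refl = scale-if (does (lookup τ (upTo i s) Fin.≟ i)) (suc (toℕ i) ^ α)
      (suc (toℕ s) ^ α - toℕ s ^ α) (inverse (suc (toℕ i) ^ α) (^-pos (toℕ i) α α>0))
      (signalProbability α α>0 i s) ≡.refl (*-inverseʳ (suc (toℕ i) ^ α) (^-pos (toℕ i) α α>0))
    shifted : ∀ s → g s ≤ hits τ i (inject≤ s (Fin.toℕ<n i))
    shifted s = relabel (toℕ (inject≤ s (Fin.toℕ<n i))) (Fin.toℕ-inject≤ s (Fin.toℕ<n i))
      where
      relabel : ∀ k → k ≡ toℕ s →
        g s ≤ (if does (lookup τ (upTo i s) Fin.≟ i) then suc k ^ α - k ^ α else 0ℝ)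
      relabel _ ≡.refl = ≤-refl

  column : ∀ {n} (τ : Vec (Fin n) n) s → foldr _+_ 0ℝ (λ i → hits τ i s) ≤ suc (toℕ s) ^ α - toℕ s ^ α
  column τ s = sum-≤-single (λ i → hits τ i s) (lookup τ s) (suc (toℕ s) ^ α - toℕ s ^ α) (weight-nonNegative (toℕ s))
      (if-≤ (does (lookup τ s Fin.≟ lookup τ s)))
      λ i i≢τs → if-false (dec-false (lookup τ s Fin.≟ i) (i≢τs ∘ ≡.sym))
    where
    if-≤ : ∀ b → (if b then suc (toℕ s) ^ α - toℕ s ^ α else 0ℝ) ≤ suc (toℕ s) ^ α - toℕ s ^ α
    if-≤ true  = ≤-refl
    if-≤ false = weight-nonNegative (toℕ s)
    if-false : ∀ {b p} → b ≡ false → (if b then p else 0ℝ) ≤ 0ℝ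
    if-false ≡.refl = ≤-refl

  -- Each signal time s is answered at the single time τ s, so over all positions
  -- of the maximum the weights of successful signal times add up to at most n ^ α.
  sum-powers≤ : ∀ {n} (τ : Vec (Fin n) n) y → (∀ i → y ≤ delayValue τ i) →
    foldr _+_ 0ℝ (λ (i : Fin n) → suc (toℕ i) ^ α * y) ≤ n ^ α
  sum-powers≤ {n} τ y y≤value = begin
      foldr _+_ 0ℝ (λ (i : Fin n) → suc (toℕ i) ^ α * y)
        ≲⟨ sum-mono (λ (i : Fin n) → suc (toℕ i) ^ α * y) (λ i → foldr _+_ 0ℝ (hits τ i)) (λ i → row τ y i (y≤value i)) ⟩
      foldr _+_ 0ℝ (λ i → foldr _+_ 0ℝ (hits τ i))
        ≈⟨ sum-swap (hits τ) ⟩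
      foldr _+_ 0ℝ (λ s → foldr _+_ 0ℝ (λ i → hits τ i s))
        ≲⟨ sum-mono (λ s → foldr _+_ 0ℝ (λ i → hits τ i s)) (λ s → suc (toℕ s) ^ α - toℕ s ^ α) (column τ) ⟩
      foldr _+_ 0ℝ (λ (s : Fin n) → suc (toℕ s) ^ α - toℕ s ^ α)
        ≲⟨ sum-telescope n (λ k → k ^ α) (λ s → suc (toℕ s) ^ α - toℕ s ^ α) (λ { s _ ≡.refl → ≤-refl }) ⟩
      n ^ α - zero ^ α
        ≈⟨ pointwise (λ k → ℚ.+-identityʳ (seq (n ^ α) k)) ⟩
      n ^ α ∎
    where open ≤-Reasoning

  delayValue-upper : ∀ j m (τ : Vec (Fin (suc j ℕ.+ suc m)) (suc j ℕ.+ suc m)) y e → 0ℝ ≤ y → 0ℝ ≤ 1ℝ - e →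
    (∀ k → suc m ℕ.≤ k → e * suc k ^ α ≤ k ^ α) →
    (∀ i → y ≤ delayValue τ i) → y ≤ (1ℝ - e) + fromℚ (unit j)
  delayValue-upper j m τ y e 0≤y 0≤d ratio y≤value =
      average ((suc j ℕ.+ suc m) ^ α) (foldr _+_ 0ℝ (λ (i : Fin (suc j ℕ.+ suc m)) → suc (toℕ i) ^ α * y))
        (1ℝ - e) y (suc m ^ α * y) (unit j) (ι (suc j))
        (^-pos (j ℕ.+ suc m) α α>0) 0≤d (unit-nonNeg j) (unit-inverse j)
        (∑-tail-geometric (suc j) (λ i → suc (toℕ i) ^ α * y) (λ { i _ ≡.refl → ≤-refl }))
        (∑-tail-linear (suc j) (λ i → suc (toℕ i) ^ α * y) (λ { i _ ≡.refl → ≤-refl }))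
        (sum-powers≤ τ y y≤value)
    where
    -- With y absorbed into the sequence, the sum is literally the one bounded by `sum-powers≤`.
    open TailSum (λ k → k ^ α * y) (1ℝ - e) (suc m)
      (λ k → *-nonNegative (k ^ α) y (^-nonNegative k) 0≤y) 0≤d
      (λ k → *-monoʳ-≤ y (k ^ α) (suc k ^ α) 0≤y (^-mono-suc k))
      (λ k m≤k → slow-growth e (suc k ^ α) (k ^ α) y 0≤y (ratio k m≤k))

  ^-ratio-uniform : ∀ m k → suc m ℕ.≤ k → exp (- (α * fromℚ (unit m))) * suc k ^ α ≤ k ^ α
  ^-ratio-uniform m (suc k) (ℕ.s≤s m≤k) = ≤-trans
    (*-monoʳ-≤ (suc (suc k) ^ α) (exp (- (α * fromℚ (unit m)))) (exp (- (α * fromℚ (unit k))))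
      (^-nonNegative (suc (suc k))) (exp-unit-mono α 0≤α m k m≤k))
    (^-ratio-≥ k)

  OPTdet-upper : ∀ j m x → IsOPTdet α α>0 (suc j ℕ.+ suc m) x →
    x ≤ (1ℝ - exp (- (α * fromℚ (unit m)))) + fromℚ (unit j)
  OPTdet-upper j m x (_ , lower) = ≤-limit₁ x ((1ℝ - exp (- (α * fromℚ (unit m)))) + fromℚ (unit j)) λ q 0<q →
    let π , x-q≤ = lower (fromℚ q) (fromℚ-pos q 0<q) in begin
      x
        ≈⟨ pointwise (λ n → solve 2 (λ x q → x := x :- q :+ q) ≡.refl (seq x n) q) ⟩
      x - fromℚ q + fromℚ q
        ≲⟨ +-monoˡ-≤ (fromℚ q) (x - fromℚ q) ((1ℝ - exp (- (α * fromℚ (unit m)))) + fromℚ (unit j))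
             -- The double counting multiplies inequalities by y and so takes y ≥ 0, whereas x - q
             -- may be negative. Its maximum with 0 is still below every success probability.
             (≤-trans (x≤x⊔y (x - fromℚ q) 0ℝ)
               (delayValue-upper j m (tabulate (stopTime π)) ((x - fromℚ q) ⊔ 0ℝ) (exp (- (α * fromℚ (unit m))))
                 (y≤x⊔y (x - fromℚ q) 0ℝ)
                 (≤⇒0≤- (exp (- (α * fromℚ (unit m)))) 1ℝ (exp-neg≤1 (α * fromℚ (unit m))
                   (*-nonNegative α (fromℚ (unit m)) 0≤α (fromℚ-mono (unit-nonNeg m)))))
                 (^-ratio-uniform m) λ i →
                 ≤-trans (⊔-lub (x - fromℚ q) 0ℝ (successProbability α α>0 π (riseInstance i))
                           (x-q≤ (riseInstance i)) (success-nonNegative π (riseInstance i)))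
                         (success-rise≤ π i))) ⟩
      (1ℝ - exp (- (α * fromℚ (unit m)))) + fromℚ (unit j) + fromℚ q ∎
    where open ≤-Reasoning

-- Asymptotics

∣-∣<⇒≤ : ∀ x y q → ∣ x - y ∣ < fromℚ q → x ≤ y + fromℚ q × y ≤ x + fromℚ q
∣-∣<⇒≤ x y q (mk< g 0<g N h) =
    eventually⇒≤ N (λ n N≤n → ∣p-r∣≤ε⇒p≤r+ε (seq x n) (seq y n) (close n N≤n)) ,
    eventually⇒≤ N (λ n N≤n → ∣p-r∣≤ε⇒p≤r+ε (seq y n) (seq x n)
      (ℚ.≤-trans (ℚ.≤-reflexive (RationalAnalysis.∣∣-sym (seq y n) (seq x n))) (close n N≤n)))
  where
  close : ∀ n → N ℕ.≤ n → ℚ.∣ seq x n ℚ.- seq y n ∣ ℚ.≤ q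
  close n N≤n = ℚ.≤-trans (p≤p+q ℚ.∣ seq x n ℚ.- seq y n ∣ (ℚ.<⇒≤ 0<g)) (h n N≤n)

∣-∣-≤ : ∀ x y q → x ≤ y + fromℚ q → y ≤ x + fromℚ q → ∣ x - y ∣ ≤ fromℚ q
∣-∣-≤ x y q (mk≤ f) (mk≤ g) = mk≤ λ ε 0<ε →
  let M , hM = f ε 0<ε
      N , hN = g ε 0<ε
  in M ℕ.⊔ N , λ n le → bound (seq x n) (seq y n) ε (hM n (ℕ.m⊔n≤o⇒m≤o M N le)) (hN n (ℕ.m⊔n≤o⇒n≤o M N le))
  where
  side : ∀ a b ε → a ℚ.≤ b ℚ.+ q ℚ.+ ε → a ℚ.- b ℚ.≤ q ℚ.+ ε
  side a b ε a≤ = ℚ.≤-trans (ℚ.+-monoˡ-≤ (ℚ.- b) a≤)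
    (ℚ.≤-reflexive (solve 3 (λ b q e → b :+ q :+ e :- b := q :+ e) ≡.refl b q ε))
  bound : ∀ a b ε → a ℚ.≤ b ℚ.+ q ℚ.+ ε → b ℚ.≤ a ℚ.+ q ℚ.+ ε → ℚ.∣ a ℚ.- b ∣ ℚ.≤ q ℚ.+ ε
  bound a b ε a≤ b≤ with ℚ.∣p∣≡p∨∣p∣≡-p (a ℚ.- b)
  ... | inj₁ eq = ℚ.≤-trans (ℚ.≤-reflexive eq) (side a b ε a≤)
  ... | inj₂ eq = ℚ.≤-trans (ℚ.≤-reflexive (≡.trans eq (solve 2 (λ a b → :- (a :- b) := b :- a) ≡.refl a b)))
                            (side b a ε b≤)

-- Convergence as two weak one-sided inequalities with a rational error, the form in which the
-- bounds on the optimum arise.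
Within : Sequence → ℝ → ℚ → Set
Within x L q = ∃ λ N → ∀ n → .{{_ : NonZero n}} → N ℕ.≤ n → x n ≤ L + fromℚ q × L ≤ x n + fromℚ q

⟶⇒Within : ∀ x L → x ⟶ L → ∀ q → 0ℚ ℚ.< q → Within x L q
⟶⇒Within x L x⟶L q 0<q =
  let N , h = x⟶L (fromℚ q) (fromℚ-pos q 0<q)
  in N , λ n N≤n → ∣-∣<⇒≤ (x n) L q (h n N≤n)

Within⇒⟶ : ∀ x L → (∀ q → 0ℚ ℚ.< q → Within x L q) → x ⟶ L
Within⇒⟶ x L within ε 0<ε =
  let g , 0<g , g≤ε = pos⇒fromℚ≤ 0<ε
      -- `Within` gives a weak inequality and `_⟶_` asks for a strict one; halving g leaves the gap.
      η , 0<η , η+η≡g = halve g 0<g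
      N , h = within η 0<η
  in N , λ n N≤n → ≤-<-trans ∣ x n - L ∣ (fromℚ η) ε (∣-∣-≤ (x n) L η (proj₁ (h n N≤n)) (proj₂ (h n N≤n)))
       (half<ε 0<η η+η≡g g≤ε)
  where
  half<ε : ∀ {η g} → 0ℚ ℚ.< η → η ℚ.+ η ≡ g → fromℚ g ≤ ε → fromℚ η < ε
  half<ε {η} {g} 0<η η+η≡g (mk≤ f) =
    let θ , 0<θ , θ+θ≡η = halve η 0<η
        N , h = f θ 0<θ
    in mk< θ 0<θ N λ n N≤n → let open ℚ.≤-Reasoning in begin
      η ℚ.+ θ                    ≡⟨ solve 2 (λ e t → e :+ t := e :+ (t :+ t) :- t) ≡.refl η θ ⟩
      η ℚ.+ (θ ℚ.+ θ) ℚ.- θ      ≡⟨ cong (λ z → η ℚ.+ z ℚ.- θ) θ+θ≡η ⟩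
      η ℚ.+ η ℚ.- θ              ≡⟨ cong (ℚ._- θ) η+η≡g ⟩
      g ℚ.- θ                    ≤⟨ ℚ.+-monoˡ-≤ (ℚ.- θ) (h n N≤n) ⟩
      seq ε n ℚ.+ θ ℚ.- θ        ≡⟨ solve 2 (λ x t → x :+ t :- t := x) ≡.refl (seq ε n) θ ⟩
      seq ε n                    ∎

unit-small : ∀ K q → 0ℚ ℚ.< q → ∃ λ M → ∀ m → M ℕ.≤ m → ι K ℚ.* unit m ℚ.≤ q
unit-small K q 0<q =
  let R , _ , qR≡ = split q 0<q (1ℚ ℚ.+ ι K) (RationalAnalysis.1+-pos (ι-nonNeg K))
      M , R≤M = archimedean R
  in M , λ m M≤m → let open ℚ.≤-Reasoning in begin
    ι K ℚ.* unit m                   ≤⟨ *-monoʳ (unit m) (unit-nonNeg m) (begin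
      ι K                              ≤⟨ p≤p+q (ι K) (ℚ.nonNegative⁻¹ 1ℚ) ⟩
      ι K ℚ.+ 1ℚ                       ≡⟨ ≡.trans (ℚ.+-comm (ι K) 1ℚ) (≡.sym qR≡) ⟩
      q ℚ.* R                          ≤⟨ *-monoˡ q (ℚ.<⇒≤ 0<q) (ℚ.≤-trans R≤M (ι-mono (ℕ.m≤n⇒m≤1+n M≤m))) ⟩
      q ℚ.* ι (suc m)                  ∎) ⟩
    q ℚ.* ι (suc m) ℚ.* unit m       ≡⟨ solve 3 (λ q i u → q :* i :* u := q :* (u :* i)) ≡.refl q (ι (suc m)) (unit m) ⟩
    q ℚ.* (unit m ℚ.* ι (suc m))     ≡⟨ cong (q ℚ.*_) (unit-inverse m) ⟩
    q ℚ.* 1ℚ                         ≡⟨ ℚ.*-identityʳ q ⟩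
    q                                ∎

-- 1 / (m + 1) = 1 / n + (j + 1) / ((m + 1) n) for n = (j + 1) + (m + 1)
unit-shift : ∀ j m → unit m ≡ unit (j ℕ.+ suc m) ℚ.+ unit (j ℕ.+ suc m) ℚ.* (ι (suc j) ℚ.* unit m)
unit-shift j m = begin
    u                                ≡⟨ ℚ.*-identityˡ u ⟨
    1ℚ ℚ.* u                         ≡⟨ cong (ℚ._* u) (unit-inverse (j ℕ.+ suc m)) ⟨
    v ℚ.* ι (suc j ℕ.+ suc m) ℚ.* u  ≡⟨ cong (λ i → v ℚ.* i ℚ.* u) (ι-+ (suc j) (suc m)) ⟩
    v ℚ.* (ι (suc j) ℚ.+ ι (suc m)) ℚ.* u
      ≡⟨ solve 4 (λ v i k u → v :* (i :+ k) :* u := v :* (u :* k) :+ v :* (i :* u)) ≡.refl v (ι (suc j)) (ι (suc m)) u ⟩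
    v ℚ.* (u ℚ.* ι (suc m)) ℚ.+ v ℚ.* (ι (suc j) ℚ.* u)
      ≡⟨ cong (λ z → v ℚ.* z ℚ.+ v ℚ.* (ι (suc j) ℚ.* u)) (unit-inverse m) ⟩
    v ℚ.* 1ℚ ℚ.+ v ℚ.* (ι (suc j) ℚ.* u)
      ≡⟨ cong (ℚ._+ v ℚ.* (ι (suc j) ℚ.* u)) (ℚ.*-identityʳ v) ⟩
    v ℚ.+ v ℚ.* (ι (suc j) ℚ.* u)    ∎
  where
  open ≡.≡-Reasoning
  u = unit m
  v = unit (j ℕ.+ suc m)

1/-unit : ∀ k n → .{{_ : NonZero k}} → k ≡ suc n → + 1 ℚ./ k ≡ unit n
1/-unit _ n ≡.refl = ≡.refl

/ℕ-as-* : ∀ x k q → .{{_ : NonZero k}} → + 1 ℚ./ k ≡ q → x /ℕ k ≡ x * fromℚ q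
/ℕ-as-* x k _ ≡.refl = ≡.refl

-- Replacing n = (j + 1) + (m + 1) by m + 1 in α / n costs at most K (j + 1) / (m + 1).
shifted-rate : ∀ α c K j m η → α * fromℚ (unit (j ℕ.+ suc m)) ≤ c + fromℚ η →
  α * fromℚ (unit (j ℕ.+ suc m)) ≤ fromℚ (ι K) → ι (K ℕ.* suc j) ℚ.* unit m ℚ.≤ η →
  α * fromℚ (unit m) ≤ c + fromℚ η + fromℚ η
shifted-rate α c K j m η t≤c+η t≤K small = begin
    α * fromℚ (unit m)
      ≈⟨ pointwise (λ n → ≡.trans (cong (seq α n ℚ.*_) (unit-shift j m))
           (solve 3 (λ a v r → a :* (v :+ v :* r) := a :* v :+ r :* (a :* v)) ≡.refl (seq α n) (unit (j ℕ.+ suc m)) (ι (suc j) ℚ.* unit m))) ⟩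
    α * fromℚ (unit (j ℕ.+ suc m)) + fromℚ (ι (suc j) ℚ.* unit m) * (α * fromℚ (unit (j ℕ.+ suc m)))
      ≲⟨ +-mono (α * fromℚ (unit (j ℕ.+ suc m))) (c + fromℚ η)
           (fromℚ (ι (suc j) ℚ.* unit m) * (α * fromℚ (unit (j ℕ.+ suc m)))) (fromℚ η) t≤c+η
           (≤-trans (*-monoˡ-≤ (fromℚ (ι (suc j) ℚ.* unit m)) (α * fromℚ (unit (j ℕ.+ suc m))) (fromℚ (ι K))
                       (fromℚ-mono (RationalAnalysis.*-nonNeg (ι-nonNeg (suc j)) (unit-nonNeg m))) t≤K)
                    (eventually⇒≤ 0 λ _ _ → ℚ.≤-trans (ℚ.≤-reflexive product) small)) ⟩
    c + fromℚ η + fromℚ η ∎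
  where
  open ≤-Reasoning
  ι-* : ∀ K J → ι (K ℕ.* J) ≡ ι K ℚ.* ι J
  ι-* zero    J = ≡.sym (ℚ.*-zeroˡ (ι J))
  ι-* (suc K) J = ≡.trans (ι-+ J (K ℕ.* J)) (≡.trans (cong (λ z → ι J ℚ.+ z) (ι-* K J))
    (≡.trans (solve 2 (λ j k → j :+ k :* j := (k :+ con 1ℚ) :* j) ≡.refl (ι J) (ι K))
             (cong (ℚ._* ι J) (≡.sym (ι-suc K)))))
  product : ι (suc j) ℚ.* unit m ℚ.* ι K ≡ ι (K ℕ.* suc j) ℚ.* unit m
  product = ≡.trans (solve 3 (λ j u k → j :* u :* k := k :* j :* u) ≡.refl (ι (suc j)) (unit m) (ι K))
    (cong (ℚ._* unit m) (≡.sym (ι-* K (suc j))))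

-- Of the three errors η, two come from the rate, namely from its distance to c and from replacing n
-- by m, and the third bounds 1 / J.
upper-bound : ∀ x e e′ q η u → x ≤ (1ℝ - e′) + fromℚ u → e ≤ e′ + (fromℚ η + fromℚ η) → u ℚ.≤ η →
  η ℚ.+ η ℚ.+ η ℚ.≤ q → x ≤ (1ℝ - e) + fromℚ q
upper-bound x e e′ q η u x≤ e≤ u≤η 3η≤q = begin
    x
      ≲⟨ x≤ ⟩
    (1ℝ - e′) + fromℚ u
      ≲⟨ +-mono (1ℝ - e′) (1ℝ - e + (fromℚ η + fromℚ η)) (fromℚ u) (fromℚ η)
           (≤-rearrange e (e′ + (fromℚ η + fromℚ η)) (1ℝ - e′) (1ℝ - e + (fromℚ η + fromℚ η)) e≤
             λ n → solve 3 (λ e e′ h → e′ :+ (h :+ h) :- e := con 1ℚ :- e :+ (h :+ h) :- (con 1ℚ :- e′)) ≡.refl (seq e n) (seq e′ n) η)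
           (fromℚ-mono u≤η) ⟩
    1ℝ - e + (fromℚ η + fromℚ η) + fromℚ η
      ≲⟨ eventually⇒≤ 0 (λ n _ → ℚ.≤-trans (ℚ.≤-reflexive (ℚ.+-assoc (1ℚ ℚ.- seq e n) (η ℚ.+ η) η))
           (ℚ.+-monoʳ-≤ (1ℚ ℚ.- seq e n) 3η≤q)) ⟩
    (1ℝ - e) + fromℚ q ∎
  where open ≤-Reasoning

lower-bound : ∀ x e e′ q → 1ℝ - e′ ≤ x → e′ ≤ e + fromℚ q → 1ℝ - e ≤ x + fromℚ q
lower-bound x e e′ q ≤x e′≤ = begin
    1ℝ - e
      ≲⟨ ≤-rearrange e′ (e + fromℚ q) (1ℝ - e) (1ℝ - e′ + fromℚ q) e′≤
           (λ n → solve 3 (λ e e′ q → e :+ q :- e′ := con 1ℚ :- e′ :+ q :- (con 1ℚ :- e)) ≡.refl (seq e n) (seq e′ n) q) ⟩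
    1ℝ - e′ + fromℚ q
      ≲⟨ +-monoˡ-≤ (fromℚ q) (1ℝ - e′) x ≤x ⟩
    x + fromℚ q ∎
  where open ≤-Reasoning

thirds : ∀ q → 0ℚ ℚ.< q → ∃ λ η → 0ℚ ℚ.< η × η ℚ.+ η ℚ.+ η ℚ.≤ q
thirds q 0<q =
  let h , 0<h , h+h≡q = halve q 0<q
      η , 0<η , η+η≡h = halve h 0<h
  in η , 0<η , let open ℚ.≤-Reasoning in begin
    η ℚ.+ η ℚ.+ η             ≤⟨ p≤p+q (η ℚ.+ η ℚ.+ η) (ℚ.<⇒≤ 0<η) ⟩
    η ℚ.+ η ℚ.+ η ℚ.+ η       ≡⟨ ℚ.+-assoc (η ℚ.+ η) η η ⟩
    (η ℚ.+ η) ℚ.+ (η ℚ.+ η)   ≡⟨ cong₂ ℚ._+_ η+η≡h η+η≡h ⟩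
    h ℚ.+ h                   ≡⟨ h+h≡q ⟩
    q                         ∎

decompose : ∀ j M n → suc j ℕ.+ suc M ℕ.≤ n → ∃ λ m → M ℕ.≤ m × n ≡ suc j ℕ.+ suc m
decompose j M n le = n ℕ.∸ (suc j ℕ.+ suc M) ℕ.+ M , ℕ.m≤n+m M _ ,
  ≡.trans (≡.sym (ℕ.m+[n∸m]≡n le)) (begin
    suc j ℕ.+ suc M ℕ.+ d        ≡⟨ ℕ.+-assoc (suc j) (suc M) d ⟩
    suc j ℕ.+ (suc M ℕ.+ d)      ≡⟨ cong (λ k → suc j ℕ.+ suc k) (ℕ.+-comm M d) ⟩
    suc j ℕ.+ suc (d ℕ.+ M)      ∎)
  where
  open ≡.≡-Reasoning
  d = n ℕ.∸ (suc j ℕ.+ suc M)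

module Rates (α : ℝ) (α>0 : 0ℝ < α) (c : ℝ) (0≤c : 0ℝ ≤ c) where

  upper-at : ∀ x q η K j m → IsOPTdet α α>0 (suc j ℕ.+ suc m) x →
    0ℚ ℚ.< η → η ℚ.+ η ℚ.+ η ℚ.≤ q → c + fromℚ η ≤ fromℚ (ι K) →
    unit j ℚ.≤ η → ι (K ℕ.* suc j) ℚ.* unit m ℚ.≤ η →
    α * fromℚ (unit (j ℕ.+ suc m)) ≤ c + fromℚ η → x ≤ (1ℝ - exp (- c)) + fromℚ q
  upper-at x q η K j m isOPT 0<η 3η≤q c+η≤K uj≤η small rate≤ =
    upper-bound x (exp (- c)) (exp (- (α * fromℚ (unit m)))) q η (unit j)
      (UpperBound.OPTdet-upper α α>0 j m x isOPT)
      (exp-neg-lipschitz (α * fromℚ (unit m)) c (fromℚ η + fromℚ η) 0≤c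
        (eventually⇒≤ 0 λ _ _ → RationalAnalysis.+-nonNeg (ℚ.<⇒≤ 0<η) (ℚ.<⇒≤ 0<η))
        (≤-trans (shifted-rate α c K j m η rate≤ (≤-trans rate≤ c+η≤K) small)
          (≈⇒≤ (+-assoc-≈ c (fromℚ η) (fromℚ η)))))
      uj≤η 3η≤q

  lower-at : ∀ x q n → IsOPTdet α α>0 (suc n) x → 0ℚ ℚ.< q → c ≤ α * fromℚ (unit n) + fromℚ q →
    1ℝ - exp (- c) ≤ x + fromℚ q
  lower-at x q n isOPT 0<q c≤ =
    lower-bound x (exp (- c)) (exp (- (α * fromℚ (unit n)))) q
      (Secretary.OPTdet-lower α α>0 n x isOPT)
      (exp-neg-lipschitz c (α * fromℚ (unit n)) (fromℚ q)
        (*-nonNegative α (fromℚ (unit n)) (<⇒≤ 0ℝ α α>0) (fromℚ-mono (unit-nonNeg n)))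
        (fromℚ-nonNeg q 0<q) c≤)

  -- The rate t is a variable, and n an equation, so that no two forms of the same
  -- real number are compared below an operation.
  bounds : ∀ x q η K j m n t → IsOPTdet α α>0 n x → n ≡ suc j ℕ.+ suc m → t ≡ α * fromℚ (unit (j ℕ.+ suc m)) →
    0ℚ ℚ.< q → 0ℚ ℚ.< η → η ℚ.+ η ℚ.+ η ℚ.≤ q → c + fromℚ η ≤ fromℚ (ι K) →
    unit j ℚ.≤ η → ι (K ℕ.* suc j) ℚ.* unit m ℚ.≤ η →
    t ≤ c + fromℚ η → c ≤ t + fromℚ η →
    x ≤ (1ℝ - exp (- c)) + fromℚ q × 1ℝ - exp (- c) ≤ x + fromℚ q
  bounds x q η K j m n _ isOPT n≡ ≡.refl 0<q 0<η 3η≤q c+η≤K uj≤η small rate≤ c≤ =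
    upper-at x q η K j m (subst (λ k → IsOPTdet α α>0 k x) {x = n} {y = suc j ℕ.+ suc m} n≡ isOPT) 0<η 3η≤q c+η≤K uj≤η small rate≤ ,
    lower-at x q (j ℕ.+ suc m) (subst (λ k → IsOPTdet α α>0 k x) {x = n} {y = suc (j ℕ.+ suc m)} n≡ isOPT) 0<q
      (≤-trans c≤ (+-mono (α * fromℚ (unit (j ℕ.+ suc m))) (α * fromℚ (unit (j ℕ.+ suc m))) (fromℚ η) (fromℚ q)
        ≤-refl (fromℚ-mono η≤q)))
    where
    η≤q = ℚ.≤-trans (ℚ.≤-trans (p≤p+q η (ℚ.<⇒≤ 0<η)) (p≤p+q (η ℚ.+ η) (ℚ.<⇒≤ 0<η))) 3η≤q

-- The order of the choices matters: q gives η, then K bounds c + η, then j makes 1 / (j + 1) ≤ η,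
-- and only then M makes K (j + 1) / (m + 1) ≤ η for all m ≥ M.
OPTdet-limit : (α : Sequence) (α>0 : (n : ℕ) → .{{_ : NonZero n}} → 0ℝ < α n) (x : Sequence) →
  ((n : ℕ) → .{{_ : NonZero n}} → IsOPTdet (α n) (α>0 n) n (x n)) → ∀ c → 0ℝ ≤ c →
  (λ n → α n /ℕ n) ⟶ c → ∀ q → 0ℚ ℚ.< q → Within x (1ℝ - exp (- c)) q
OPTdet-limit α α>0 x isOPT c 0≤c rate q 0<q = scale (thirds q 0<q)
  where
  scale : (∃ λ η → 0ℚ ℚ.< η × η ℚ.+ η ℚ.+ η ℚ.≤ q) → Within x (1ℝ - exp (- c)) q
  scale (η , 0<η , 3η≤q) =
      assemble (eventually-≤ι (c + fromℚ η)) (unit-small 1 η 0<η) 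
        (⟶⇒Within (λ n {{nz}} → _/ℕ_ (α n {{nz}}) n {{nz}}) c rate η 0<η)
    where
    at : ∀ K j M n → .{{_ : NonZero n}} → c + fromℚ η ≤ fromℚ (ι K) → unit j ℚ.≤ η →
      (∀ m → M ℕ.≤ m → ι (K ℕ.* suc j) ℚ.* unit m ℚ.≤ η) →
      (∃ λ m → M ℕ.≤ m × n ≡ suc j ℕ.+ suc m) →
      α n /ℕ n ≤ c + fromℚ η × c ≤ α n /ℕ n + fromℚ η →
      x n ≤ (1ℝ - exp (- c)) + fromℚ q × 1ℝ - exp (- c) ≤ x n + fromℚ q
    at K j M n {{nz}} c+η≤K uj≤η small (m , M≤m , n≡) (rate≤ , c≤) =
      Rates.bounds (α n {{nz}}) (α>0 n {{nz}}) c 0≤c (x n {{nz}}) q η K j m n _ (isOPT n {{nz}}) n≡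
        (/ℕ-as-* (α n {{nz}}) n (unit (j ℕ.+ suc m)) {{nz}} (1/-unit n (j ℕ.+ suc m) {{nz}} n≡))
        0<q 0<η 3η≤q c+η≤K uj≤η (small m M≤m) rate≤ c≤
    assemble : (∃ λ K → ∃ λ N → ∀ n → N ℕ.≤ n → ℚ.∣ seq c n ℚ.+ η ∣ ℚ.≤ ι K) →
      (∃ λ j → ∀ m → j ℕ.≤ m → ι 1 ℚ.* unit m ℚ.≤ η) → Within (λ n → α n /ℕ n) c η →
      Within x (1ℝ - exp (- c)) q
    assemble (K , N₀ , bound) (j , small₁) (N , close) = conclude (unit-small (K ℕ.* suc j) η 0<η)
      where
      c+η≤K : c + fromℚ η ≤ fromℚ (ι K)
      c+η≤K = eventually⇒≤ N₀ λ n N₀≤n → ℚ.≤-trans (p≤∣p∣ (seq c n ℚ.+ η)) (bound n N₀≤n)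
      uj≤η : unit j ℚ.≤ η
      uj≤η = ℚ.≤-trans (ℚ.≤-reflexive (≡.sym (ℚ.*-identityˡ (unit j)))) (small₁ j ℕ.≤-refl)
      conclude : (∃ λ M → ∀ m → M ℕ.≤ m → ι (K ℕ.* suc j) ℚ.* unit m ℚ.≤ η) → Within x (1ℝ - exp (- c)) q
      -- From the second bound on, n is (j + 1) + (m + 1) with m ≥ M; from N on, the rate is within
      -- η of c.
      conclude (M , small₂) = N ℕ.⊔ (suc j ℕ.+ suc M) , λ n {{nz}} le →
        at K j M n {{nz}} c+η≤K uj≤η small₂
          (decompose j M n (ℕ.m⊔n≤o⇒n≤o N (suc j ℕ.+ suc M) le))
          (close n {{nz}} (ℕ.m⊔n≤o⇒m≤o N (suc j ℕ.+ suc M) le))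

1-exp0≈0 : 1ℝ - exp (- 0ℝ) ≈ 0ℝ
1-exp0≈0 = pointwise λ n → ≡.trans (cong (λ e → 1ℚ ℚ.- e) (ExponentialSeries.E-zero n)) (ℚ.+-inverseʳ 1ℚ)

Within-cong : ∀ x L L′ q → L ≈ L′ → Within x L q → Within x L′ q
Within-cong x L L′ q (mk≈ L≤L′ L′≤L) (N , h) = N , λ n N≤n →
  ≤-trans (proj₁ (h n N≤n)) (+-monoˡ-≤ (fromℚ q) L L′ L≤L′) ,
  ≤-trans L′≤L (proj₂ (h n N≤n))

corollary7 : (α : Sequence) (α>0 : (n : ℕ) → .{{_ : NonZero n}} → 0ℝ < α n) →
    ((n : ℕ) → .{{_ : NonZero n}} → ∃ λ x → IsOPTdet (α n) (α>0 n) n x) ×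
    ((OPTdet : Sequence) →
    ((n : ℕ) → .{{_ : NonZero n}} → IsOPTdet (α n) (α>0 n) n (OPTdet n)) →
    ((λ n → α n /ℕ n) ⟶ 0ℝ → OPTdet ⟶ 0ℝ) ×
    ((c : ℝ) → 0ℝ < c → (λ n → α n /ℕ n) ⟶ c → OPTdet ⟶ (1ℝ - exp (- c))))
corollary7 α α>0 =
    -- Existence of the optimum for every length keeps the limit statements from being vacuous.
    (λ { (suc n) {{nz}} → Secretary.OPTdet-exists (α (suc n) {{nz}}) (α>0 (suc n) {{nz}}) n }) ,
    λ OPTdet isOPT →
      -- The case α = o(n) is the limit at c = 0, where 1 - e ^ (- c) vanishes.
      (λ rate → Within⇒⟶ OPTdet 0ℝ λ q 0<q → Within-cong OPTdet (1ℝ - exp (- 0ℝ)) 0ℝ q 1-exp0≈0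
        (OPTdet-limit α α>0 OPTdet isOPT 0ℝ ≤-refl rate q 0<q)) ,
      λ c 0<c rate → Within⇒⟶ OPTdet (1ℝ - exp (- c))
        (OPTdet-limit α α>0 OPTdet isOPT c (<⇒≤ 0ℝ c 0<c) rate)
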